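{- Let $G$ be a unicyclic graph on $n$ vertices and let $uv$ be a nonpendent edge of $G$ not lying on the cycle of $G$. Let $G_{uv}$ be the graph obtained from $G$ by identifying $u$ and $v$ into a single new vertex $w$ (deleting the edge $uv$; $w$ is adjacent to all other neighbours of $u$ and of $v$) and then adding a new vertex $w'$ together with the pendent edge $ww'$. Then $\varphi_i(G)\ge\varphi_i(G_{uv})$ for $i=0,1,\dots,n$, with equality if and only if $i\in\{0,1,n\}$ when $G$ is non-bipartite, or $i\in\{0,1,n-1,n\}$ when $G$ is bipartite.
   Context: A unicyclic graph is a simple connected graph containing exactly one cycle. An edge is pendent if one of its endpoints has degree 1; otherwise it is nonpendent. For a graph $G$ on $n$ vertices let $Q(G)=D(G)+A(G)$ be its signless Laplacian matrix ($D(G)$ degree diagonal matrix, $A(G)$ adjacency matrix), and write $\det(xI-Q(G))=\sum_{i=0}^{n}(-1)^i\varphi_i(G)x^{n-i}$. -}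

module Defs where

open import Data.Bool using (Bool; true; false; if_then_else_; _∧_; _∨_; not)
open import Data.Nat using (ℕ; zero; suc; _≤_; _∸_)
import Data.Nat as ℕ
open import Data.Integer using (ℤ; +_; -_; _+_; _*_; _^_)
open import Data.Fin using (Fin; zero; suc; toℕ; punchIn; _≟_)
open import Data.List using (List; []; _∷_; map)
open import Data.Product using (Σ; ∃; _×_; _,_; proj₁)
open import Data.Sum using (_⊎_)
open import Relation.Nullary using (¬_)
open import Relation.Nullary.Decidable using (⌊_⌋)
open import Relation.Binary.PropositionalEquality using (_≡_)
open import Function.Bundles using (_⇔_)

Adj : ℕ → Set
Adj n = Fin n → Fin n → Bool

IsSimple : ∀ {n} → Adj n → Set
IsSimple {n} A = (∀ x y → A x y ≡ A y x) × (∀ x → A x x ≡ false)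

sumℕ : ∀ {m} → (Fin m → ℕ) → ℕ
sumℕ {zero} f = 0
sumℕ {suc m} f = f zero ℕ.+ sumℕ (λ j → f (suc j))

deg : ∀ {n} → Adj n → Fin n → ℕ
deg A i = sumℕ (λ j → if A i j then 1 else 0)

data Reach {n} (A : Adj n) : Fin n → Fin n → Set where
  here : ∀ {x} → Reach A x x
  step : ∀ {x y z} → A x y ≡ true → Reach A y z → Reach A x z

Connected : ∀ {n} → Adj n → Set
Connected A = ∀ x y → Reach A x y

CSucc : (k : ℕ) → Fin k → Fin k → Set
CSucc k i j = (suc (toℕ i) ≡ toℕ j) ⊎ ((suc (toℕ i) ≡ k) × (toℕ j ≡ 0))

record Cycle {n} (A : Adj n) : Set where
  field
    len    : ℕ
    len≥3  : 3 ≤ len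
    vert   : Fin len → Fin n
    inj    : ∀ i j → vert i ≡ vert j → i ≡ j
    closed : ∀ i j → CSucc len i j → A (vert i) (vert j) ≡ true

CycleEdge : ∀ {n} {A : Adj n} → Cycle A → Fin n → Fin n → Set
CycleEdge C a b = ∃ λ i → ∃ λ j → CSucc len i j ×
    (((vert i ≡ a) × (vert j ≡ b)) ⊎ ((vert i ≡ b) × (vert j ≡ a)))
  where open Cycle C

SameCycle : ∀ {n} {A : Adj n} → Cycle A → Cycle A → Set
SameCycle {n} C D = ∀ (a b : Fin n) → CycleEdge C a b ⇔ CycleEdge D a b

Unicyclic : ∀ {n} → Adj n → Set
Unicyclic A = IsSimple A × Connected A × (Σ (Cycle A) λ C → ∀ D → SameCycle D C)

Bipartite : ∀ {n} → Adj n → Set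
Bipartite {n} A = Σ (Fin n → Bool) λ c → ∀ x y → A x y ≡ true → ¬ (c x ≡ c y)

-- G_uv, realised on the same vertex set Fin n: vertex u plays the role of
-- the merged vertex w, vertex v plays the role of the new pendent vertex w'.

_==_ : ∀ {n} → Fin n → Fin n → Bool
x == y = ⌊ x ≟ y ⌋

contractPendent : ∀ {n} → Adj n → Fin n → Fin n → Adj n
contractPendent A u v x y =
  if x == v then y == u else
  if y == v then x == u else
  if x == u then (not (y == u) ∧ (A u y ∨ A v y)) else
  if y == u then (A u x ∨ A v x) else
  A x y

-- Polynomials over ℤ as coefficient lists (constant term first).

Poly : Set
Poly = List ℤ

_⊕_ : Poly → Poly → Poly
[] ⊕ q = q
(a ∷ p) ⊕ [] = a ∷ p
(a ∷ p) ⊕ (b ∷ q) = (a + b) ∷ (p ⊕ q)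

_⊗_ : Poly → Poly → Poly
[] ⊗ q = []
(a ∷ p) ⊗ q = map (a *_) q ⊕ (+ 0 ∷ (p ⊗ q))

coeff : Poly → ℕ → ℤ
coeff [] k = + 0
coeff (a ∷ p) zero = a
coeff (a ∷ p) (suc k) = coeff p k

sumP : ∀ {m} → (Fin m → Poly) → Poly
sumP {zero} f = []
sumP {suc m} f = f zero ⊕ sumP (λ j → f (suc j))

det : ∀ m → (Fin m → Fin m → Poly) → Poly
det zero M = + 1 ∷ []
det (suc m) M = sumP λ j →
  (((- + 1) ^ toℕ j) ∷ []) ⊗ (M zero j ⊗ det m (λ a b → M (suc a) (punchIn j b)))

Q : ∀ {n} → Adj n → Fin n → Fin n → ℤ
Q A i j = if i == j then + deg A i else (if A i j then + 1 else + 0)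

charPolyQ : ∀ {n} → Adj n → Poly
charPolyQ {n} A = det n (λ i j → if i == j then (- Q A i j) ∷ + 1 ∷ [] else (- Q A i j) ∷ [])

-- det(xI − Q) = Σ (−1)^i φ_i x^{n−i}
φ : ∀ {n} → Adj n → ℕ → ℤ
φ {n} A i = ((- + 1) ^ i) * coeff (charPolyQ A) (n ∸ i)

{-# OPTIONS --safe #-}
-- Write B for the graph G minus the bridge uv, and χ for the characteristic polynomial of Q.
-- Since B is block diagonal for the two sides of the bridge, expanding determinants along the
-- rows u and v gives
--   χ(G) − χ(G_uv) = det (x D − Q(B)),
-- where D is the identity matrix with its (u,u) and (v,v) entries replaced by 0.  Hence
-- φ_i(G) − φ_i(G_uv) is the sum of the principal minors of Q(B) on the i-element vertex sets
-- containing u and v.  As xᵀQ(B)x = Σ (x_p + x_q)² over the edges pq of B, such a minor is zero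
-- if the vertex set contains a whole bipartite side, and positive otherwise.  Only one side
-- can contain the cycle, so at least one side is bipartite, and both are iff G is.
-- Polynomial identities are checked by evaluating at all integers.
module Submission where

open import Defs
open import Data.Bool using (Bool; true; false; if_then_else_; _∧_; _∨_; not)
import Data.Bool as Bool
import Data.Bool.Properties as Boolₚ
open import Data.Nat using (ℕ; zero; suc; z≤n; s≤s; _≤_; _∸_)
import Data.Nat as ℕ
import Data.Nat.Properties as ℕₚ
open import Data.Integer using (ℤ; +_; -_; _+_; _*_; _^_; 0ℤ; 1ℤ; -1ℤ; _<_; +<+) renaming (_≤_ to _≤ℤ_)
import Data.Integer as ℤ
import Data.Integer.Properties as ℤₚ
open import Data.Integer.Tactic.RingSolver using (solve-∀)
open import Data.Fin using (Fin; zero; suc; toℕ; fromℕ<; punchIn; _≟_)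
import Data.Fin.Properties as Finₚ
open import Data.Fin.Subset.Properties using (anySubset?)
open import Data.List using (List; []; _∷_; map; length; cartesianProduct; allFin)
import Data.List as List
open import Data.List.Membership.Propositional using (_∈_)
open import Data.List.Membership.Propositional.Properties using (∈-lookup; ∈-allFin; ∈-cartesianProduct⁺)
import Data.List.Relation.Unary.Any as Any
open Any using (here; there)
import Data.List.Relation.Unary.All as All
open All using ([]; _∷_)
open import Data.List.Relation.Unary.All.Properties using (¬Any⇒All¬)
open import Data.List.Relation.Unary.AllPairs using ([]; _∷_)
open import Data.List.Relation.Unary.Unique.Propositional using (Unique)
open import Data.Vec using (Vec; []; _∷_; lookup; tabulate)
import Data.Vec.Properties as Vecₚ
import Data.Vec.Functional as Vector
open import Data.Product using (Σ; ∃; _×_; _,_; proj₁; proj₂)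
open import Data.Sum using (_⊎_; inj₁; inj₂)
open import Data.Empty using (⊥; ⊥-elim)
open import Function using (_∘_; flip)
open import Function.Bundles using (_⇔_; mk⇔; Equivalence)
open import Relation.Nullary using (¬_; yes; no; Dec)
open import Relation.Nullary.Decidable using (_×-dec_; _→-dec_; ¬?; ⌊_⌋; map′; decidable-stable)
open import Relation.Binary.PropositionalEquality
import Algebra.Properties.Semiring.Sum ℤₚ.+-*-semiring as Sum

-- The identity rests on a 2×2 block common to both graphs. In G as in G_uv one edge joins the two
-- vertices `u`, `v`; in x - Q it contributes -1 off the diagonal and lowers the two diagonal
-- entries by 1. Giving the x of rows u and v to this block, with diagonal x - 1, is what puts the
-- two zeros into D. All terms using a row of the block have the same total for both graphs. The
-- term using none of them is the determinant of the remaining matrix for G, and is absent for G_uv,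
-- whose pendent row comes from the block alone.
--
-- A principal minor is encoded as the determinant of a full-size matrix with unit rows outside the
-- vertex set. That matrix is not symmetric, so positivity is derived from a criterion for
-- P-matrices, which stays inside ℤ.
--
-- The indices of equality come from counting. A nonzero minor needs a set that contains u and v and
-- omits a vertex of each bipartite side: one omission if G is non-bipartite, two if it is
-- bipartite. The omitted vertices differ from u and v, and the degree hypotheses supply such a
-- vertex on each side.

-- Determinants

-- Opaque so that unification can read f off ∑ f.
opaque
  ∑ : ∀ {n} → (Fin n → ℤ) → ℤ
  ∑ = Sum.sum

  ∑-empty : ∀ {f : Fin 0 → ℤ} → ∑ f ≡ 0ℤ
  ∑-empty = refl

  ∑-suc : ∀ {n} {f : Fin (suc n) → ℤ} → ∑ f ≡ f zero + ∑ (λ i → f (suc i))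
  ∑-suc = refl

  ∑-cong : ∀ {n} {f g : Fin n → ℤ} → (∀ i → f i ≡ g i) → ∑ f ≡ ∑ g
  ∑-cong = Sum.sum-cong-≗

  ∑-zero : ∀ {n} {f : Fin n → ℤ} → (∀ i → f i ≡ 0ℤ) → ∑ f ≡ 0ℤ
  ∑-zero {n} f≡0 = trans (Sum.sum-cong-≗ f≡0) (Sum.sum-replicate-zero n)

  ∑-+ : ∀ {n} {f g : Fin n → ℤ} → ∑ (λ i → f i + g i) ≡ ∑ f + ∑ g
  ∑-+ {f = f} {g} = Sum.∑-distrib-+ f g

  ∑-*ˡ : ∀ {n} c (f : Fin n → ℤ) → ∑ (λ i → c * f i) ≡ c * ∑ f
  ∑-*ˡ c f = sym (Sum.*-distribˡ-sum c f)

  ∑-comm : ∀ {m n} {f : Fin m → Fin n → ℤ} → ∑ (λ i → ∑ (f i)) ≡ ∑ (λ j → ∑ (λ i → f i j))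
  ∑-comm {f = f} = Sum.∑-comm f

Mat : ℕ → Set
Mat n = Fin n → Fin n → ℤ

infix 4 _≐_
_≐_ : ∀ {n} → Mat n → Mat n → Set
M ≐ P = ∀ i j → M i j ≡ P i j

sgn : ∀ {n} → Fin n → ℤ
sgn j = -1ℤ ^ toℕ j

minor : ∀ {n} → Mat (suc n) → Fin (suc n) → Mat n
minor M j a b = M (suc a) (punchIn j b)

detℤ : ∀ n → Mat n → ℤ
detℤ zero    M = 1ℤ
detℤ (suc n) M = ∑ λ j → sgn j * (M zero j * detℤ n (minor M j))

laplace : ∀ {n} → Mat (suc n) → Fin (suc n) → ℤ
laplace {n} M j = sgn j * (M zero j * detℤ n (minor M j))

det-cong : ∀ {n} {M P : Mat n} → M ≐ P → detℤ n M ≡ detℤ n P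
det-cong {zero}  M≐P = refl
det-cong {suc n} M≐P = ∑-cong λ j →
  cong (sgn j *_) (cong₂ _*_ (M≐P zero j) (det-cong λ a b → M≐P (suc a) (punchIn j b)))

det-add : ∀ {n} (i : Fin n) {M P R : Mat n} → (∀ j → M i j ≡ P i j + R i j) →
  (∀ k → k ≢ i → ∀ j → M k j ≡ P k j) → (∀ k → k ≢ i → ∀ j → M k j ≡ R k j) →
  detℤ n M ≡ detℤ n P + detℤ n R
det-add {suc n} zero {M} {P} {R} h p r = trans (∑-cong term) ∑-+
  where
  distrib : ∀ s x y d → s * ((x + y) * d) ≡ s * (x * d) + s * (y * d)
  distrib = solve-∀
  term : ∀ j → sgn j * (M zero j * detℤ n (minor M j)) ≡
    sgn j * (P zero j * detℤ n (minor P j)) + sgn j * (R zero j * detℤ n (minor R j))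
  term j = begin
    sgn j * (M zero j * detℤ n (minor M j))
      ≡⟨ cong (λ m → sgn j * (m * detℤ n (minor M j))) (h j) ⟩
    sgn j * ((P zero j + R zero j) * detℤ n (minor M j))
      ≡⟨ distrib (sgn j) (P zero j) (R zero j) _ ⟩
    sgn j * (P zero j * detℤ n (minor M j)) + sgn j * (R zero j * detℤ n (minor M j))
      ≡⟨ cong₂ (λ d e → sgn j * (P zero j * d) + sgn j * (R zero j * e))
           (det-cong λ a b → p (suc a) (λ ()) _) (det-cong λ a b → r (suc a) (λ ()) _) ⟩
    _ ∎ where open ≡-Reasoning
det-add {suc n} (suc i) {M} {P} {R} h p r = trans (∑-cong term) ∑-+
  where
  distrib : ∀ s x d e → s * (x * (d + e)) ≡ s * (x * d) + s * (x * e)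
  distrib = solve-∀
  term : ∀ j → sgn j * (M zero j * detℤ n (minor M j)) ≡
    sgn j * (P zero j * detℤ n (minor P j)) + sgn j * (R zero j * detℤ n (minor R j))
  term j = begin
    sgn j * (M zero j * detℤ n (minor M j))
      ≡⟨ cong (λ d → sgn j * (M zero j * d)) (det-add i (λ b → h (punchIn j b))
           (λ k k≢i b → p (suc k) (k≢i ∘ λ { refl → refl }) _)
           (λ k k≢i b → r (suc k) (k≢i ∘ λ { refl → refl }) _)) ⟩
    sgn j * (M zero j * (detℤ n (minor P j) + detℤ n (minor R j)))
      ≡⟨ distrib (sgn j) (M zero j) _ _ ⟩
    sgn j * (M zero j * detℤ n (minor P j)) + sgn j * (M zero j * detℤ n (minor R j))
      ≡⟨ cong₂ (λ x y → sgn j * (x * detℤ n (minor P j)) + sgn j * (y * detℤ n (minor R j)))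
           (p zero (λ ()) j) (r zero (λ ()) j) ⟩
    _ ∎ where open ≡-Reasoning

prod : ∀ {n} → (Fin n → ℤ) → ℤ
prod {zero}  c = 1ℤ
prod {suc n} c = c zero * prod (c ∘ suc)

det-scaleRows : ∀ {n} (c : Fin n → ℤ) (M : Mat n) → detℤ n (λ i j → c i * M i j) ≡ prod c * detℤ n M
det-scaleRows {zero}  c M = refl
det-scaleRows {suc n} c M = trans (∑-cong term) (∑-*ˡ (prod c) (laplace M))
  where
  rearrange : ∀ s c₀ m p d → s * (c₀ * m * (p * d)) ≡ c₀ * p * (s * (m * d))
  rearrange = solve-∀
  term : ∀ j → sgn j * (c zero * M zero j * detℤ n (λ a b → c (suc a) * minor M j a b)) ≡
    prod c * (sgn j * (M zero j * detℤ n (minor M j)))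
  term j = trans (cong (λ d → sgn j * (c zero * M zero j * d)) (det-scaleRows (c ∘ suc) (minor M j)))
    (rearrange (sgn j) (c zero) (M zero j) _ _)

setRow : ∀ {n} {V : Set} → (Fin n → V) → Fin n → V → Fin n → V
setRow M i r k with k ≟ i
... | yes _ = r
... | no  _ = M k

setRow-at : ∀ {n} {V : Set} (M : Fin n → V) i r → setRow M i r i ≡ r
setRow-at M i r with i ≟ i
... | yes _ = refl
... | no ¬p = ⊥-elim (¬p refl)

setRow-other : ∀ {n} {V : Set} (M : Fin n → V) {i k} r → k ≢ i → setRow M i r k ≡ M k
setRow-other M {i} {k} r k≢i with k ≟ i
... | yes p = ⊥-elim (k≢i p)
... | no _ = refl

det-scaleRow : ∀ {n} (i : Fin n) (c : ℤ) {M P : Mat n} → (∀ j → M i j ≡ c * P i j) →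
  (∀ k → k ≢ i → ∀ j → M k j ≡ P k j) → detℤ n M ≡ c * detℤ n P
det-scaleRow {suc n} zero c {M} {P} h p = trans (∑-cong term) (∑-*ˡ c (laplace P))
  where
  rearrange : ∀ s c m d → s * (c * m * d) ≡ c * (s * (m * d))
  rearrange = solve-∀
  term : ∀ j → sgn j * (M zero j * detℤ n (minor M j)) ≡ c * (sgn j * (P zero j * detℤ n (minor P j)))
  term j = trans (cong (sgn j *_) (cong₂ _*_ (h j) (det-cong λ a b → p (suc a) (λ ()) _)))
    (rearrange (sgn j) c (P zero j) _)
det-scaleRow {suc n} (suc i) c {M} {P} h p = trans (∑-cong term) (∑-*ˡ c (laplace P))
  where
  rearrange : ∀ s c m d → s * (m * (c * d)) ≡ c * (s * (m * d))
  rearrange = solve-∀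
  term : ∀ j → sgn j * (M zero j * detℤ n (minor M j)) ≡ c * (sgn j * (P zero j * detℤ n (minor P j)))
  term j = trans (cong (sgn j *_) (cong₂ _*_ (p zero (λ ()) j)
      (det-scaleRow i c (λ b → h (punchIn j b)) (λ k k≢i b → p (suc k) (k≢i ∘ λ { refl → refl }) _))))
    (rearrange (sgn j) c (P zero j) _)

-- `G` is evaluated at ordered pairs of distinct columns, and exchanging the two columns reverses
-- the sign. The pairs that start with column zero cancel those that end with it. The rest is the
-- same sum one size lower, since both signs flip there.
alternating-sum : ∀ n (G : Fin (suc n) → Fin (suc n) → ℤ) → (∀ a b → G a b ≡ G b a) →
  ∑ (λ j → ∑ (λ k → sgn j * (sgn k * G j (punchIn j k)))) ≡ 0ℤ
alternating-sum zero    G G-sym = trans ∑-suc (cong₂ _+_ ∑-empty ∑-empty)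
alternating-sum (suc n) G G-sym = begin
  ∑ (λ j → ∑ (λ k → sgn j * (sgn k * G j (punchIn j k))))
      ≡⟨ ∑-suc ⟩
  ∑ row₀ + ∑ (λ j → ∑ (λ k → sgn (suc j) * (sgn k * G (suc j) (punchIn (suc j) k))))
      ≡⟨ cong (λ t → ∑ row₀ + t) (trans (∑-cong λ j → ∑-suc) ∑-+) ⟩
  ∑ row₀ + (∑ col₀ + ∑ (λ j → ∑ (λ k → sgn (suc j) * (sgn (suc k) * G (suc j) (suc (punchIn j k))))))
      ≡⟨ sym (ℤₚ.+-assoc (∑ row₀) _ _) ⟩
  (∑ row₀ + ∑ col₀) + ∑ (λ j → ∑ (λ k → sgn (suc j) * (sgn (suc k) * G (suc j) (suc (punchIn j k)))))
      ≡⟨ cong₂ _+_ (trans (sym ∑-+) (∑-zero cancel))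
           (trans (∑-cong λ j → ∑-cong λ k → signs (sgn j) (sgn k) (G (suc j) (suc (punchIn j k))))
             (alternating-sum n (λ a b → G (suc a) (suc b)) (λ a b → G-sym (suc a) (suc b)))) ⟩
  0ℤ ∎
  where
  open ≡-Reasoning
  row₀ : Fin (suc n) → ℤ
  row₀ k = 1ℤ * (sgn k * G zero (suc k))
  col₀ : Fin (suc n) → ℤ
  col₀ j = sgn (suc j) * (1ℤ * G (suc j) zero)
  opposite : ∀ s g → 1ℤ * (s * g) + (-1ℤ * s) * (1ℤ * g) ≡ 0ℤ
  opposite = solve-∀
  signs : ∀ s t g → (-1ℤ * s) * ((-1ℤ * t) * g) ≡ s * (t * g)
  signs = solve-∀
  cancel : ∀ k → row₀ k + col₀ k ≡ 0ℤ
  cancel k = trans (cong (λ g → row₀ k + sgn (suc k) * (1ℤ * g)) (G-sym (suc k) zero)) (opposite (sgn k) (G zero (suc k)))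

-- The increasing enumeration of Fin (2 + n) ∖ {a, b}; its values are irrelevant when a ≡ b.
skip₂ : ∀ {n} → Fin (suc (suc n)) → Fin (suc (suc n)) → Fin n → Fin (suc (suc n))
skip₂ zero    zero    c       = suc (suc c)
skip₂ zero    (suc b) c       = suc (punchIn b c)
skip₂ (suc a) zero    c       = suc (punchIn a c)
skip₂ (suc a) (suc b) zero    = zero
skip₂ (suc a) (suc b) (suc c) = suc (skip₂ a b c)

skip₂-comm : ∀ {n} a b (c : Fin n) → skip₂ a b c ≡ skip₂ b a c
skip₂-comm zero    zero    c       = refl
skip₂-comm zero    (suc b) c       = refl
skip₂-comm (suc a) zero    c       = refl
skip₂-comm (suc a) (suc b) zero    = refl
skip₂-comm (suc a) (suc b) (suc c) = cong suc (skip₂-comm a b c)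

skip₂-punchIn : ∀ {n} j k (c : Fin n) → skip₂ j (punchIn j k) c ≡ punchIn j (punchIn k c)
skip₂-punchIn zero    k       c       = refl
skip₂-punchIn (suc j) zero    c       = refl
skip₂-punchIn (suc j) (suc k) zero    = refl
skip₂-punchIn (suc j) (suc k) (suc c) = cong suc (skip₂-punchIn j k c)

-- Expanding along two rows gives a sum over ordered pairs of columns. When the rows are equal, the
-- unsigned factor is symmetric in the pair.
det-alt₀₁ : ∀ {n} (M : Mat (suc (suc n))) → (∀ j → M zero j ≡ M (suc zero) j) → detℤ (suc (suc n)) M ≡ 0ℤ
det-alt₀₁ {n} M h = trans (∑-cong term) (alternating-sum (suc n) G G-sym)
  where
  G : Fin (suc (suc n)) → Fin (suc (suc n)) → ℤ
  G a b = M zero a * M zero b * detℤ n (λ p c → M (suc (suc p)) (skip₂ a b c))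
  G-sym : ∀ a b → G a b ≡ G b a
  G-sym a b = cong₂ _*_ (ℤₚ.*-comm (M zero a) (M zero b))
    (det-cong λ p c → cong (M (suc (suc p))) (skip₂-comm a b c))
  rearrange : ∀ s m t m′ d → s * (m * (t * (m′ * d))) ≡ s * (t * (m * m′ * d))
  rearrange = solve-∀
  term : ∀ j → sgn j * (M zero j * detℤ (suc n) (minor M j)) ≡
    ∑ (λ k → sgn j * (sgn k * G j (punchIn j k)))
  term j = trans (cong (sgn j *_) (sym (∑-*ˡ (M zero j) (laplace (minor M j))))) (trans (sym (∑-*ˡ (sgn j) _))
    (∑-cong λ k → trans (rearrange (sgn j) (M zero j) (sgn k) _ _)
      (cong (λ x → sgn j * (sgn k * x)) (cong₂ _*_ (cong (M zero j *_) (sym (h (punchIn j k))))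
        (det-cong λ p c → cong (M (suc (suc p))) (sym (skip₂-punchIn j k c)))))))

AltAt : ∀ n → Fin n → Fin n → Set
AltAt n i j = ∀ (M : Mat n) → (∀ k → M i k ≡ M j k) → detℤ n M ≡ 0ℤ

setRows : ∀ {n} {V : Set} → (Fin n → V) → Fin n → V → Fin n → V → Fin n → V
setRows M i p j q = setRow (setRow M j q) i p

-- With all other rows frozen, the determinant becomes an alternating bilinear form in two rows. The
-- graphs are later compared through this form in the rows of `u` and `v`.
bracket : ∀ {n} → Mat n → Fin n → Fin n → (Fin n → ℤ) → (Fin n → ℤ) → ℤ
bracket {n} M i j p q = detℤ n (setRows M i p j q)

module Bracket {n} (M : Mat n) {i j : Fin n} (i≢j : i ≢ j) where
  ⟨_,_⟩ : (Fin n → ℤ) → (Fin n → ℤ) → ℤ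
  ⟨_,_⟩ = bracket M i j

  atˡ : ∀ p q → setRows M i p j q i ≡ p
  atˡ p q = setRow-at (setRow M j q) i p

  atʳ : ∀ p q → setRows M i p j q j ≡ q
  atʳ p q = trans (setRow-other (setRow M j q) p (i≢j ∘ sym)) (setRow-at M j q)

  at-other : ∀ p q {k} → k ≢ i → k ≢ j → setRows M i p j q k ≡ M k
  at-other p q k≢i k≢j = trans (setRow-other (setRow M j q) p k≢i) (setRow-other M q k≢j)

  rows-other : ∀ p q p′ q′ k → k ≢ i → k ≢ j → ∀ l → setRows M i p j q k l ≡ setRows M i p′ j q′ k l
  rows-other p q p′ q′ k k≢i k≢j l = cong-app (trans (at-other p q k≢i k≢j) (sym (at-other p′ q′ k≢i k≢j))) l

  fixʳ : ∀ p p′ q k → k ≢ i → ∀ l → setRows M i p j q k l ≡ setRows M i p′ j q k l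
  fixʳ p p′ q k k≢i l with k ≟ j
  ... | yes refl = cong-app (trans (atʳ p q) (sym (atʳ p′ q))) l
  ... | no k≢j = rows-other p q p′ q k k≢i k≢j l

  fixˡ : ∀ p q q′ k → k ≢ j → ∀ l → setRows M i p j q k l ≡ setRows M i p j q′ k l
  fixˡ p q q′ k k≢j l with k ≟ i
  ... | yes refl = refl
  ... | no k≢i = cong-app (trans (setRow-other M q k≢j) (sym (setRow-other M q′ k≢j))) l

  det≡⟨⟩ : ∀ P → (∀ k → k ≢ i → k ≢ j → ∀ l → P k l ≡ M k l) → detℤ n P ≡ ⟨ P i , P j ⟩
  det≡⟨⟩ P h = det-cong pt
    where
    pt : ∀ a b → P a b ≡ setRows M i (P i) j (P j) a b
    pt a b with a ≟ i
    ... | yes refl = refl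
    ... | no a≢i with a ≟ j
    ... | yes refl = refl
    ... | no a≢j = h a a≢i a≢j b

  ⟨⟩-cong : ∀ {p p′ q q′} → (∀ k → p k ≡ p′ k) → (∀ k → q k ≡ q′ k) → ⟨ p , q ⟩ ≡ ⟨ p′ , q′ ⟩
  ⟨⟩-cong {p} {p′} {q} {q′} e f = det-cong pt
    where
    pt : ∀ a b → setRows M i p j q a b ≡ setRows M i p′ j q′ a b
    pt a b with a ≟ i
    ... | yes _ = e b
    ... | no _ with a ≟ j
    ... | yes _ = f b
    ... | no _ = refl

  addˡ : ∀ p p′ q → ⟨ (λ k → p k + p′ k) , q ⟩ ≡ ⟨ p , q ⟩ + ⟨ p′ , q ⟩
  addˡ p p′ q = det-add i
    (λ l → trans (cong-app (atˡ _ q) l) (sym (cong₂ _+_ (cong-app (atˡ p q) l) (cong-app (atˡ p′ q) l))))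
    (fixʳ _ p q) (fixʳ _ p′ q)

  addʳ : ∀ p q q′ → ⟨ p , (λ k → q k + q′ k) ⟩ ≡ ⟨ p , q ⟩ + ⟨ p , q′ ⟩
  addʳ p q q′ = det-add j
    (λ l → trans (cong-app (atʳ p _) l) (sym (cong₂ _+_ (cong-app (atʳ p q) l) (cong-app (atʳ p q′) l))))
    (fixˡ p _ q) (fixˡ p _ q′)

  scaleˡ : ∀ c p q → ⟨ (λ k → c * p k) , q ⟩ ≡ c * ⟨ p , q ⟩
  scaleˡ c p q = det-scaleRow i c
    (λ l → trans (cong-app (atˡ _ q) l) (sym (cong (c *_) (cong-app (atˡ p q) l)))) (fixʳ _ p q)

  scaleʳ : ∀ c p q → ⟨ p , (λ k → c * q k) ⟩ ≡ c * ⟨ p , q ⟩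
  scaleʳ c p q = det-scaleRow j c
    (λ l → trans (cong-app (atʳ p _) l) (sym (cong (c *_) (cong-app (atʳ p q) l)))) (fixˡ p _ q)

  -- Alternation is a parameter because `det-alt₀` already exchanges rows for which it holds, before
  -- it is known for all pairs. `swap` is polarisation: expand the vanishing bracket of p + q with
  -- itself.
  module Antisym (alt : AltAt n i j) where
    self : ∀ p → ⟨ p , p ⟩ ≡ 0ℤ
    self p = alt _ λ k → cong-app (trans (atˡ p p) (sym (atʳ p p))) k

    swap : ∀ p q → ⟨ p , q ⟩ ≡ - ⟨ q , p ⟩
    swap p q = trans (isolate ⟨ p , p ⟩ ⟨ p , q ⟩ ⟨ q , p ⟩ ⟨ q , q ⟩)
      (trans (cong₂ (λ x y → x + - ⟨ q , p ⟩ + y) total (cong₂ (λ x y → - (x + y)) (self p) (self q)))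
        (drop ⟨ q , p ⟩))
      where
      drop : ∀ c → 0ℤ + - c + - (0ℤ + 0ℤ) ≡ - c
      drop = solve-∀
      isolate : ∀ a b c d → b ≡ (a + b + (c + d)) + - c + - (a + d)
      isolate = solve-∀
      p+q : Fin n → ℤ
      p+q k = p k + q k
      total : ⟨ p , p ⟩ + ⟨ p , q ⟩ + (⟨ q , p ⟩ + ⟨ q , q ⟩) ≡ 0ℤ
      total = trans (sym (trans (addˡ p q p+q) (cong₂ _+_ (addʳ p p q) (addʳ q p q)))) (self p+q)

det-alt-tail : ∀ {n} {i j : Fin n} → AltAt n i j → AltAt (suc n) (suc i) (suc j)
det-alt-tail {n} alt M h = ∑-zero λ k →
  trans (cong (λ d → sgn k * (M zero k * d)) (alt (minor M k) (λ l → h (punchIn k l)))) (vanish (sgn k) (M zero k))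
  where
  vanish : ∀ s m → s * (m * 0ℤ) ≡ 0ℤ
  vanish = solve-∀

-- Exchanging the second row with the one equal to row zero costs a sign and brings the equal rows
-- to the top. The exchange stays below row zero, where alternation is inherited from the smaller
-- size.
det-alt₀ : ∀ {n} (j : Fin n) → (∀ i → i ≢ j → AltAt n i j) → AltAt (suc n) zero (suc j)
det-alt₀ {suc n} zero    alt M h = det-alt₀₁ M h
det-alt₀ {suc n} (suc j) alt M h = begin
  detℤ _ M                              ≡⟨ B.det≡⟨⟩ M (λ _ _ _ _ → refl) ⟩
  B.⟨ M (suc zero) , M (suc (suc j)) ⟩  ≡⟨ swap (M (suc zero)) (M (suc (suc j))) ⟩
  - B.⟨ M (suc (suc j)) , M (suc zero) ⟩ ≡⟨ cong -_ (det-alt₀₁ (setRows M (suc zero) (M (suc (suc j))) (suc (suc j)) (M (suc zero))) h) ⟩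
  0ℤ ∎
  where
  open ≡-Reasoning
  module B = Bracket M {suc zero} {suc (suc j)} (λ ())
  open B.Antisym (det-alt-tail (alt zero (λ ())))

det-alt : ∀ {n} (i j : Fin n) → i ≢ j → AltAt n i j
det-alt zero    zero    i≢j = ⊥-elim (i≢j refl)
det-alt zero    (suc j) i≢j = det-alt₀ j (λ i → det-alt i j)
det-alt (suc i) zero    i≢j = λ M h → det-alt₀ i (λ k → det-alt k i) M (λ k → sym (h k))
det-alt (suc i) (suc j) i≢j = det-alt-tail (det-alt i j (i≢j ∘ cong suc))

columnMinor : ∀ {n} → Mat (suc n) → Fin (suc n) → Mat n
columnMinor M i a b = M (punchIn i a) (suc b)

-- Expanding the first row and then first columns, or the first column and then first rows,
-- gives the same double sum.
det-column : ∀ n (M : Mat (suc n)) →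
  detℤ (suc n) M ≡ ∑ λ i → sgn i * (M i zero * detℤ n (columnMinor M i))
det-column zero    M = ∑-cong λ { zero → refl }
det-column (suc n) M = trans ∑-suc (trans (cong (λ t → corner + t) tails) (sym ∑-suc))
  where
  corner : ℤ
  corner = 1ℤ * (M zero zero * detℤ (suc n) (minor M zero))
  rest : Fin (suc n) → Fin (suc n) → ℤ
  rest i j = detℤ n λ a b → M (suc (punchIn i a)) (suc (punchIn j b))
  swapFactors : ∀ s m t m′ d → (-1ℤ * s) * (m * (t * (m′ * d))) ≡ (-1ℤ * t) * (m′ * (s * (m * d)))
  swapFactors = solve-∀
  inner : ∀ {m} s c (f : Fin m → ℤ) → s * (c * ∑ f) ≡ ∑ (λ k → s * (c * f k))
  inner s c f = trans (cong (s *_) (sym (∑-*ˡ c f))) (sym (∑-*ˡ s _))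
  open ≡-Reasoning
  tails : ∑ (λ j → sgn (suc j) * (M zero (suc j) * detℤ (suc n) (minor M (suc j)))) ≡
    ∑ (λ i → sgn (suc i) * (M (suc i) zero * detℤ (suc n) (columnMinor M (suc i))))
  tails = begin
    ∑ (λ j → sgn (suc j) * (M zero (suc j) * detℤ (suc n) (minor M (suc j))))
      ≡⟨ ∑-cong (λ j → trans (cong (λ d → sgn (suc j) * (M zero (suc j) * d)) (det-column n (minor M (suc j))))
           (inner (sgn (suc j)) (M zero (suc j)) λ i → sgn i * (M (suc i) zero * rest i j))) ⟩
    ∑ (λ j → ∑ (λ i → sgn (suc j) * (M zero (suc j) * (sgn i * (M (suc i) zero * rest i j)))))
      ≡⟨ ∑-comm ⟩
    ∑ (λ i → ∑ (λ j → sgn (suc j) * (M zero (suc j) * (sgn i * (M (suc i) zero * rest i j)))))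
      ≡⟨ ∑-cong (λ i → ∑-cong λ j → swapFactors (sgn j) (M zero (suc j)) (sgn i) (M (suc i) zero) (rest i j)) ⟩
    ∑ (λ i → ∑ (λ j → sgn (suc i) * (M (suc i) zero * (sgn j * (M zero (suc j) * rest i j)))))
      ≡⟨ ∑-cong (λ i → sym (inner (sgn (suc i)) (M (suc i) zero) λ j → sgn j * (M zero (suc j) * rest i j))) ⟩
    ∑ (λ i → sgn (suc i) * (M (suc i) zero * detℤ (suc n) (columnMinor M (suc i)))) ∎

-- Row expansion of the transpose is column expansion of the matrix.
det-transpose : ∀ {n} (M : Mat n) → detℤ n (flip M) ≡ detℤ n M
det-transpose {zero}  M = refl
det-transpose {suc n} M = trans
  (∑-cong λ j → cong (λ d → sgn j * (M j zero * d)) (det-transpose (columnMinor M j)))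
  (sym (det-column n M))

det-rowSwap : ∀ {n} (M P : Mat n) {i j} → i ≢ j → (∀ k → P i k ≡ M j k) → (∀ k → P j k ≡ M i k) →
  (∀ l → l ≢ i → l ≢ j → ∀ k → P l k ≡ M l k) → detℤ n P ≡ - detℤ n M
det-rowSwap M P {i} {j} i≢j Pi Pj P-other = begin
  detℤ _ P                ≡⟨ B.det≡⟨⟩ P P-other ⟩
  B.⟨ P i , P j ⟩         ≡⟨ B.⟨⟩-cong Pi Pj ⟩
  B.⟨ M j , M i ⟩         ≡⟨ swap (M j) (M i) ⟩
  - B.⟨ M i , M j ⟩       ≡⟨ cong -_ (sym (B.det≡⟨⟩ M (λ _ _ _ _ → refl))) ⟩
  - detℤ _ M ∎
  where
  open ≡-Reasoning
  module B = Bracket M i≢j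
  open B.Antisym (det-alt i j i≢j)

det-columnSwap : ∀ {n} (M P : Mat n) {i j} → i ≢ j → (∀ k → P k i ≡ M k j) → (∀ k → P k j ≡ M k i) →
  (∀ l → l ≢ i → l ≢ j → ∀ k → P k l ≡ M k l) → detℤ n P ≡ - detℤ n M
det-columnSwap M P i≢j Pi Pj P-other = trans (sym (det-transpose P))
  (trans (det-rowSwap (flip M) (flip P) i≢j Pi Pj P-other) (cong -_ (det-transpose M)))

-- Determinants with a block of zeros

count : ∀ {n} → (Fin n → Bool) → ℕ
count {zero}  f = 0
count {suc n} f = (if f zero then 1 else 0) ℕ.+ count (f ∘ suc)

count-cong : ∀ {n} {f g : Fin n → Bool} → (∀ i → f i ≡ g i) → count f ≡ count g
count-cong {zero}  h = refl
count-cong {suc n} h = cong₂ (λ b c → (if b then 1 else 0) ℕ.+ c) (h zero) (count-cong (h ∘ suc))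

count-punchIn : ∀ {n} (f : Fin (suc n) → Bool) j → count f ≡ (if f j then 1 else 0) ℕ.+ count (f ∘ punchIn j)
count-punchIn         f zero    = refl
count-punchIn {suc n} f (suc j) = trans (cong (λ c → (if f zero then 1 else 0) ℕ.+ c) (count-punchIn (f ∘ suc) j))
  (trans (sym (ℕₚ.+-assoc (if f zero then 1 else 0) (if f (suc j) then 1 else 0) rest))
  (trans (cong (ℕ._+ rest) (ℕₚ.+-comm (if f zero then 1 else 0) (if f (suc j) then 1 else 0)))
    (ℕₚ.+-assoc (if f (suc j) then 1 else 0) (if f zero then 1 else 0) rest)))
  where
  rest : ℕ
  rest = count (f ∘ suc ∘ punchIn j)

count-remove : ∀ {n} (f : Fin (suc n) → Bool) {j b} → f j ≡ b → count f ≡ (if b then 1 else 0) ℕ.+ count (f ∘ punchIn j)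
count-remove f {j} refl = count-punchIn f j

ZeroBlock : ∀ {n} → (Fin n → Bool) → (Fin n → Bool) → Mat n → Set
ZeroBlock r c M = ∀ i j → r i ≡ true → c j ≡ false → M i j ≡ 0ℤ

vanishˡ : ∀ s {m} d → m ≡ 0ℤ → s * (m * d) ≡ 0ℤ
vanishˡ s d refl = ℤₚ.*-zeroʳ s

vanishʳ : ∀ s m {d} → d ≡ 0ℤ → s * (m * d) ≡ 0ℤ
vanishʳ s m refl = trans (cong (s *_) (ℤₚ.*-zeroʳ m)) (ℤₚ.*-zeroʳ s)

-- Frobenius-König: the rows in `r` live on the columns in `c`, and there are too few of these. In
-- the expansion along row zero every entry not already zero leaves a minor with the same shortage.
det-zeroBlock : ∀ {n} (r c : Fin n → Bool) {M : Mat n} → ZeroBlock r c M → count c ℕ.< count r → detℤ n M ≡ 0ℤ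
det-zeroBlock {zero}  r c z ()
det-zeroBlock {suc n} r c {M} z c<r = ∑-zero term
  where
  term : ∀ j → sgn j * (M zero j * detℤ n (minor M j)) ≡ 0ℤ
  term j = cases (r zero) (c j) refl refl
    where
    cases : ∀ b b′ → r zero ≡ b → c j ≡ b′ → sgn j * (M zero j * detℤ n (minor M j)) ≡ 0ℤ
    cases true false r₀ cⱼ = vanishˡ (sgn j) (detℤ n (minor M j)) (z zero j r₀ cⱼ)
    cases true true r₀ cⱼ = vanishʳ (sgn j) (M zero j) (det-zeroBlock (r ∘ suc) (c ∘ punchIn j)
      (λ a b → z (suc a) (punchIn j b))
      (ℕ.s≤s⁻¹ (subst₂ ℕ._<_ (count-remove c cⱼ) (count-remove r r₀) c<r)))
    cases false _ r₀ cⱼ = vanishʳ (sgn j) (M zero j) (det-zeroBlock (r ∘ suc) (c ∘ punchIn j)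
      (λ a b → z (suc a) (punchIn j b))
      (ℕₚ.≤-<-trans (subst (count (c ∘ punchIn j) ℕ.≤_) (sym (count-punchIn c j)) (ℕₚ.m≤n+m _ _))
        (subst (count c ℕ.<_) (count-remove r r₀) c<r)))

det-zeroBlock-cong : ∀ {n} (r c : Fin n → Bool) {M P : Mat n} → ZeroBlock r c M → ZeroBlock r c P →
  (∀ i j → r i ≡ c j → M i j ≡ P i j) → count c ℕ.≤ count r → detℤ n M ≡ detℤ n P
det-zeroBlock-cong {zero}  r c zM zP eq c≤r = refl
det-zeroBlock-cong {suc n} r c {M} {P} zM zP eq c≤r = ∑-cong term
  where
  minors : ∀ j → count (c ∘ punchIn j) ℕ.≤ count (r ∘ suc) → detℤ n (minor M j) ≡ detℤ n (minor P j)
  minors j = det-zeroBlock-cong (r ∘ suc) (c ∘ punchIn j) (λ a b → zM (suc a) (punchIn j b))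
    (λ a b → zP (suc a) (punchIn j b)) (λ a b → eq (suc a) (punchIn j b))
  term : ∀ j → sgn j * (M zero j * detℤ n (minor M j)) ≡ sgn j * (P zero j * detℤ n (minor P j))
  term j = cases (r zero) (c j) refl refl
    where
    -- Spending a column of `c` on a row outside `r` leaves the rows in `r` one column short.
    zeroMinor : c j ≡ true → r zero ≡ false → ∀ {R : Mat (suc n)} → ZeroBlock r c R → detℤ n (minor R j) ≡ 0ℤ
    zeroMinor cⱼ r₀ zR = det-zeroBlock (r ∘ suc) (c ∘ punchIn j) (λ a b → zR (suc a) (punchIn j b))
      (subst₂ ℕ._≤_ (count-remove c cⱼ) (count-remove r r₀) c≤r)
    cases : ∀ b b′ → r zero ≡ b → c j ≡ b′ →
        sgn j * (M zero j * detℤ n (minor M j)) ≡ sgn j * (P zero j * detℤ n (minor P j))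
    cases true false r₀ cⱼ = trans (vanishˡ (sgn j) (detℤ n (minor M j)) (zM zero j r₀ cⱼ))
      (sym (vanishˡ (sgn j) (detℤ n (minor P j)) (zP zero j r₀ cⱼ)))
    cases true true r₀ cⱼ = cong (sgn j *_) (cong₂ _*_ (eq zero j (trans r₀ (sym cⱼ))) (minors j
      (ℕ.s≤s⁻¹ (subst₂ ℕ._≤_ (count-remove c cⱼ) (count-remove r r₀) c≤r))))
    cases false false r₀ cⱼ = cong (sgn j *_) (cong₂ _*_ (eq zero j (trans r₀ (sym cⱼ))) (minors j
      (subst₂ ℕ._≤_ (count-remove c cⱼ) (count-remove r r₀) c≤r)))
    cases false true r₀ cⱼ = trans (vanishʳ (sgn j) (M zero j) (zeroMinor cⱼ r₀ zM))
        (sym (vanishʳ (sgn j) (P zero j) (zeroMinor cⱼ r₀ zP)))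

-- Expansion in all rows at once

record Multiadditive {n m} (f : (Fin m → Fin n → ℤ) → ℤ) : Set where
  field
    respects : ∀ {M P} → (∀ i j → M i j ≡ P i j) → f M ≡ f P
    additive : ∀ i {M P R} → (∀ j → M i j ≡ P i j + R i j) →
      (∀ k → k ≢ i → ∀ j → M k j ≡ P k j) → (∀ k → k ≢ i → ∀ j → M k j ≡ R k j) → f M ≡ f P + f R
open Multiadditive

det-multiadditive : ∀ {n} → Multiadditive (detℤ n)
det-multiadditive .respects = det-cong
det-multiadditive .additive = det-add

module _ {n m} {f : (Fin (suc m) → Fin n → ℤ) → ℤ} (F : Multiadditive f) where

  cons-cong : ∀ {r r′} {T T′ : Fin m → Fin n → ℤ} → (∀ j → r j ≡ r′ j) → (∀ i j → T i j ≡ T′ i j) →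
    f (r Vector.∷ T) ≡ f (r′ Vector.∷ T′)
  cons-cong e h = respects F λ { zero → e ; (suc i) → h i }

  -- Freezing a row leaves a function of one row fewer over the same columns. For this reason the
  -- numbers of rows and columns are independent, and inductions can run over the rows.
  fixFirst : ∀ r → Multiadditive (λ T → f (r Vector.∷ T))
  fixFirst r .respects h = cons-cong (λ _ → refl) h
  fixFirst r .additive i h p q = additive F (suc i) h
    (λ { zero _ _ → refl ; (suc k) k≢i → p k (k≢i ∘ cong suc) })
    (λ { zero _ _ → refl ; (suc k) k≢i → q k (k≢i ∘ cong suc) })

  cons-add : ∀ p q T → f ((λ j → p j + q j) Vector.∷ T) ≡ f (p Vector.∷ T) + f (q Vector.∷ T)
  cons-add p q T = additive F zero (λ _ → refl)
    (λ { zero k≢ → ⊥-elim (k≢ refl) ; (suc k) _ _ → refl })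
    (λ { zero k≢ → ⊥-elim (k≢ refl) ; (suc k) _ _ → refl })

-- Additivity splits off each added multiple of `r`, and the split-off summand is killed. All rows
-- are treated in one pass, with `r` itself outside of them.
shear : ∀ {n m} {f : (Fin m → Fin n → ℤ) → ℤ} → Multiadditive f → (r : Fin n → ℤ) →
  (∀ T i c → (∀ j → T i j ≡ c * r j) → f T ≡ 0ℤ) →
  ∀ (c : Fin m → ℤ) T → f (λ i j → T i j + c i * r j) ≡ f T
shear {m = zero}          F r kills c T = respects F λ ()
shear {m = suc m} {f = f} F r kills c T = begin
  f (λ i j → T i j + c i * r j)
    ≡⟨ respects F (λ { zero _ → refl ; (suc _) _ → refl }) ⟩
  f ((λ j → T zero j + c zero * r j) Vector.∷ T′)
    ≡⟨ cons-add F (T zero) (λ j → c zero * r j) T′ ⟩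
  f (T zero Vector.∷ T′) + f ((λ j → c zero * r j) Vector.∷ T′)
    ≡⟨ cong (λ t → f (T zero Vector.∷ T′) + t) (kills _ zero (c zero) (λ _ → refl)) ⟩
  f (T zero Vector.∷ T′) + 0ℤ
    ≡⟨ ℤₚ.+-identityʳ _ ⟩
  f (T zero Vector.∷ T′)
    ≡⟨ shear (fixFirst F (T zero)) r (λ S i → kills (T zero Vector.∷ S) (suc i)) (c ∘ suc) (T ∘ suc) ⟩
  f (T zero Vector.∷ (T ∘ suc))
    ≡⟨ respects F (λ { zero _ → refl ; (suc _) _ → refl }) ⟩
  f T ∎
  where
  open ≡-Reasoning
  T′ : Fin m → Fin _ → ℤ
  T′ i j = T (suc i) j + c (suc i) * r j

∑ₛ : ∀ {n} → (Vec Bool n → ℤ) → ℤ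
∑ₛ {zero}  g = g []
∑ₛ {suc n} g = ∑ₛ (λ b → g (true ∷ b)) + ∑ₛ (λ b → g (false ∷ b))

∑ₛ-cong : ∀ {n} {g h : Vec Bool n → ℤ} → (∀ b → g b ≡ h b) → ∑ₛ g ≡ ∑ₛ h
∑ₛ-cong {zero}  e = e []
∑ₛ-cong {suc n} e = cong₂ _+_ (∑ₛ-cong λ b → e (true ∷ b)) (∑ₛ-cong λ b → e (false ∷ b))

multiExpand : ∀ {n m} {f : (Fin m → Fin n → ℤ) → ℤ} → Multiadditive f → ∀ (P R : Fin m → Fin n → ℤ) →
  f (λ i j → P i j + R i j) ≡ ∑ₛ (λ b → f (λ i j → if lookup b i then P i j else R i j))
multiExpand {m = zero}          F P R = respects F λ ()
multiExpand {m = suc m} {f = f} F P R = begin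
  f (λ i j → P i j + R i j)
    ≡⟨ respects F (λ { zero _ → refl ; (suc _) _ → refl }) ⟩
  f ((λ j → P zero j + R zero j) Vector.∷ S)
    ≡⟨ cons-add F (P zero) (R zero) S ⟩
  f (P zero Vector.∷ S) + f (R zero Vector.∷ S)
    ≡⟨ cong₂ _+_ (multiExpand (fixFirst F (P zero)) (P ∘ suc) (R ∘ suc))
         (multiExpand (fixFirst F (R zero)) (P ∘ suc) (R ∘ suc)) ⟩
  ∑ₛ (λ b → f (P zero Vector.∷ choice b)) + ∑ₛ (λ b → f (R zero Vector.∷ choice b))
    ≡⟨ cong₂ _+_
         (∑ₛ-cong λ b → respects F {M = P zero Vector.∷ choice b} (λ { zero _ → refl ; (suc _) _ → refl }))
         (∑ₛ-cong λ b → respects F {M = R zero Vector.∷ choice b} (λ { zero _ → refl ; (suc _) _ → refl })) ⟩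
  ∑ₛ (λ b → f (λ i j → if lookup b i then P i j else R i j)) ∎
  where
  open ≡-Reasoning
  S : Fin m → Fin _ → ℤ
  S i j = P (suc i) j + R (suc i) j
  choice : Vec Bool m → Fin m → Fin _ → ℤ
  choice b i j = if lookup b i then P (suc i) j else R (suc i) j

-- Criteria for positive and for vanishing determinants

prod-positive : ∀ {n} {c : Fin n → ℤ} → (∀ i → 0ℤ < c i) → 0ℤ < prod c
prod-positive {zero}      h = ℤ.+<+ (s≤s z≤n)
prod-positive {suc n} {c} h = subst (_< c zero * prod (c ∘ suc)) (ℤₚ.*-zeroʳ (c zero))
  (ℤₚ.*-monoˡ-<-pos (c zero) {{ℤ.positive (h zero)}} (prod-positive (h ∘ suc)))

<-cancel-positive : ∀ {d x} → 0ℤ < d → 0ℤ < d * x → 0ℤ < x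
<-cancel-positive {d} {x} 0<d 0<dx = ℤₚ.*-cancelˡ-<-nonNeg d {{ℤ.nonNegative (ℤₚ.<⇒≤ 0<d)}}
  (subst (_< d * x) (sym (ℤₚ.*-zeroʳ d)) 0<dx)

_·_ : ∀ {n} → Mat n → (Fin n → ℤ) → Fin n → ℤ
(M · x) i = ∑ λ j → M i j * x j

-- P-matrices are the matrices that reverse the sign of no nonzero vector (Fiedler–Pták).
SignPreserving : ∀ {n} → Mat n → Set
SignPreserving M = ∀ x p → x p ≢ 0ℤ → ∃ λ i → 0ℤ < x i * (M · x) i

-- Induction on the size: the fraction-free Schur complement of the (0,0) entry is again sign preserving.
det-signPreserving : ∀ {n} (M : Mat n) → SignPreserving M → 0ℤ < detℤ n M
det-signPreserving {zero}  M sp = ℤ.+<+ (s≤s z≤n)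
det-signPreserving {suc n} M sp = <-cancel-positive (prod-positive scale-positive) (subst (0ℤ <_) (sym eliminate) product-positive)
  where
  d : ℤ
  d = M zero zero

  e₀ : Fin (suc n) → ℤ
  e₀ = 1ℤ Vector.∷ λ _ → 0ℤ

  d-positive : 0ℤ < d
  d-positive with sp e₀ zero (λ ())
  ... | zero  , p = subst (0ℤ <_) (trans (ℤₚ.*-identityˡ _) (trans ∑-suc
    (trans (cong₂ _+_ (ℤₚ.*-identityʳ d) (∑-zero λ j → ℤₚ.*-zeroʳ (M zero (suc j)))) (ℤₚ.+-identityʳ d)))) p
  ... | suc i , p = ⊥-elim (ℤₚ.<-irrefl (sym (ℤₚ.*-zeroˡ ((M · e₀) (suc i)))) p)

  schur : Mat n
  schur a b = d * M (suc a) (suc b) + - M (suc a) zero * M zero (suc b)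

  schur-sp : SignPreserving schur
  schur-sp x p xp≢0 with sp X (suc p) (λ e → xp≢0 (ℤₚ.*-cancelˡ-≡ d (x p) 0ℤ {{d-nonZero}} (trans e (sym (ℤₚ.*-zeroʳ d)))))
    where
    d-nonZero : ℤ.NonZero d
    d-nonZero = ℤ.≢-nonZero λ e → ℤₚ.<-irrefl (sym e) d-positive
    -- `X` is d times x, completed by the coordinate that makes row zero of `M · X` vanish. The
    -- remaining rows of `M · X` are then `schur · x`, and the index supplied by `sp` cannot be
    -- zero.
    X : Fin (suc n) → ℤ
    X = - (∑ λ j → M zero (suc j) * x j) Vector.∷ λ j → d * x j
  ... | i , q = conclude i q
    where
    t : ℤ
    t = ∑ λ j → M zero (suc j) * x j
    X : Fin (suc n) → ℤ
    X = - t Vector.∷ λ j → d * x j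
    regroup : ∀ m d x → m * (d * x) ≡ d * (m * x)
    regroup = solve-∀
    MX : ∀ i → (M · X) i ≡ M i zero * - t + d * ∑ (λ j → M i (suc j) * x j)
    MX i = trans ∑-suc (cong (λ s → M i zero * - t + s)
      (trans (∑-cong λ j → regroup (M i (suc j)) d (x j)) (∑-*ˡ d _)))
    split : ∀ d m c r x → (d * m + - c * r) * x ≡ d * (m * x) + - c * (r * x)
    split = solve-∀
    schur-x : ∀ a → (schur · x) a ≡ d * ∑ (λ j → M (suc a) (suc j) * x j) + - M (suc a) zero * t
    schur-x a = trans (∑-cong λ j → split d (M (suc a) (suc j)) (M (suc a) zero) (M zero (suc j)) (x j))
      (trans ∑-+ (cong₂ _+_ (∑-*ˡ d _) (∑-*ˡ (- M (suc a) zero) _)))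
    cancel₀ : ∀ t d → - t * (d * - t + d * t) ≡ 0ℤ
    cancel₀ = solve-∀
    factor : ∀ d x c t s → (d * x) * (c * - t + d * s) ≡ d * (x * (d * s + - c * t))
    factor = solve-∀
    conclude : ∀ i → 0ℤ < X i * (M · X) i → ∃ λ a → 0ℤ < x a * (schur · x) a
    conclude zero q = ⊥-elim (ℤₚ.<-irrefl (sym (trans (cong (- t *_) (MX zero)) (cancel₀ t d))) q)
    conclude (suc a) q = a , <-cancel-positive d-positive (subst (0ℤ <_)
      (trans (cong (d * x a *_) (MX (suc a))) (trans (factor d (x a) (M (suc a) zero) t _)
        (cong (λ s → d * (x a * s)) (sym (schur-x a))))) q)

  scale : Fin (suc n) → ℤ
  scale = 1ℤ Vector.∷ λ _ → d

  scale-positive : ∀ i → 0ℤ < scale i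
  scale-positive zero    = ℤ.+<+ (s≤s z≤n)
  scale-positive (suc i) = d-positive

  product-positive : 0ℤ < d * detℤ n schur
  product-positive = subst (_< d * detℤ n schur) (ℤₚ.*-zeroʳ d)
    (ℤₚ.*-monoˡ-<-pos d {{ℤ.positive d-positive}} (det-signPreserving schur schur-sp))

  eliminated : Mat (suc n)
  eliminated = M zero Vector.∷ λ a j → d * M (suc a) j + - M (suc a) zero * M zero j

  kills : ∀ (T : Fin n → Fin (suc n) → ℤ) i c → (∀ j → T i j ≡ c * M zero j) → detℤ (suc n) (M zero Vector.∷ T) ≡ 0ℤ
  kills T i c h = trans (det-scaleRow (suc i) c {M = M zero Vector.∷ T} {P = M zero Vector.∷ setRow T i (M zero)}
      (λ j → trans (h j) (cong (c *_) (sym (cong-app (setRow-at T i (M zero)) j))))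
      (λ { zero _ _ → refl ; (suc k) k≢i j → sym (cong-app (setRow-other T (M zero) (k≢i ∘ cong suc)) j) }))
    (trans (cong (c *_) (det-alt zero (suc i) (λ ()) (M zero Vector.∷ setRow T i (M zero)) λ k → sym (cong-app (setRow-at T i (M zero)) k))) (ℤₚ.*-zeroʳ c))

  open ≡-Reasoning
  cancel : ∀ d c → d * c + - c * d ≡ 0ℤ
  cancel = solve-∀
  eliminate : prod scale * detℤ (suc n) M ≡ d * detℤ n schur
  eliminate = begin
    prod scale * detℤ (suc n) M
      ≡⟨ sym (det-scaleRows scale M) ⟩
    detℤ (suc n) (λ i j → scale i * M i j)
      ≡⟨ det-cong {M = λ i j → scale i * M i j} {P = M zero Vector.∷ λ a j → d * M (suc a) j}
           (λ { zero j → ℤₚ.*-identityˡ (M zero j) ; (suc _) _ → refl }) ⟩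
    detℤ (suc n) (M zero Vector.∷ λ a j → d * M (suc a) j)
      ≡⟨ sym (shear (fixFirst det-multiadditive (M zero)) (M zero) kills (λ a → - M (suc a) zero)
           (λ a j → d * M (suc a) j)) ⟩
    detℤ (suc n) eliminated
      ≡⟨ det-column n eliminated ⟩
    ∑ (λ i → sgn i * (eliminated i zero * detℤ n (columnMinor eliminated i)))
      ≡⟨ ∑-suc ⟩
    1ℤ * (d * detℤ n schur) + ∑ (λ i → sgn (suc i) * (eliminated (suc i) zero * detℤ n (columnMinor eliminated (suc i))))
      ≡⟨ cong₂ _+_ (ℤₚ.*-identityˡ (d * detℤ n schur)) (∑-zero λ i → vanishˡ (sgn (suc i)) _ (cancel d (M (suc i) zero))) ⟩
    d * detℤ n schur + 0ℤ
      ≡⟨ ℤₚ.+-identityʳ _ ⟩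
    d * detℤ n schur ∎

∑-single : ∀ {n} (p : Fin n) {f : Fin n → ℤ} → (∀ i → i ≢ p → f i ≡ 0ℤ) → ∑ f ≡ f p
∑-single zero    {f} h = trans ∑-suc (trans (cong (λ t → f zero + t) (∑-zero λ i → h (suc i) (λ ()))) (ℤₚ.+-identityʳ _))
∑-single (suc p)     h = trans ∑-suc (trans (cong₂ _+_ (h zero (λ ())) (∑-single p λ i i≢p → h (suc i) λ { refl → i≢p refl })) (ℤₚ.+-identityˡ _))

det-combination : ∀ {n m} (M : Mat n) p (κ : Fin m → ℤ) (v : Fin m → Fin n → ℤ) →
  detℤ n (setRow M p (λ j → ∑ λ i → κ i * v i j)) ≡ ∑ (λ i → κ i * detℤ n (setRow M p (v i)))
det-combination {n} {zero} M p κ v = trans (det-scaleRow p 0ℤ {P = setRow M p (λ _ → 0ℤ)}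
    (λ j → trans (cong-app (setRow-at M p _) j) ∑-empty)
    (λ k k≢p j → cong-app (trans (setRow-other M _ k≢p) (sym (setRow-other M _ k≢p))) j))
  (trans (ℤₚ.*-zeroˡ (detℤ n (setRow M p (λ _ → 0ℤ)))) (sym ∑-empty))
det-combination {n} {suc m} M p κ v = begin
  detℤ n (setRow M p (λ j → ∑ λ i → κ i * v i j))
    ≡⟨ det-add p (λ j → trans (at _ j) (trans ∑-suc (sym (cong₂ _+_ (at _ j) (at _ j))))) (other _ _) (other _ _) ⟩
  detℤ n (setRow M p (λ j → κ zero * v zero j)) + detℤ n (setRow M p (λ j → ∑ λ i → κ (suc i) * v (suc i) j))
    ≡⟨ cong₂ _+_ (det-scaleRow p (κ zero) (λ j → trans (at _ j) (cong (κ zero *_) (sym (at _ j)))) (other _ _))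
         (det-combination M p (κ ∘ suc) (v ∘ suc)) ⟩
  κ zero * detℤ n (setRow M p (v zero)) + ∑ (λ i → κ (suc i) * detℤ n (setRow M p (v (suc i))))
    ≡⟨ sym ∑-suc ⟩
  ∑ (λ i → κ i * detℤ n (setRow M p (v i))) ∎
  where
  open ≡-Reasoning
  at : ∀ r j → setRow M p r p j ≡ r j
  at r j = cong-app (setRow-at M p r) j
  other : ∀ r r′ k → k ≢ p → ∀ j → setRow M p r k j ≡ setRow M p r′ k j
  other r r′ k k≢p j = cong-app (trans (setRow-other M r k≢p) (sym (setRow-other M r′ k≢p))) j

-- Replace row p by the combination of all rows with coefficients κ. The result has a zero row; by
-- linearity it is also κ p times the determinant, because every other summand repeats a row.
det-leftKernel : ∀ {n} (M : Mat n) (κ : Fin n → ℤ) → (∀ j → ∑ (λ i → κ i * M i j) ≡ 0ℤ) →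
  ∀ p → κ p ≢ 0ℤ → detℤ n M ≡ 0ℤ
det-leftKernel {n} M κ ker p κp≢0 = ℤₚ.*-cancelˡ-≡ (κ p) _ _ {{ℤ.≢-nonZero κp≢0}} (begin
  κ p * detℤ n M
    ≡⟨ cong (κ p *_) (det-cong λ i j → restored i j) ⟩
  κ p * detℤ n (setRow M p (M p))
    ≡⟨ sym (∑-single p λ i i≢p → trans (cong (κ i *_) (repeated i i≢p)) (ℤₚ.*-zeroʳ (κ i))) ⟩
  ∑ (λ i → κ i * detℤ n (setRow M p (M i)))
    ≡⟨ sym (det-combination M p κ M) ⟩
  detℤ n (setRow M p (λ j → ∑ λ i → κ i * M i j))
    ≡⟨ det-scaleRow p 0ℤ {P = M} (λ j → trans (cong-app (setRow-at M p _) j) (ker j))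
         (λ k k≢p j → cong-app (setRow-other M _ k≢p) j) ⟩
  0ℤ * detℤ n M
    ≡⟨ trans (ℤₚ.*-zeroˡ (detℤ n M)) (sym (ℤₚ.*-zeroʳ (κ p))) ⟩
  κ p * 0ℤ ∎)
  where
  open ≡-Reasoning
  restored : ∀ i j → M i j ≡ setRow M p (M p) i j
  restored i j with i ≟ p
  ... | yes refl = refl
  ... | no _ = refl
  repeated : ∀ i → i ≢ p → detℤ n (setRow M p (M i)) ≡ 0ℤ
  repeated i i≢p = det-alt p i (i≢p ∘ sym) _ λ k →
    cong-app (trans (setRow-at M p (M i)) (sym (setRow-other M (M i) i≢p))) k

-- Polynomials and principal minors

eval : Poly → ℤ → ℤ
eval []      x = 0ℤ
eval (a ∷ p) x = a + x * eval p x

eval-⊕ : ∀ p q x → eval (p ⊕ q) x ≡ eval p x + eval q x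
eval-⊕ []      q       x = sym (ℤₚ.+-identityˡ _)
eval-⊕ (a ∷ p) []      x = sym (ℤₚ.+-identityʳ _)
eval-⊕ (a ∷ p) (b ∷ q) x = trans (cong (λ t → a + b + x * t) (eval-⊕ p q x)) (regroup a b x _ _)
  where
  regroup : ∀ a b x s t → a + b + x * (s + t) ≡ a + x * s + (b + x * t)
  regroup = solve-∀

eval-scale : ∀ c p x → eval (map (c *_) p) x ≡ c * eval p x
eval-scale c []      x = sym (ℤₚ.*-zeroʳ c)
eval-scale c (a ∷ p) x = trans (cong (λ t → c * a + x * t) (eval-scale c p x)) (regroup c a x _)
  where
  regroup : ∀ c a x s → c * a + x * (c * s) ≡ c * (a + x * s)
  regroup = solve-∀

eval-⊗ : ∀ p q x → eval (p ⊗ q) x ≡ eval p x * eval q x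
eval-⊗ []      q x = sym (ℤₚ.*-zeroˡ (eval q x))
eval-⊗ (a ∷ p) q x = trans (eval-⊕ (map (a *_) q) (+ 0 ∷ (p ⊗ q)) x)
  (trans (cong₂ (λ s t → s + (0ℤ + x * t)) (eval-scale a q x) (eval-⊗ p q x)) (regroup a x (eval p x) (eval q x)))
  where
  regroup : ∀ a x s t → a * t + (0ℤ + x * (s * t)) ≡ (a + x * s) * t
  regroup = solve-∀

eval-sumP : ∀ {m} (f : Fin m → Poly) x → eval (sumP f) x ≡ ∑ (λ j → eval (f j) x)
eval-sumP {zero}  f x = sym ∑-empty
eval-sumP {suc m} f x = trans (eval-⊕ (f zero) (sumP (λ j → f (suc j))) x)
  (trans (cong (λ t → eval (f zero) x + t) (eval-sumP (λ j → f (suc j)) x)) (sym ∑-suc))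

eval-det : ∀ m (M : Fin m → Fin m → Poly) x → eval (det m M) x ≡ detℤ m (λ i j → eval (M i j) x)
eval-det zero    M x = cong (λ t → 1ℤ + t) (ℤₚ.*-zeroʳ x)
eval-det (suc m) M x = trans (eval-sumP term x) (∑-cong λ j →
  trans (eval-⊗ ((-1ℤ ^ toℕ j) ∷ []) (M zero j ⊗ minorDet j) x)
    (cong₂ _*_ (trans (cong (λ t → sgn j + t) (ℤₚ.*-zeroʳ x)) (ℤₚ.+-identityʳ (sgn j)))
      (trans (eval-⊗ (M zero j) (minorDet j) x)
        (cong (eval (M zero j) x *_) (eval-det m (λ a b → M (suc a) (punchIn j b)) x)))))
  where
  minorDet : Fin (suc m) → Poly
  minorDet j = det m (λ a b → M (suc a) (punchIn j b))
  term : Fin (suc m) → Poly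
  term j = ((- + 1) ^ toℕ j ∷ []) ⊗ (M zero j ⊗ minorDet j)

coeff-⊕ : ∀ p q k → coeff (p ⊕ q) k ≡ coeff p k + coeff q k
coeff-⊕ []      q       k       = sym (ℤₚ.+-identityˡ _)
coeff-⊕ (a ∷ p) []      k       = sym (ℤₚ.+-identityʳ _)
coeff-⊕ (a ∷ p) (b ∷ q) zero    = refl
coeff-⊕ (a ∷ p) (b ∷ q) (suc k) = coeff-⊕ p q k

coeff-scale : ∀ c p k → coeff (map (c *_) p) k ≡ c * coeff p k
coeff-scale c []      k       = sym (ℤₚ.*-zeroʳ c)
coeff-scale c (a ∷ p) zero    = refl
coeff-scale c (a ∷ p) (suc k) = coeff-scale c p k

small-root : ∀ a r m → ℤ.∣ a ∣ ℕ.< m → a + + m * r ≡ 0ℤ → a ≡ 0ℤ × r ≡ 0ℤ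
small-root a r m a<m e with r ℤ.≟ 0ℤ
... | yes r≡0 = trans (sym (ℤₚ.+-identityʳ a))
    (trans (cong (λ t → a + t) (sym (trans (cong (+ m *_) r≡0) (ℤₚ.*-zeroʳ (+ m))))) e) , r≡0
... | no r≢0 = ⊥-elim (ℕₚ.<-irrefl refl (ℕₚ.<-≤-trans a<m
    (subst (m ℕ.≤_) (sym abs-a) (ℕₚ.m≤m*n m ℤ.∣ r ∣ {{ℤ.≢-nonZero r≢0}}))))
  where
  isolate : ∀ a y → a ≡ a + y + - y
  isolate = solve-∀
  abs-a : ℤ.∣ a ∣ ≡ m ℕ.* ℤ.∣ r ∣
  abs-a = trans (cong ℤ.∣_∣ (trans (isolate a (+ m * r)) (trans (cong (_+ - (+ m * r)) e) (ℤₚ.+-identityˡ (- (+ m * r))))))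
    (trans (ℤₚ.∣-i∣≡∣i∣ (+ m * r)) (ℤₚ.abs-* (+ m) r))

-- At an argument m above the absolute value of the constant term a, the equation a + m r = 0 forces
-- both a and r to be zero. The tail is thereby known to vanish only from a larger bound on, and
-- hence the bound N in the statement.
coeff-vanish : ∀ p N → (∀ m → N ℕ.≤ m → eval p (+ m) ≡ 0ℤ) → ∀ k → coeff p k ≡ 0ℤ
coeff-vanish []      N h k       = refl
coeff-vanish (a ∷ p) N h zero    = proj₁ (small-root a _ (N ℕ.⊔ suc ℤ.∣ a ∣) (ℕₚ.m≤n⊔m N _) (h _ (ℕₚ.m≤m⊔n N _)))
coeff-vanish (a ∷ p) N h (suc k) = coeff-vanish p (N ℕ.⊔ suc ℤ.∣ a ∣)
  (λ m le → proj₂ (small-root a _ m (ℕₚ.≤-trans (ℕₚ.m≤n⊔m N _) le) (h m (ℕₚ.≤-trans (ℕₚ.m≤m⊔n N _) le)))) k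

coeff-unique : ∀ p q → (∀ x → eval p x ≡ eval q x) → ∀ k → coeff p k ≡ coeff q k
coeff-unique p q h k = trans (isolate (coeff p k) (coeff q k)) (trans (cong (_+ coeff q k) difference) (ℤₚ.+-identityˡ _))
  where
  isolate : ∀ a b → a ≡ a + -1ℤ * b + b
  isolate = solve-∀
  cancel : ∀ b → b + -1ℤ * b ≡ 0ℤ
  cancel = solve-∀
  difference : coeff p k + -1ℤ * coeff q k ≡ 0ℤ
  difference = trans (sym (trans (coeff-⊕ p (map (-1ℤ *_) q) k) (cong (λ t → coeff p k + t) (coeff-scale -1ℤ q k))))
    (coeff-vanish (p ⊕ map (-1ℤ *_) q) 0 (λ m _ → trans (eval-⊕ p (map (-1ℤ *_) q) (+ m))
      (trans (cong₂ _+_ (h (+ m)) (eval-scale -1ℤ q (+ m))) (cancel (eval q (+ m))))) k)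

-- Principal minors as coefficients

monomial : ℕ → ℤ → Poly
monomial zero    a = a ∷ []
monomial (suc e) a = + 0 ∷ monomial e a

eval-monomial : ∀ e a x → eval (monomial e a) x ≡ a * x ^ e
eval-monomial zero    a x = trans (cong (λ t → a + t) (ℤₚ.*-zeroʳ x)) (trans (ℤₚ.+-identityʳ a) (sym (ℤₚ.*-identityʳ a)))
eval-monomial (suc e) a x = trans (ℤₚ.+-identityˡ _) (trans (cong (x *_) (eval-monomial e a x)) (regroup x a (x ^ e)))
  where
  regroup : ∀ x a y → x * (a * y) ≡ a * (x * y)
  regroup = solve-∀

coeff-monomial : ∀ e a → coeff (monomial e a) e ≡ a
coeff-monomial zero    a = refl
coeff-monomial (suc e) a = coeff-monomial e a

coeff-monomial-other : ∀ e a {k} → e ≢ k → coeff (monomial e a) k ≡ 0ℤ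
coeff-monomial-other zero    a {zero}  ne = ⊥-elim (ne refl)
coeff-monomial-other zero    a {suc k} ne = refl
coeff-monomial-other (suc e) a {zero}  ne = refl
coeff-monomial-other (suc e) a {suc k} ne = coeff-monomial-other e a (ne ∘ cong suc)

⨁ₛ : ∀ {n} → (Vec Bool n → Poly) → Poly
⨁ₛ {zero}  g = g []
⨁ₛ {suc n} g = ⨁ₛ (λ b → g (true ∷ b)) ⊕ ⨁ₛ (λ b → g (false ∷ b))

eval-⨁ₛ : ∀ {n} (g : Vec Bool n → Poly) x → eval (⨁ₛ g) x ≡ ∑ₛ (λ b → eval (g b) x)
eval-⨁ₛ {zero}  g x = refl
eval-⨁ₛ {suc n} g x = trans (eval-⊕ (⨁ₛ λ b → g (true ∷ b)) (⨁ₛ λ b → g (false ∷ b)) x)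
  (cong₂ _+_ (eval-⨁ₛ (λ b → g (true ∷ b)) x) (eval-⨁ₛ (λ b → g (false ∷ b)) x))

coeff-⨁ₛ : ∀ {n} (g : Vec Bool n → Poly) k → coeff (⨁ₛ g) k ≡ ∑ₛ (λ b → coeff (g b) k)
coeff-⨁ₛ {zero}  g k = refl
coeff-⨁ₛ {suc n} g k = trans (coeff-⊕ (⨁ₛ λ b → g (true ∷ b)) (⨁ₛ λ b → g (false ∷ b)) k)
  (cong₂ _+_ (coeff-⨁ₛ (λ b → g (true ∷ b)) k) (coeff-⨁ₛ (λ b → g (false ∷ b)) k))

∑ₛ-*ˡ : ∀ {n} c (g : Vec Bool n → ℤ) → ∑ₛ (λ b → c * g b) ≡ c * ∑ₛ g
∑ₛ-*ˡ {zero}  c g = refl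
∑ₛ-*ˡ {suc n} c g = trans (cong₂ _+_ (∑ₛ-*ˡ c λ b → g (true ∷ b)) (∑ₛ-*ˡ c λ b → g (false ∷ b)))
  (sym (ℤₚ.*-distribˡ-+ c (∑ₛ λ b → g (true ∷ b)) (∑ₛ λ b → g (false ∷ b))))

∑ₛ-zero : ∀ {n} {g : Vec Bool n → ℤ} → (∀ b → g b ≡ 0ℤ) → ∑ₛ g ≡ 0ℤ
∑ₛ-zero {zero}  h = h []
∑ₛ-zero {suc n} h = cong₂ _+_ (∑ₛ-zero λ b → h (true ∷ b)) (∑ₛ-zero λ b → h (false ∷ b))

∑ₛ-nonNegative : ∀ {n} {g : Vec Bool n → ℤ} → (∀ b → 0ℤ ℤ.≤ g b) → 0ℤ ℤ.≤ ∑ₛ g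
∑ₛ-nonNegative {zero}  h = h []
∑ₛ-nonNegative {suc n} h = ℤₚ.+-mono-≤ (∑ₛ-nonNegative λ b → h (true ∷ b)) (∑ₛ-nonNegative λ b → h (false ∷ b))

∑ₛ-positive : ∀ {n} {g : Vec Bool n → ℤ} → (∀ b → 0ℤ ℤ.≤ g b) → ∀ b → 0ℤ < g b → 0ℤ < ∑ₛ g
∑ₛ-positive h []          p = p
∑ₛ-positive h (true ∷ b)  p = ℤₚ.+-mono-<-≤ (∑ₛ-positive (λ b → h (true ∷ b)) b p) (∑ₛ-nonNegative λ b → h (false ∷ b))
∑ₛ-positive h (false ∷ b) p = ℤₚ.+-mono-≤-< (∑ₛ-nonNegative λ b → h (true ∷ b)) (∑ₛ-positive (λ b → h (false ∷ b)) b p)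

δ : ∀ {n} → Fin n → Fin n → ℤ
δ i j = if i == j then 1ℤ else 0ℤ

-- Its determinant is the principal minor of M on the rows and columns in b.
principal : ∀ {n} → Mat n → Vec Bool n → Mat n
principal M b i j = if lookup b i then M i j else δ i j

size : ∀ {n} → Vec Bool n → ℕ
size b = count (lookup b)

cosize : ∀ {n} → Vec Bool n → ℕ
cosize []          = 0
cosize (true ∷ b)  = cosize b
cosize (false ∷ b) = suc (cosize b)

cosize+size : ∀ {n} (b : Vec Bool n) → cosize b ℕ.+ size b ≡ n
cosize+size []          = refl
cosize+size (true ∷ b)  = trans (ℕₚ.+-suc (cosize b) (size b)) (cong suc (cosize+size b))
cosize+size (false ∷ b) = cong suc (cosize+size b)

diagonal : ∀ {n} → (Fin n → Bool) → ℤ → Fin n → ℤ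
diagonal keep x i = if keep i then 0ℤ else x

-- The factor with which the set b enters det (x D - M): a sign for every row taken from -M, and
-- zero as soon as a row in `keep` is not taken from there, since D vanishes on it.
weight : ∀ {n} → (Fin n → Bool) → Vec Bool n → ℤ
weight keep b = prod λ i → if lookup b i then -1ℤ else diagonal keep 1ℤ i

prod-weight : ∀ {n} (keep : Fin n → Bool) b x →
  prod (λ i → if lookup b i then -1ℤ else diagonal keep x i) ≡ weight keep b * x ^ cosize b
prod-weight keep [] x = refl
prod-weight keep (true ∷ b) x = trans (cong (-1ℤ *_) (prod-weight (keep ∘ suc) b x))
  (sym (ℤₚ.*-assoc -1ℤ (weight (keep ∘ suc) b) (x ^ cosize b)))
prod-weight keep (false ∷ b) x with keep zero
... | true  = trans (ℤₚ.*-zeroˡ (prod λ i → if lookup b i then -1ℤ else diagonal (keep ∘ suc) x i))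
  (sym (trans (cong (_* (x * x ^ cosize b)) (ℤₚ.*-zeroˡ (weight (keep ∘ suc) b))) (ℤₚ.*-zeroˡ (x * x ^ cosize b))))
... | false = trans (cong (x *_) (prod-weight (keep ∘ suc) b x)) (regroup x (weight (keep ∘ suc) b) (x ^ cosize b))
  where
  regroup : ∀ x w y → x * (w * y) ≡ (1ℤ * w) * (x * y)
  regroup = solve-∀

weight-keep : ∀ {n} (keep : Fin n → Bool) b → (∀ i → keep i ≡ true → lookup b i ≡ true) → weight keep b ≡ -1ℤ ^ size b
weight-keep keep [] h = refl
weight-keep keep (true ∷ b) h = cong (-1ℤ *_) (weight-keep (keep ∘ suc) b (λ i → h (suc i)))
weight-keep keep (false ∷ b) h with keep zero in eq
... | false = trans (ℤₚ.*-identityˡ (weight (keep ∘ suc) b)) (weight-keep (keep ∘ suc) b (λ i → h (suc i)))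
... | true with () ← h zero eq

weight-drop : ∀ {n} (keep : Fin n → Bool) b i → keep i ≡ true → lookup b i ≡ false → weight keep b ≡ 0ℤ
weight-drop keep (false ∷ b) zero    k refl rewrite k = ℤₚ.*-zeroˡ (weight (keep ∘ suc) b)
weight-drop keep (c ∷ b)     (suc i) k l = trans (cong (c′ *_) (weight-drop (keep ∘ suc) b i k l)) (ℤₚ.*-zeroʳ c′)
  where
  c′ : ℤ
  c′ = if c then -1ℤ else diagonal keep 1ℤ zero

minorPoly : ∀ {n} → (Fin n → Bool) → Mat n → Poly
minorPoly {n} keep M = ⨁ₛ λ b → monomial (cosize b) (weight keep b * detℤ n (principal M b))

-- Each row is the sum of a row of -M and a multiple of a unit row. Choosing the first for the rows
-- in b and the second elsewhere gives the principal minor on b, and each unit row contributes a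
-- factor x or 0.
det-diagonal-minus : ∀ {n} (keep : Fin n → Bool) (M : Mat n) x →
  detℤ n (λ i j → diagonal keep x i * δ i j + - M i j) ≡ eval (minorPoly keep M) x
det-diagonal-minus {n} keep M x = begin
  detℤ n (λ i j → z i * δ i j + - M i j)
    ≡⟨ det-cong (λ i j → trans (ℤₚ.+-comm (z i * δ i j) (- M i j)) (cong (_+ z i * δ i j) (sym (ℤₚ.-1*i≡-i (M i j))))) ⟩
  detℤ n (λ i j → -1ℤ * M i j + z i * δ i j)
    ≡⟨ multiExpand det-multiadditive (λ i j → -1ℤ * M i j) (λ i j → z i * δ i j) ⟩
  ∑ₛ (λ b → detℤ n (λ i j → if lookup b i then -1ℤ * M i j else z i * δ i j))
    ≡⟨ ∑ₛ-cong (λ b → trans (det-cong (factor b)) (det-scaleRows (scalar b) (principal M b))) ⟩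
  ∑ₛ (λ b → prod (scalar b) * detℤ n (principal M b))
    ≡⟨ ∑ₛ-cong (λ b → trans (cong (_* detℤ n (principal M b)) (prod-weight keep b x))
         (trans (regroup (weight keep b) (x ^ cosize b) (detℤ n (principal M b)))
           (sym (eval-monomial (cosize b) (weight keep b * detℤ n (principal M b)) x)))) ⟩
  ∑ₛ (λ b → eval (monomial (cosize b) (weight keep b * detℤ n (principal M b))) x)
    ≡⟨ sym (eval-⨁ₛ (λ b → monomial (cosize b) (weight keep b * detℤ n (principal M b))) x) ⟩
  eval (minorPoly keep M) x ∎
  where
  open ≡-Reasoning
  z : Fin n → ℤ
  z = diagonal keep x
  scalar : Vec Bool n → Fin n → ℤ
  scalar b i = if lookup b i then -1ℤ else z i
  regroup : ∀ w y d → w * y * d ≡ w * d * y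
  regroup = solve-∀
  factor : ∀ b i j → (if lookup b i then -1ℤ * M i j else z i * δ i j) ≡ scalar b i * principal M b i j
  factor b i j with lookup b i
  ... | true  = refl
  ... | false = refl

module MinorCoefficients {n} (keep : Fin n → Bool) (M : Mat n) (i : ℕ) (i≤n : i ℕ.≤ n) where

  Admissible : Vec Bool n → Set
  Admissible b = size b ≡ i × (∀ j → keep j ≡ true → lookup b j ≡ true)

  admissible? : ∀ b → Dec (Admissible b)
  admissible? b = (size b ℕ.≟ i) ×-dec Finₚ.all? λ j → (keep j Bool.≟ true) →-dec (lookup b j Bool.≟ true)

  term : Vec Bool n → ℤ
  term b = -1ℤ ^ i * coeff (monomial (cosize b) (weight keep b * detℤ n (principal M b))) (n ∸ i)

  coefficient : -1ℤ ^ i * coeff (minorPoly keep M) (n ∸ i) ≡ ∑ₛ term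
  coefficient = trans (cong (-1ℤ ^ i *_) (coeff-⨁ₛ (λ b → monomial (cosize b) (weight keep b * detℤ n (principal M b))) (n ∸ i)))
    (sym (∑ₛ-*ˡ (-1ℤ ^ i) λ b → coeff (monomial (cosize b) (weight keep b * detℤ n (principal M b))) (n ∸ i)))

  sign-square : ∀ k → -1ℤ ^ k * -1ℤ ^ k ≡ 1ℤ
  sign-square zero    = refl
  sign-square (suc k) = trans (regroup (-1ℤ ^ k)) (sign-square k)
    where
    regroup : ∀ s → (-1ℤ * s) * (-1ℤ * s) ≡ s * s
    regroup = solve-∀

  cosize≡ : ∀ (b : Vec Bool n) → size b ≡ i → cosize b ≡ n ∸ i
  cosize≡ b s = sym (trans (cong₂ _∸_ (sym (cosize+size b)) (sym s)) (ℕₚ.m+n∸n≡m (cosize b) (size b)))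

  -- The bound on i enters here: with truncated subtraction, `n ∸ i` determines i only when i ≤ n.
  size≡ : ∀ (b : Vec Bool n) → cosize b ≡ n ∸ i → size b ≡ i
  size≡ b e = ℕₚ.+-cancelˡ-≡ (cosize b) (size b) i (trans (cosize+size b) (sym (trans (cong (ℕ._+ i) e) (ℕₚ.m∸n+n≡m i≤n))))

  term-admissible : ∀ b → Admissible b → term b ≡ detℤ n (principal M b)
  term-admissible b (s , k) = begin
    term b
      ≡⟨ cong (λ e → -1ℤ ^ i * coeff (monomial e (weight keep b * D)) (n ∸ i)) (cosize≡ b s) ⟩
    -1ℤ ^ i * coeff (monomial (n ∸ i) (weight keep b * D)) (n ∸ i)
      ≡⟨ cong (-1ℤ ^ i *_) (coeff-monomial (n ∸ i) (weight keep b * D)) ⟩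
    -1ℤ ^ i * (weight keep b * D)
      ≡⟨ cong (λ w → -1ℤ ^ i * (w * D)) (trans (weight-keep keep b k) (cong (-1ℤ ^_) s)) ⟩
    -1ℤ ^ i * (-1ℤ ^ i * D)
      ≡⟨ sym (ℤₚ.*-assoc (-1ℤ ^ i) (-1ℤ ^ i) D) ⟩
    (-1ℤ ^ i * -1ℤ ^ i) * D
      ≡⟨ trans (cong (_* D) (sign-square i)) (ℤₚ.*-identityˡ D) ⟩
    D ∎
    where
    open ≡-Reasoning
    D : ℤ
    D = detℤ n (principal M b)

  -- Either the monomial has the wrong degree, or a vertex in `keep` is missing and the weight is
  -- zero.
  term-other : ∀ b → ¬ Admissible b → term b ≡ 0ℤ
  term-other b ¬adm with cosize b ℕ.≟ n ∸ i
  ... | no ne = trans (cong (-1ℤ ^ i *_) (coeff-monomial-other (cosize b) _ ne)) (ℤₚ.*-zeroʳ (-1ℤ ^ i))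
  ... | yes e = trans (cong (-1ℤ ^ i *_) (trans (cong (λ w → coeff (monomial (cosize b) w) (n ∸ i)) zeroWeight) (zeroCoeff (cosize b) (n ∸ i))))
      (ℤₚ.*-zeroʳ (-1ℤ ^ i))
    where
    zeroCoeff : ∀ e k → coeff (monomial e 0ℤ) k ≡ 0ℤ
    zeroCoeff zero    zero    = refl
    zeroCoeff zero    (suc k) = refl
    zeroCoeff (suc e) zero    = refl
    zeroCoeff (suc e) (suc k) = zeroCoeff e k
    zeroWeight : weight keep b * detℤ n (principal M b) ≡ 0ℤ
    zeroWeight with Finₚ.¬∀⟶∃¬ n (λ j → keep j ≡ true → lookup b j ≡ true)
      (λ j → (keep j Bool.≟ true) →-dec (lookup b j Bool.≟ true)) (λ k → ¬adm (size≡ b e , k))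
    ... | j , ne with keep j in kj | lookup b j in bj
    ... | true  | false = trans (cong (_* detℤ n (principal M b)) (weight-drop keep b j kj bj)) (ℤₚ.*-zeroˡ (detℤ n (principal M b)))
    ... | true  | true  = ⊥-elim (ne (λ _ → refl))
    ... | false | _     = ⊥-elim (ne (λ ()))

-- Cycles, bipartiteness and bridges

==-refl : ∀ {n} (x : Fin n) → (x == x) ≡ true
==-refl x with x ≟ x
... | yes _ = refl
... | no ne = ⊥-elim (ne refl)

==⇒≡ : ∀ {n} {x y : Fin n} → (x == y) ≡ true → x ≡ y
==⇒≡ {x = x} {y} e with x ≟ y
... | yes p = p
==⇒≡ () | no _

==-≢ : ∀ {n} {x y : Fin n} → x ≢ y → (x == y) ≡ false
==-≢ {x = x} {y} ne with x ≟ y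
... | yes e = ⊥-elim (ne e)
... | no _  = refl

∧-true : ∀ {a b} → a ∧ b ≡ true → a ≡ true × b ≡ true
∧-true {true} {true} refl = refl , refl

∨-true : ∀ {a b} → a ∨ b ≡ true → a ≡ true ⊎ b ≡ true
∨-true {true}  e = inj₁ refl
∨-true {false} e = inj₂ e

∨-trueʳ : ∀ a {b} → b ≡ true → a ∨ b ≡ true
∨-trueʳ true  e = refl
∨-trueʳ false e = e

Symmetric : ∀ {n} → Adj n → Set
Symmetric A = ∀ x y → A x y ≡ A y x

_⊑_ : ∀ {n} → Adj n → Adj n → Set
H ⊑ A = ∀ {x y} → H x y ≡ true → A x y ≡ true

module _ {n : ℕ} where

  reach-trans : ∀ {A : Adj n} {x y z} → Reach A x y → Reach A y z → Reach A x z
  reach-trans here       s = s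
  reach-trans (step e r) s = step e (reach-trans r s)

  reach-mono : ∀ {H A : Adj n} → H ⊑ A → ∀ {x y} → Reach H x y → Reach A x y
  reach-mono H⊑A here       = here
  reach-mono H⊑A (step e r) = step (H⊑A e) (reach-mono H⊑A r)

  isPair : Fin n → Fin n → Adj n
  isPair p q x y = ((x == p) ∧ (y == q)) ∨ ((x == q) ∧ (y == p))

  isPair-cases : ∀ {p q x y} → isPair p q x y ≡ true → (x ≡ p × y ≡ q) ⊎ (x ≡ q × y ≡ p)
  isPair-cases e with ∨-true e
  ... | inj₁ e₁ = let (f , g) = ∧-true e₁ in inj₁ (==⇒≡ f , ==⇒≡ g)
  ... | inj₂ e₂ = let (f , g) = ∧-true e₂ in inj₂ (==⇒≡ f , ==⇒≡ g)

  isPair-here : ∀ p q → isPair p q p q ≡ true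
  isPair-here p q rewrite ==-refl p | ==-refl q = refl

  isPair-there : ∀ p q → isPair p q q p ≡ true
  isPair-there p q rewrite ==-refl p | ==-refl q = ∨-trueʳ _ refl

  isPair-sym : ∀ p q → Symmetric (isPair p q)
  isPair-sym p q x y = trans (Boolₚ.∨-comm ((x == p) ∧ (y == q)) ((x == q) ∧ (y == p)))
    (cong₂ _∨_ (Boolₚ.∧-comm (x == q) (y == p)) (Boolₚ.∧-comm (x == p) (y == q)))

  addEdge : Adj n → Fin n → Fin n → Adj n
  addEdge H p q x y = H x y ∨ isPair p q x y

  addEdge-⊒ : ∀ H p q → H ⊑ addEdge H p q
  addEdge-⊒ H p q {x} {y} e = cong (_∨ isPair p q x y) e

  addEdge-new : ∀ H p q → addEdge H p q p q ≡ true
  addEdge-new H p q = ∨-trueʳ (H p q) (isPair-here p q)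

  addEdge-new′ : ∀ H p q → addEdge H p q q p ≡ true
  addEdge-new′ H p q = ∨-trueʳ (H q p) (isPair-there p q)

  addEdge-cases : ∀ H p q {x y} → addEdge H p q x y ≡ true → H x y ≡ true ⊎ (x ≡ p × y ≡ q) ⊎ (x ≡ q × y ≡ p)
  addEdge-cases H p q e with ∨-true e
  ... | inj₁ e₁ = inj₁ e₁
  ... | inj₂ e₂ = inj₂ (isPair-cases e₂)

  -- A form of induction over graphs: B is reached from the empty graph by inserting its edges in
  -- the order of a list, while data about the part already built is carried along.
  build : Adj n → List (Fin n × Fin n) → Adj n
  build B []            = λ _ _ → false
  build B ((p , q) ∷ L) = if B p q then addEdge (build B L) p q else build B L

  build-⊑ : ∀ {B} → Symmetric B → ∀ L → build B L ⊑ B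
  build-⊑ B-sym []            ()
  build-⊑ {B} B-sym ((p , q) ∷ L) e with B p q in pq
  ... | false = build-⊑ B-sym L e
  ... | true with addEdge-cases (build B L) p q e
  ...   | inj₁ e₁ = build-⊑ B-sym L e₁
  ...   | inj₂ (inj₁ (refl , refl)) = pq
  ...   | inj₂ (inj₂ (refl , refl)) = trans (B-sym _ _) pq

  build-∈ : ∀ {B : Adj n} {x y} → B x y ≡ true → ∀ {L} → (x , y) ∈ L → build B L x y ≡ true
  build-∈ {B} {x} {y} e {_ ∷ L}       (here refl) rewrite e = addEdge-new (build B L) x y
  build-∈ {B} e {(p , q) ∷ L} (there m) with B p q
  ... | true  = addEdge-⊒ (build B L) p q (build-∈ e m)
  ... | false = build-∈ e m

  allPairs : List (Fin n × Fin n)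
  allPairs = cartesianProduct (allFin n) (allFin n)

  build-all : ∀ {B : Adj n} → B ⊑ build B allPairs
  build-all e = build-∈ e (∈-cartesianProduct⁺ (∈-allFin _) (∈-allFin _))

  -- Names for the connected components. Since labels can be compared, lying in the same component
  -- becomes decidable.
  record Labelling (H : Adj n) : Set where
    field
      label   : Fin n → Fin n
      sound   : ∀ {x y} → label x ≡ label y → Reach H x y
      on-edge : ∀ {x y} → H x y ≡ true → label x ≡ label y

  addEdge-labelling : ∀ {H} p q → Labelling H → Labelling (addEdge H p q)
  addEdge-labelling {H} p q L = record { label = label′ ; sound = sound′ _ _ ; on-edge = on-edge′ }
    where
    open Labelling L
    label′ : Fin n → Fin n
    label′ x with label x ≟ label p
    ... | yes _ = label q
    ... | no _  = label x
    weaken : ∀ {x y} → label x ≡ label y → Reach (addEdge H p q) x y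
    weaken e = reach-mono (addEdge-⊒ H p q) (sound e)
    sound′ : ∀ x y → label′ x ≡ label′ y → Reach (addEdge H p q) x y
    sound′ x y e with label x ≟ label p | label y ≟ label p
    ... | yes a | yes b = weaken (trans a (sym b))
    ... | yes a | no _  = reach-trans (weaken a) (step (addEdge-new H p q) (weaken e))
    ... | no _  | yes b = reach-trans (weaken e) (step (addEdge-new′ H p q) (weaken (sym b)))
    ... | no _  | no _  = weaken e
    label′-p : label′ p ≡ label q
    label′-p with label p ≟ label p
    ... | yes _ = refl
    ... | no ne = ⊥-elim (ne refl)
    label′-q : label′ q ≡ label q
    label′-q with label q ≟ label p
    ... | yes _ = refl
    ... | no _  = refl
    label′-cong : ∀ {x y} → label x ≡ label y → label′ x ≡ label′ y
    label′-cong {x} {y} e with label x ≟ label p | label y ≟ label p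
    ... | yes _ | yes _ = refl
    ... | yes a | no b  = ⊥-elim (b (trans (sym e) a))
    ... | no a  | yes b = ⊥-elim (a (trans e b))
    ... | no _  | no _  = e
    on-edge′ : ∀ {x y} → addEdge H p q x y ≡ true → label′ x ≡ label′ y
    on-edge′ e with addEdge-cases H p q e
    ... | inj₁ h = label′-cong (on-edge h)
    ... | inj₂ (inj₁ (refl , refl)) = trans label′-p (sym label′-q)
    ... | inj₂ (inj₂ (refl , refl)) = trans label′-q (sym label′-p)

  build-labelling : ∀ B L → Labelling (build B L)
  build-labelling B [] = record { label = λ x → x ; sound = λ { refl → here } ; on-edge = λ () }
  build-labelling B ((p , q) ∷ L) with B p q
  ... | true  = addEdge-labelling p q (build-labelling B L)
  ... | false = build-labelling B L

  labelling : ∀ {B} → Symmetric B → Labelling B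
  labelling {B} B-sym = record
    { label   = label
    ; sound   = reach-mono (build-⊑ B-sym allPairs) ∘ sound
    ; on-edge = on-edge ∘ build-all
    }
    where open Labelling (build-labelling B allPairs)

  -- Simple paths and cycles

  data Chain (H : Adj n) : Fin n → List (Fin n) → Fin n → Set where
    [_] : ∀ x → Chain H x (x ∷ []) x
    _∷_ : ∀ {x y z l} → H x y ≡ true → Chain H y l z → Chain H x (x ∷ l) z

  SimplePath : Adj n → Fin n → Fin n → Set
  SimplePath H x z = ∃ λ l → Chain H x l z × Unique l

  -- A path that is about to revisit x is restarted at the later occurrence of x.
  cut : ∀ {H x y z l} → x ∈ l → Chain H y l z → Unique l → SimplePath H x z
  cut (here refl) [ x ]   U       = _ , [ x ] , U
  cut (here refl) (e ∷ c) U       = _ , e ∷ c , U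
  cut (there m)   (e ∷ c) (_ ∷ U) = cut m c U

  simplePath : ∀ {H x z} → Reach H x z → SimplePath H x z
  simplePath {x = x} here = _ , [ x ] , [] ∷ []
  simplePath {x = x} (step e r) with simplePath r
  ... | l , c , U with Any.any? (x ≟_) l
  ...   | yes m = cut m c U
  ...   | no x∉ = _ , e ∷ c , ¬Any⇒All¬ l x∉ ∷ U

  unique-lookup : ∀ {l : List (Fin n)} → Unique l → ∀ i j → List.lookup l i ≡ List.lookup l j → i ≡ j
  unique-lookup (a ∷ U) zero    zero    e = refl
  unique-lookup (a ∷ U) zero    (suc j) e = ⊥-elim (All.lookup a (∈-lookup j) e)
  unique-lookup (a ∷ U) (suc i) zero    e = ⊥-elim (All.lookup a (∈-lookup i) (sym e))
  unique-lookup (a ∷ U) (suc i) (suc j) e = cong suc (unique-lookup U i j e)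

  module _ {H : Adj n} where

    chain-first : ∀ {x l z} → Chain H x l z → ∃ λ (i : Fin (length l)) → toℕ i ≡ 0
    chain-first [ _ ]   = zero , refl
    chain-first (_ ∷ _) = zero , refl

    chain-last : ∀ {x l z} → Chain H x l z → ∃ λ (i : Fin (length l)) → suc (toℕ i) ≡ length l
    chain-last [ _ ]   = zero , refl
    chain-last (_ ∷ c) = let (i , e) = chain-last c in suc i , cong suc e

    lookup-first : ∀ {x l z} → Chain H x l z → ∀ i → toℕ i ≡ 0 → List.lookup l i ≡ x
    lookup-first [ _ ]   zero e = refl
    lookup-first (_ ∷ _) zero e = refl

    lookup-last : ∀ {x l z} → Chain H x l z → ∀ i → suc (toℕ i) ≡ length l → List.lookup l i ≡ z
    lookup-last [ _ ]         zero    e = refl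
    lookup-last (_ ∷ [ _ ])   zero    ()
    lookup-last (_ ∷ (_ ∷ _)) zero    ()
    lookup-last (_ ∷ c)       (suc i) e = lookup-last c i (ℕₚ.suc-injective e)

    lookup-step : ∀ {x l z} → Chain H x l z → ∀ i j → suc (toℕ i) ≡ toℕ j →
      H (List.lookup l i) (List.lookup l j) ≡ true
    lookup-step [ _ ]   zero    zero    ()
    lookup-step (e ∷ c) zero    (suc j) s = trans (cong (H _) (lookup-first c j (sym (ℕₚ.suc-injective s)))) e
    lookup-step (e ∷ c) (suc i) (suc j) s = lookup-step c i j (ℕₚ.suc-injective s)

    chain-length : ∀ {x l z} → Chain H x l z → x ≢ z → H x z ≢ true → 3 ≤ length l
    chain-length [ _ ]             x≢z xz = ⊥-elim (x≢z refl)
    chain-length (e ∷ [ _ ])       x≢z xz = ⊥-elim (xz e)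
    chain-length (_ ∷ _ ∷ [ _ ])   x≢z xz = s≤s (s≤s (s≤s z≤n))
    chain-length (_ ∷ _ ∷ (_ ∷ _)) x≢z xz = s≤s (s≤s (s≤s z≤n))

    -- A simple path from p to q in `H` is closed by the edge from q back to p in `A`. It has at
    -- least three vertices because p and q are distinct and not adjacent in `H`.
    cycle-through : ∀ {A : Adj n} → H ⊑ A → ∀ {p q} → p ≢ q → A q p ≡ true → H p q ≢ true →
      Reach H p q → Σ (Cycle A) λ C → CycleEdge C p q
    cycle-through {A} H⊑A {p} {q} p≢q qp pq r with simplePath r
    ... | l , c , U = record
        { len    = length l
        ; len≥3  = chain-length c p≢q pq
        ; vert   = List.lookup l
        ; inj    = unique-lookup U
        ; closed = λ { i j (inj₁ s) → H⊑A (lookup-step c i j s)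
                     ; i j (inj₂ (s , z)) → trans (cong₂ A (lookup-last c i s) (lookup-first c j z)) qp }
        }
      , (let (i , s) = chain-last c ; (j , z) = chain-first c in
          i , j , inj₂ (s , z) , inj₂ (lookup-last c i s , lookup-first c j z))

  -- An edge of the cycle is recorded as well, because its end will tell on which side of the bridge
  -- the cycle lies.
  CycleOn : Adj n → Set
  CycleOn B = ∃ λ x → ∃ λ y → B x y ≡ true × Σ (Cycle B) λ C → CycleEdge C x y

  -- Edges are added one at a time; an edge inside a component that is monochromatic closes
  -- a cycle, one between two components can be fixed by flipping the colours of one of them.
  bipartite⊎cycle-build : ∀ {B} → IsSimple B → ∀ L → Bipartite (build B L) ⊎ CycleOn B
  bipartite⊎cycle-build B-simple [] = inj₁ ((λ _ → true) , λ _ _ ())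
  bipartite⊎cycle-build {B} B-simple@(B-sym , B-irr) ((p , q) ∷ L) with B p q in pq | bipartite⊎cycle-build B-simple L
  ... | _     | inj₂ c = inj₂ c
  ... | false | inj₁ b = inj₁ b
  ... | true  | inj₁ (c , proper) = cases (c p Bool.≟ c q) (label p ≟ label q)
    where
    H = build B L
    open Labelling (build-labelling B L)
    p≢q : p ≢ q
    p≢q refl with () ← trans (sym pq) (B-irr p)

    flipped : Fin n → Bool
    flipped x = if label x == label p then not (c x) else c x

    flipped-proper : c p ≡ c q → label p ≢ label q → ∀ x y → addEdge H p q x y ≡ true → flipped x ≢ flipped y
    flipped-proper cpq lpq x y e with addEdge-cases H p q e
    ... | inj₁ h rewrite on-edge h with label y == label p
    ...   | true  = proper x y h ∘ Boolₚ.not-injective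
    ...   | false = proper x y h
    flipped-proper cpq lpq x y e | inj₂ (inj₁ (refl , refl))
      rewrite ==-refl (label p) | ==-≢ (lpq ∘ sym) = λ eq → Boolₚ.not-¬ (sym cpq) (sym eq)
    flipped-proper cpq lpq x y e | inj₂ (inj₂ (refl , refl))
      rewrite ==-refl (label p) | ==-≢ (lpq ∘ sym) = λ eq → Boolₚ.not-¬ (sym cpq) eq

    cases : Dec (c p ≡ c q) → Dec (label p ≡ label q) → Bipartite (addEdge H p q) ⊎ CycleOn B
    cases (no cpq) _ = inj₁ (c , λ x y e → proper′ (addEdge-cases H p q e))
      where
      proper′ : ∀ {x y} → H x y ≡ true ⊎ (x ≡ p × y ≡ q) ⊎ (x ≡ q × y ≡ p) → c x ≢ c y
      proper′ (inj₁ h) = proper _ _ h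
      proper′ (inj₂ (inj₁ (refl , refl))) = cpq
      proper′ (inj₂ (inj₂ (refl , refl))) = cpq ∘ sym
    cases (yes cpq) (yes lpq) = inj₂ (p , q , pq ,
      cycle-through (build-⊑ B-sym L) p≢q (trans (B-sym q p) pq) (λ h → proper p q h cpq) (sound lpq))
    cases (yes cpq) (no lpq) = inj₁ (flipped , flipped-proper cpq lpq)

  bipartite⊎cycle : ∀ {B} → IsSimple B → Bipartite B ⊎ CycleOn B
  bipartite⊎cycle B-simple with bipartite⊎cycle-build B-simple allPairs
  ... | inj₁ (c , proper) = inj₁ (c , λ x y e → proper x y (build-all e))
  ... | inj₂ cyc = inj₂ cyc

  bipartite? : ∀ (B : Adj n) → Dec (Bipartite B)
  bipartite? B = map′ (λ (c , proper) → lookup c , proper)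
    (λ (c , proper) → tabulate c , λ x y e → subst₂ _≢_ (sym (Vecₚ.lookup∘tabulate c x)) (sym (Vecₚ.lookup∘tabulate c y)) (proper x y e))
    (anySubset? λ c → Finₚ.all? λ x → Finₚ.all? λ y → (B x y Bool.≟ true) →-dec ¬? (lookup c x Bool.≟ lookup c y))

-- The two sides of the bridge

deleteEdge : ∀ {n} → Adj n → Fin n → Fin n → Adj n
deleteEdge A u v x y = A x y ∧ not (isPair u v x y)

deleteEdge-⊑ : ∀ {n} (A : Adj n) u v → deleteEdge A u v ⊑ A
deleteEdge-⊑ A u v e = proj₁ (∧-true e)

deleteEdge-simple : ∀ {n} (A : Adj n) u v → IsSimple A → IsSimple (deleteEdge A u v)
deleteEdge-simple A u v (A-sym , A-irr) =
  (λ x y → cong₂ (λ a b → a ∧ not b) (A-sym x y) (isPair-sym u v x y)) ,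
  (λ x → cong (_∧ not (isPair u v x x)) (A-irr x))

deleteEdge-cases : ∀ {n} (A : Adj n) u v {x y} → A x y ≡ true →
  deleteEdge A u v x y ≡ true ⊎ (x ≡ u × y ≡ v) ⊎ (x ≡ v × y ≡ u)
deleteEdge-cases A u v {x} {y} e with isPair u v x y in p
... | false = inj₁ (trans (cong (_∧ true) e) refl)
... | true  = inj₂ (isPair-cases p)

module Bridge {n} (A : Adj n) (A-simple : IsSimple A) (A-connected : Connected A) (u v : Fin n)
  (uv : A u v ≡ true) (nonCycle : ∀ (C : Cycle A) → ¬ CycleEdge C u v) where

  A-sym = proj₁ A-simple

  B : Adj n
  B = deleteEdge A u v

  B⊑A : B ⊑ A
  B⊑A = deleteEdge-⊑ A u v

  B-simple : IsSimple B
  B-simple = deleteEdge-simple A u v A-simple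

  u≢v : u ≢ v
  u≢v refl with () ← trans (sym uv) (proj₂ A-simple u)

  B-uv : B u v ≡ false
  B-uv = trans (cong (λ b → A u v ∧ not b) (isPair-here u v)) (Boolₚ.∧-zeroʳ (A u v))

  open Labelling (labelling (proj₁ B-simple))

  -- A path from u to v that avoids the edge uv would be closed by it to a cycle.
  label-u≢v : label u ≢ label v
  label-u≢v e = let (C , ce) = cycle-through {H = B} B⊑A u≢v (trans (A-sym v u) uv) (λ h → Boolₚ.not-¬ h B-uv) (sound e)
    in nonCycle C ce

  side : Fin n → Bool
  side x = label x == label u

  side-u : side u ≡ true
  side-u = ==-refl (label u)

  side-v : side v ≡ false
  side-v = ==-≢ (label-u≢v ∘ sym)

  side-edge : ∀ {x y} → B x y ≡ true → side x ≡ side y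
  side-edge e = cong (_== label u) (on-edge e)

  side-different : ∀ {x y} → side x ≢ side y → B x y ≡ false
  side-different {x} {y} ne with B x y in e
  ... | true  = ⊥-elim (ne (side-edge e))
  ... | false = refl

  -- Along a path in `A` the label can change only at the edge uv, whose ends carry these two
  -- labels. So `B` has just the components of u and v.
  two-labels : ∀ {x} → Reach A x u → label x ≡ label u ⊎ label x ≡ label v
  two-labels here = inj₁ refl
  two-labels (step e r) with deleteEdge-cases A u v e
  ... | inj₂ (inj₁ (refl , _)) = inj₁ refl
  ... | inj₂ (inj₂ (refl , _)) = inj₂ refl
  ... | inj₁ b with two-labels r
  ...   | inj₁ l = inj₁ (trans (on-edge b) l)
  ...   | inj₂ l = inj₂ (trans (on-edge b) l)

  side-reach : ∀ {x y} → side x ≡ side y → Reach B x y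
  side-reach {x} {y} e with two-labels (A-connected x u) | two-labels (A-connected y u)
  ... | inj₁ a | inj₁ b = sound (trans a (sym b))
  ... | inj₂ a | inj₂ b = sound (trans a (sym b))
  ... | inj₁ a | inj₂ b = ⊥-elim (label-u≢v (trans (sym (==⇒≡ (trans (sym e) (trans (cong (_== label u) a) side-u)))) b))
  ... | inj₂ a | inj₁ b = ⊥-elim (label-u≢v (trans (sym (==⇒≡ (trans e (trans (cong (_== label u) b) side-u)))) a))

  on : Bool → Bool → Bool
  on t b = if t then b else not b

  -- The vertex set stays `Fin n`. Vertices of the other side become isolated and put no condition
  -- on a colouring, so bipartiteness of `half t` is that of side t.
  half : Bool → Adj n
  half t x y = B x y ∧ on t (side x)

  on-true : ∀ t {b} → on t b ≡ true → b ≡ t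
  on-true true  e = e
  on-true false e = Boolₚ.not-injective e

  on-self : ∀ t → on t t ≡ true
  on-self true  = refl
  on-self false = refl

  half-intro : ∀ {t x y} → B x y ≡ true → side x ≡ t → half t x y ≡ true
  half-intro {t} b s = cong₂ _∧_ b (trans (cong (on t) s) (on-self t))

  half-elim : ∀ {t x y} → half t x y ≡ true → B x y ≡ true × side x ≡ t
  half-elim {t} e = let (b , s) = ∧-true e in b , on-true t s

  half-simple : ∀ t → IsSimple (half t)
  half-simple t = half-sym , λ x → cong (_∧ on t (side x)) (proj₂ B-simple x)
    where
    half-sym : Symmetric (half t)
    half-sym x y with B x y in e | B y x in e′
    ... | true  | true  = cong (on t) (side-edge e)
    ... | false | false = refl
    ... | true  | false = ⊥-elim (Boolₚ.not-¬ e (trans (proj₁ B-simple x y) e′))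
    ... | false | true  = ⊥-elim (Boolₚ.not-¬ e′ (trans (proj₁ B-simple y x) e))

  half⊑A : ∀ t → half t ⊑ A
  half⊑A t {x} {y} e = B⊑A (proj₁ (half-elim {t} {x} {y} e))

  module _ (C : Cycle A) where
    open Cycle C

    side-step : ∀ i j → CSucc len i j → side (vert i) ≡ side (vert j)
    side-step i j s with deleteEdge-cases A u v (closed i j s)
    ... | inj₁ b = side-edge b
    ... | inj₂ (inj₁ (a , b)) = ⊥-elim (nonCycle C (i , j , s , inj₁ (a , b)))
    ... | inj₂ (inj₂ (a , b)) = ⊥-elim (nonCycle C (i , j , s , inj₂ (a , b)))

    0<len : 0 ℕ.< len
    0<len = ℕₚ.≤-trans (s≤s z≤n) len≥3

    side-constant : ∀ k (k<len : k ℕ.< len) → side (vert (fromℕ< k<len)) ≡ side (vert (fromℕ< 0<len))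
    side-constant zero    k<len = refl
    side-constant (suc k) k<len = trans (sym (side-step (fromℕ< k<len′) (fromℕ< k<len)
        (inj₁ (trans (cong suc (Finₚ.toℕ-fromℕ< k<len′)) (sym (Finₚ.toℕ-fromℕ< k<len))))))
      (side-constant k k<len′)
      where k<len′ = ℕₚ.<-trans (ℕₚ.n<1+n k) k<len

    side-vert : ∀ i → side (vert i) ≡ side (vert (fromℕ< 0<len))
    side-vert i = trans (cong (side ∘ vert) (sym (Finₚ.fromℕ<-toℕ i (Finₚ.toℕ<n i)))) (side-constant (toℕ i) (Finₚ.toℕ<n i))

    side-cycleEdge : ∀ {a b} → CycleEdge C a b → side a ≡ side (vert (fromℕ< 0<len))
    side-cycleEdge (i , j , _ , inj₁ (refl , _)) = side-vert i
    side-cycleEdge (i , j , _ , inj₂ (_ , refl)) = side-vert j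

  liftCycle : ∀ {H : Adj n} → H ⊑ A → Cycle H → Cycle A
  liftCycle H⊑A C = record { len = len ; len≥3 = len≥3 ; vert = vert ; inj = inj ; closed = λ i j s → H⊑A (closed i j s) }
    where open Cycle C

  -- If neither half were bipartite, each would contain a cycle, and by uniqueness both would have
  -- the edges of `C`. But no cycle uses uv, so `C` stays on one side.
  one-half-bipartite : (Σ (Cycle A) λ C → ∀ D → SameCycle D C) → Bipartite (half true) ⊎ Bipartite (half false)
  one-half-bipartite (C , same) with bipartite⊎cycle (half-simple true) | bipartite⊎cycle (half-simple false)
  ... | inj₁ b | _      = inj₁ b
  ... | inj₂ _ | inj₁ b = inj₂ b
  ... | inj₂ (x₁ , y₁ , e₁ , C₁ , ce₁) | inj₂ (x₂ , y₂ , e₂ , C₂ , ce₂) =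
    ⊥-elim (true≢false (trans (sym (proj₂ (half-elim {true} {x₁} {y₁} e₁)))
      (trans (trans (side-cycleEdge C on₁) (sym (side-cycleEdge C on₂))) (proj₂ (half-elim {false} {x₂} {y₂} e₂)))))
    where
    true≢false : true ≢ false
    true≢false ()
    on₁ : CycleEdge C x₁ y₁
    on₁ = Equivalence.to (same (liftCycle (λ {x} {y} → half⊑A true {x} {y}) C₁) x₁ y₁) ce₁
    on₂ : CycleEdge C x₂ y₂
    on₂ = Equivalence.to (same (liftCycle (λ {x} {y} → half⊑A false {x} {y}) C₂) x₂ y₂) ce₂

  bipartite-half : Bipartite A → ∀ t → Bipartite (half t)
  bipartite-half (c , proper) t = c , λ x y e → proper x y (half⊑A t {x} {y} e)

  bipartite-glue : ((c₁ , _) : Bipartite (half true)) ((c₂ , _) : Bipartite (half false)) → c₁ u ≢ c₂ v → Bipartite A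
  bipartite-glue (c₁ , proper₁) (c₂ , proper₂) ne = c , proper
    where
    c : Fin n → Bool
    c x = if side x then c₁ x else c₂ x
    c-u : c u ≡ c₁ u
    c-u = cong (λ s → if s then c₁ u else c₂ u) side-u
    c-v : c v ≡ c₂ v
    c-v = cong (λ s → if s then c₁ v else c₂ v) side-v
    proper : ∀ x y → A x y ≡ true → c x ≢ c y
    proper x y e with deleteEdge-cases A u v e
    ... | inj₂ (inj₁ (refl , refl)) = λ eq → ne (trans (sym c-u) (trans eq c-v))
    ... | inj₂ (inj₂ (refl , refl)) = λ eq → ne (trans (sym c-u) (trans (sym eq) c-v))
    ... | inj₁ b with side x in sx | side y in sy
    ...   | true  | true  = proper₁ x y (half-intro b sx)
    ...   | false | false = proper₂ x y (half-intro b sx)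
    ...   | true  | false = ⊥-elim (Boolₚ.not-¬ sx (trans (side-edge b) sy))
    ...   | false | true  = ⊥-elim (Boolₚ.not-¬ sy (trans (sym (side-edge b)) sx))

  -- If the two colourings agree at the ends of the bridge, one of them is complemented.
  bipartite-halves : Bipartite (half true) → Bipartite (half false) → Bipartite A
  bipartite-halves b₁@(c₁ , _) b₂@(c₂ , proper₂) with c₁ u Bool.≟ c₂ v
  ... | no ne = bipartite-glue b₁ b₂ ne
  ... | yes e = bipartite-glue b₁ (not ∘ c₂ , λ x y h → proper₂ x y h ∘ Boolₚ.not-injective) (Boolₚ.not-¬ e)

-- The determinant identity

count-mono : ∀ {n} {f g : Fin n → Bool} → (∀ i → f i ≡ true → g i ≡ true) → count f ℕ.≤ count g
count-mono {zero}          h = z≤n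
count-mono {suc n} {f} {g} h with f zero in f₀ | g zero in g₀
... | true  | true  = s≤s (count-mono (h ∘ suc))
... | false | true  = ℕₚ.m≤n⇒m≤1+n (count-mono (h ∘ suc))
... | false | false = count-mono (h ∘ suc)
... | true  | false = ⊥-elim (Boolₚ.not-¬ (h zero f₀) g₀)

count-strict : ∀ {n} {f g : Fin n → Bool} → (∀ i → f i ≡ true → g i ≡ true) →
  ∀ v → f v ≡ false → g v ≡ true → count f ℕ.< count g
count-strict         h zero    fv gv rewrite fv | gv = s≤s (count-mono (h ∘ suc))
count-strict {f = f} {g} h (suc v) fv gv with f zero in f₀ | g zero in g₀
... | true  | true  = s≤s (count-strict (h ∘ suc) v fv gv)
... | false | true  = ℕₚ.m≤n⇒m≤1+n (count-strict (h ∘ suc) v fv gv)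
... | false | false = count-strict (h ∘ suc) v fv gv
... | true  | false = ⊥-elim (Boolₚ.not-¬ (h zero f₀) g₀)

δ-same : ∀ {n} (i : Fin n) → δ i i ≡ 1ℤ
δ-same i = cong (λ b → if b then 1ℤ else 0ℤ) (==-refl i)

δ-different : ∀ {n} {i j : Fin n} → i ≢ j → δ i j ≡ 0ℤ
δ-different i≢j = cong (λ b → if b then 1ℤ else 0ℤ) (==-≢ i≢j)

setRows-elim : ∀ {n} {V : Set} (R : Fin n → V → V → Set) {M M′ : Fin n → V} {u v p q p′ q′} →
  R u p p′ → R v q q′ → (∀ i → i ≢ u → i ≢ v → R i (M i) (M′ i)) →
  ∀ i → R i (setRows M u p v q i) (setRows M′ u p′ v q′ i)
setRows-elim R {u = u} {v} ru rv ro i with i ≟ u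
... | yes refl = ru
... | no i≢u with i ≟ v
...   | yes refl = rv
...   | no i≢v = ro i i≢u i≢v

module _ {n} (u v : Fin n) (u≢v : u ≢ v) where

  column : ∀ {R : Fin n → Set} → R u → R v → (∀ j → j ≢ u → j ≢ v → R j) → ∀ j → R j
  column ru rv ro j with j ≟ u
  ... | yes refl = ru
  ... | no j≢u with j ≟ v
  ...   | yes refl = rv
  ...   | no j≢v = ro j j≢u j≢v

  -- The entry at v is added to the one at u and then cleared: the effect on the other rows of the
  -- matrix when v is merged into u.
  moveTo : (Fin n → ℤ) → Fin n → ℤ
  moveTo r j = r j + r v * (δ u j + - δ v j)

  move-fixed : ∀ r j → r v ≡ 0ℤ → moveTo r j ≡ r j
  move-fixed r j e = trans (cong (λ t → r j + t * (δ u j + - δ v j)) e)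
    (trans (cong (λ t → r j + t) (ℤₚ.*-zeroˡ (δ u j + - δ v j))) (ℤₚ.+-identityʳ (r j)))

  move-u : ∀ r → moveTo r u ≡ r u + r v
  move-u r = trans (cong₂ (λ s t → r u + r v * (s + - t)) (δ-same u) (δ-different (u≢v ∘ sym)))
    (cong (λ t → r u + t) (ℤₚ.*-identityʳ (r v)))

  move-v : ∀ r → moveTo r v ≡ 0ℤ
  move-v r = trans (cong₂ (λ s t → r v + r v * (s + - t)) (δ-different u≢v) (δ-same v)) (cancel (r v))
    where
    cancel : ∀ a → a + a * (0ℤ + - 1ℤ) ≡ 0ℤ
    cancel = solve-∀

  move-other : ∀ r {j} → j ≢ u → j ≢ v → moveTo r j ≡ r j
  move-other r {j} j≢u j≢v = trans (cong₂ (λ s t → r j + r v * (s + - t)) (δ-different (j≢u ∘ sym)) (δ-different (j≢v ∘ sym)))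
    (trans (cong (λ t → r j + t) (ℤₚ.*-zeroʳ (r v))) (ℤₚ.+-identityʳ (r j)))

  clear : (Fin n → ℤ) → Fin n → ℤ
  clear r j = if (j == u) ∨ (j == v) then 0ℤ else r j

  clear-u : ∀ r → clear r u ≡ 0ℤ
  clear-u r rewrite ==-refl u = refl

  clear-v : ∀ r → clear r v ≡ 0ℤ
  clear-v r rewrite ==-refl v | ==-≢ (u≢v ∘ sym) = refl

  clear-other : ∀ r {j} → j ≢ u → j ≢ v → clear r j ≡ r j
  clear-other r j≢u j≢v rewrite ==-≢ j≢u | ==-≢ j≢v = refl

  swapped : (Fin n → ℤ) → Fin n → ℤ
  swapped r j = if j == u then r v else (if j == v then r u else r j)

  swapped-u : ∀ r → swapped r u ≡ r v
  swapped-u r rewrite ==-refl u = refl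

  swapped-v : ∀ r → swapped r v ≡ r u
  swapped-v r rewrite ==-refl v | ==-≢ (u≢v ∘ sym) = refl

  swapped-other : ∀ r {j} → j ≢ u → j ≢ v → swapped r j ≡ r j
  swapped-other r j≢u j≢v rewrite ==-≢ j≢u | ==-≢ j≢v = refl

  -- det-joined and det-coalesced add the 2×2 block [[k,l],[l,k]] on {u,v} to N, respectively to N
  -- with row and column v moved onto row and column u; the determinants differ by det N.
  module Coalescence (s : Fin n → Bool) (s-u : s u ≡ true) (s-v : s v ≡ false)
    (N : Mat n) (N-block : ∀ i j → s i ≢ s j → N i j ≡ 0ℤ) where

    -- Moving column v destroys the block-diagonal form: `N~` is only block triangular. `X₁` and
    -- `X₂` interpolate between the moved matrices and `N`, so that each comparison changes only
    -- entries which some zero block makes irrelevant.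
    N~ X₁ X₂ Y : Mat n
    N~ i = moveTo (N i)
    X₁ i = if s i then N i else clear (N i)
    X₂ i = if s i then clear (N i) else N i
    Y  i = swapped (N~ i)

    module ⟪N⟫ = Bracket N u≢v
    module ⟪~⟫ = Bracket N~ u≢v
    module ⟪Y⟫ = Bracket Y u≢v
    open ⟪N⟫ using (⟨_,_⟩)
    open ⟪~⟫ using () renaming (⟨_,_⟩ to ⟨_,_⟩~)
    module AltN = ⟪N⟫.Antisym (det-alt u v u≢v)
    module Alt~ = ⟪~⟫.Antisym (det-alt u v u≢v)
    module AltY = ⟪Y⟫.Antisym (det-alt u v u≢v)

    across : ∀ {i j a b} → s i ≡ a → s j ≡ b → a ≢ b → N i j ≡ 0ℤ
    across refl refl = N-block _ _

    true≢false : true ≢ false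
    true≢false ()

    false≢true : false ≢ true
    false≢true ()

    s-≢ : ∀ {i j a b} → s i ≡ a → s j ≡ b → a ≢ b → i ≢ j
    s-≢ refl refl ne refl = ne refl

    -- Row v, now a unit row at u, joins the rows of the side of u: one row more than there are
    -- columns to support them.
    ⟨Nu,Eu⟩ : ⟨ N u , δ u ⟩ ≡ 0ℤ
    ⟨Nu,Eu⟩ = det-zeroBlock r s zero-block (count-strict (λ i e → cong (_∨ (i == v)) e) v s-v (∨-trueʳ (s v) (==-refl v)))
      where
      r : Fin n → Bool
      r i = s i ∨ (i == v)
      zero-block : ZeroBlock r s (setRows N u (N u) v (δ u))
      zero-block i j ri sj = setRows-elim (λ i row _ → r i ≡ true → row j ≡ 0ℤ) {M′ = N} {p′ = N u} {q′ = N u}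
        (λ _ → across s-u sj true≢false)
        (λ _ → δ-different (s-≢ s-u sj true≢false))
        (λ i _ i≢v ri → across (trans (sym (Boolₚ.∨-identityʳ (s i))) (trans (cong (s i ∨_) (sym (==-≢ i≢v))) ri)) sj true≢false)
        i ri

    ⟨Ev,Nv⟩ : ⟨ δ v , N v ⟩ ≡ 0ℤ
    ⟨Ev,Nv⟩ = det-zeroBlock r (not ∘ s) zero-block
        (count-strict (λ i e → cong (_∨ (i == u)) e) u (cong not s-u) (∨-trueʳ (not (s u)) (==-refl u)))
      where
      r : Fin n → Bool
      r i = not (s i) ∨ (i == u)
      zero-block : ZeroBlock r (not ∘ s) (setRows N u (δ v) v (N v))
      zero-block i j ri nsj = setRows-elim (λ i row _ → r i ≡ true → row j ≡ 0ℤ) {M′ = N} {p′ = N u} {q′ = N u}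
        (λ _ → δ-different (s-≢ s-v sj false≢true))
        (λ _ → across s-v sj false≢true)
        (λ i i≢u _ ri → across (Boolₚ.not-injective (trans (sym (Boolₚ.∨-identityʳ (not (s i)))) (trans (cong (not (s i) ∨_) (sym (==-≢ i≢u))) ri))) sj false≢true)
        i ri
        where
        sj : s j ≡ true
        sj = Boolₚ.not-injective nsj

    -- Column v is entirely zero.
    ⟨p,Eu⟩~ : ∀ p → p v ≡ 0ℤ → ⟨ p , δ u ⟩~ ≡ 0ℤ
    ⟨p,Eu⟩~ p pv = det-zeroBlock (λ _ → true) (λ j → not (j == v)) zero-block
        (count-strict (λ _ _ → refl) v (cong not (==-refl v)) refl)
      where
      zero-block : ZeroBlock (λ _ → true) (λ j → not (j == v)) (setRows N~ u p v (δ u))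
      zero-block i j _ cj rewrite ==⇒≡ {x = j} {v} (Boolₚ.not-injective cj) =
        setRows-elim (λ _ row _ → row v ≡ 0ℤ) {M′ = N} {p′ = N u} {q′ = N u} pv (δ-different u≢v) (λ i _ _ → move-v (N i)) i

    -- With unit rows at u and v, the entries of the other rows in columns u and v do not count, and
    -- elsewhere `N~` and `N` coincide.
    ⟨Eu,Ev⟩~ : ⟨ δ u , δ v ⟩~ ≡ ⟨ δ u , δ v ⟩
    ⟨Eu,Ev⟩~ = det-zeroBlock-cong r r (λ i j ri rj → zero-block i j ri rj) (λ i j ri rj → zero-block i j ri rj) agree ℕₚ.≤-refl
      where
      r : Fin n → Bool
      r i = (i == u) ∨ (i == v)
      r-≢u : ∀ {j} → r j ≡ false → u ≢ j
      r-≢u e refl with () ← trans (sym e) (cong (_∨ (u == v)) (==-refl u))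
      r-≢v : ∀ {j} → r j ≡ false → v ≢ j
      r-≢v e refl with () ← trans (sym e) (∨-trueʳ (v == u) (==-refl v))
      r-other : ∀ {i} → i ≢ u → i ≢ v → r i ≡ false
      r-other i≢u i≢v = cong₂ _∨_ (==-≢ i≢u) (==-≢ i≢v)
      zero-block : ∀ {M} → ZeroBlock r r (setRows M u (δ u) v (δ v))
      zero-block {M} i j ri rj = setRows-elim (λ i row _ → r i ≡ true → row j ≡ 0ℤ) {M′ = N} {p′ = N u} {q′ = N u}
        (λ _ → δ-different (r-≢u rj)) (λ _ → δ-different (r-≢v rj))
        (λ i i≢u i≢v ri → ⊥-elim (Boolₚ.not-¬ ri (r-other i≢u i≢v))) i ri
      agree : ∀ i j → r i ≡ r j → setRows N~ u (δ u) v (δ v) i j ≡ setRows N u (δ u) v (δ v) i j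
      agree i j e = setRows-elim (λ i row row′ → r i ≡ r j → row j ≡ row′ j) {N~} {N} {u} {v} {δ u} {δ v} {δ u} {δ v} (λ _ → refl) (λ _ → refl)
        (λ i i≢u i≢v e → let rj = trans (sym e) (r-other i≢u i≢v) in
          move-other (N i) (r-≢u rj ∘ sym) (r-≢v rj ∘ sym)) i e

    Nu-v : N u v ≡ 0ℤ
    Nu-v = across s-u s-v true≢false

    Nv-u : N v u ≡ 0ℤ
    Nv-u = across s-v s-u false≢true

    X₁-true : ∀ {i} → s i ≡ true → ∀ j → X₁ i j ≡ N i j
    X₁-true {i} e j = cong (λ b → (if b then N i else clear (N i)) j) e

    X₁-false : ∀ {i} → s i ≡ false → ∀ j → X₁ i j ≡ clear (N i) j
    X₁-false {i} e j = cong (λ b → (if b then N i else clear (N i)) j) e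

    X₂-true : ∀ {i} → s i ≡ true → ∀ j → X₂ i j ≡ clear (N i) j
    X₂-true {i} e j = cong (λ b → (if b then clear (N i) else N i) j) e

    X₂-false : ∀ {i} → s i ≡ false → ∀ j → X₂ i j ≡ N i j
    X₂-false {i} e j = cong (λ b → (if b then clear (N i) else N i) j) e

    -- In the passage to `X₁`, the entries moved across into column u lie in the irrelevant corner
    -- of a block-triangular matrix. From `X₁` to `N` only column v changes, and the unit row at v
    -- makes its other entries irrelevant.
    ⟨Nu,Ev⟩~ : ⟨ N u , δ v ⟩~ ≡ ⟨ N u , δ v ⟩
    ⟨Nu,Ev⟩~ = trans
        (det-zeroBlock-cong s s
          (zero-block λ i j si sj → trans (move-fixed (N i) j (across si s-v true≢false)) (across si sj true≢false))
          (zero-block λ i j si sj → trans (X₁-true si j) (across si sj true≢false))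
          (λ i j → setRows-elim (λ i row row′ → s i ≡ s j → row j ≡ row′ j) {N~} {X₁} {u} {v} {N u} {δ v} {N u} {δ v} (λ _ → refl) (λ _ → refl) (λ i _ _ → agree₁ i j) i)
          ℕₚ.≤-refl)
        (det-zeroBlock-cong (_== v) (_== v) single-block single-block
          (λ i j → setRows-elim (λ i row row′ → (i == v) ≡ (j == v) → row j ≡ row′ j) {X₁} {N} {u} {v} {N u} {δ v} {N u} {δ v} (λ _ → refl) (λ _ → refl)
            (λ i _ i≢v e → agree₂ i j (λ { refl → Boolₚ.not-¬ (trans e (==-refl v)) (==-≢ i≢v) })) i)
          ℕₚ.≤-refl)
      where
      zero-block : ∀ {M : Mat n} → (∀ i j → s i ≡ true → s j ≡ false → M i j ≡ 0ℤ) →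
        ZeroBlock s s (setRows M u (N u) v (δ v))
      zero-block h i j si sj = setRows-elim (λ i row _ → s i ≡ true → row j ≡ 0ℤ) {M′ = N} {p′ = N u} {q′ = N u}
        (λ _ → across s-u sj true≢false) (λ sv → ⊥-elim (Boolₚ.not-¬ sv s-v)) (λ i _ _ si → h i j si sj) i si
      single-block : ∀ {M : Mat n} → ZeroBlock (_== v) (_== v) (setRows M u (N u) v (δ v))
      single-block i j iv jv rewrite ==⇒≡ {x = i} {v} iv = trans (cong-app (Bracket.atʳ _ u≢v (N u) (δ v)) j)
        (δ-different λ { refl → Boolₚ.not-¬ (==-refl v) jv })
      agree₁ : ∀ i j → s i ≡ s j → N~ i j ≡ X₁ i j
      agree₁ i j e = cases (s i) refl
        where
        cases : ∀ b → s i ≡ b → N~ i j ≡ X₁ i j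
        cases true  si = trans (move-fixed (N i) j (across si s-v true≢false)) (sym (X₁-true si j))
        cases false si = trans (column {R = λ j → s j ≡ false → N~ i j ≡ clear (N i) j}
          (λ su → ⊥-elim (Boolₚ.not-¬ s-u su))
          (λ _ → trans (move-v (N i)) (sym (clear-v (N i))))
          (λ j j≢u j≢v _ → trans (move-other (N i) j≢u j≢v) (sym (clear-other (N i) j≢u j≢v))) j (trans (sym e) si))
          (sym (X₁-false si j))
      agree₂ : ∀ i j → j ≢ v → X₁ i j ≡ N i j
      agree₂ i j j≢v = cases (s i) refl
        where
        cases : ∀ b → s i ≡ b → X₁ i j ≡ N i j
        cases true  si = X₁-true si j
        cases false si = trans (X₁-false si j) (column {R = λ j → j ≢ v → clear (N i) j ≡ N i j}
          (λ _ → trans (clear-u (N i)) (sym (across si s-u false≢true)))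
          (λ v≢v → ⊥-elim (v≢v refl))
          (λ j j≢u j≢v _ → clear-other (N i) j≢u j≢v) j j≢v)

    -- Here the row of v sits in position u and its diagonal entry in column u. Exchanging columns u
    -- and v, then the two rows, puts both back in place, and the two signs cancel.
    ⟨Nv,Ev⟩~-Y : ⟨ N~ v , δ v ⟩~ ≡ ⟪Y⟫.⟨ δ u , N v ⟩
    ⟨Nv,Ev⟩~-Y = begin
      ⟨ N~ v , δ v ⟩~           ≡⟨ sym (ℤₚ.neg-involutive _) ⟩
      - - ⟨ N~ v , δ v ⟩~       ≡⟨ cong -_ (sym columns) ⟩
      - ⟪Y⟫.⟨ N v , δ u ⟩       ≡⟨ cong -_ (AltY.swap (N v) (δ u)) ⟩
      - - ⟪Y⟫.⟨ δ u , N v ⟩     ≡⟨ ℤₚ.neg-involutive _ ⟩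
      ⟪Y⟫.⟨ δ u , N v ⟩ ∎
      where
      open ≡-Reasoning
      columns : ⟪Y⟫.⟨ N v , δ u ⟩ ≡ - ⟨ N~ v , δ v ⟩~
      columns = det-columnSwap (setRows N~ u (N~ v) v (δ v)) (setRows Y u (N v) v (δ u)) u≢v
        (setRows-elim (λ _ row row′ → row u ≡ row′ v) {Y} {N~} {u} {v} {N v} {δ u} {N~ v} {δ v}
          (trans Nv-u (sym (move-v (N v)))) (trans (δ-same u) (sym (δ-same v))) (λ i _ _ → swapped-u (N~ i)))
        (setRows-elim (λ _ row row′ → row v ≡ row′ u) {Y} {N~} {u} {v} {N v} {δ u} {N~ v} {δ v}
          (sym (trans (move-u (N v)) (trans (cong (_+ N v v) Nv-u) (ℤₚ.+-identityˡ (N v v)))))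
          (trans (δ-different u≢v) (sym (δ-different (u≢v ∘ sym)))) (λ i _ _ → swapped-v (N~ i)))
        (λ l l≢u l≢v → setRows-elim (λ _ row row′ → row l ≡ row′ l) {Y} {N~} {u} {v} {N v} {δ u} {N~ v} {δ v}
          (sym (move-other (N v) l≢u l≢v))
          (trans (δ-different (l≢u ∘ sym)) (sym (δ-different (l≢v ∘ sym)))) (λ i _ _ → swapped-other (N~ i) l≢u l≢v))

    -- The mirror image of `⟨Nu,Ev⟩~`: after the column exchange the moved entries belong to the
    -- side of v, and `X₂` is the intermediate matrix.
    ⟨Eu,Nv⟩-Y : ⟪Y⟫.⟨ δ u , N v ⟩ ≡ ⟨ δ u , N v ⟩
    ⟨Eu,Nv⟩-Y = trans
        (det-zeroBlock-cong (not ∘ s) (not ∘ s)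
          (zero-block Y-across)
          (zero-block λ i j si sj → trans (X₂-false si j) (across si sj false≢true))
          (λ i j → setRows-elim (λ i row row′ → not (s i) ≡ not (s j) → row j ≡ row′ j) {Y} {X₂} {u} {v} {δ u} {N v} {δ u} {N v} (λ _ → refl) (λ _ → refl)
            (λ i _ _ e → agree₁ i j (Boolₚ.not-injective e)) i)
          ℕₚ.≤-refl)
        (det-zeroBlock-cong (_== u) (_== u) single-block single-block
          (λ i j → setRows-elim (λ i row row′ → (i == u) ≡ (j == u) → row j ≡ row′ j) {X₂} {N} {u} {v} {δ u} {N v} {δ u} {N v} (λ _ → refl) (λ _ → refl)
            (λ i i≢u _ e → agree₂ i j (λ { refl → Boolₚ.not-¬ (trans e (==-refl u)) (==-≢ i≢u) })) i)
          ℕₚ.≤-refl)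
      where
      zero-block : ∀ {M : Mat n} → (∀ i j → s i ≡ false → s j ≡ true → M i j ≡ 0ℤ) →
        ZeroBlock (not ∘ s) (not ∘ s) (setRows M u (δ u) v (N v))
      zero-block h i j nsi nsj = setRows-elim (λ i row _ → not (s i) ≡ true → row j ≡ 0ℤ) {M′ = N} {p′ = N u} {q′ = N u}
        (λ nsu → ⊥-elim (Boolₚ.not-¬ s-u (Boolₚ.not-injective nsu))) (λ _ → across s-v sj false≢true)
        (λ i _ _ nsi → h i j (Boolₚ.not-injective nsi) sj) i nsi
        where
        sj : s j ≡ true
        sj = Boolₚ.not-injective nsj
      single-block : ∀ {M : Mat n} → ZeroBlock (_== u) (_== u) (setRows M u (δ u) v (N v))
      single-block i j iu ju rewrite ==⇒≡ {x = i} {u} iu = trans (cong-app (Bracket.atˡ _ u≢v (δ u) (N v)) j)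
        (δ-different λ { refl → Boolₚ.not-¬ (==-refl u) ju })
      Y-u : ∀ i → Y i u ≡ 0ℤ
      Y-u i = trans (swapped-u (N~ i)) (move-v (N i))
      Y-v : ∀ i → Y i v ≡ N i u + N i v
      Y-v i = trans (swapped-v (N~ i)) (move-u (N i))
      Y-other : ∀ i {j} → j ≢ u → j ≢ v → Y i j ≡ N i j
      Y-other i j≢u j≢v = trans (swapped-other (N~ i) j≢u j≢v) (move-other (N i) j≢u j≢v)
      Y-across : ∀ i j → s i ≡ false → s j ≡ true → Y i j ≡ 0ℤ
      Y-across i j si = column {R = λ j → s j ≡ true → Y i j ≡ 0ℤ}
        (λ _ → Y-u i) (λ sv → ⊥-elim (Boolₚ.not-¬ sv s-v))
        (λ j j≢u j≢v sj → trans (Y-other i j≢u j≢v) (across si sj false≢true)) j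
      agree₁ : ∀ i j → s i ≡ s j → Y i j ≡ X₂ i j
      agree₁ i j e = cases (s i) refl
        where
        cases : ∀ b → s i ≡ b → Y i j ≡ X₂ i j
        cases true  si = trans (column {R = λ j → s j ≡ true → Y i j ≡ clear (N i) j}
          (λ _ → trans (Y-u i) (sym (clear-u (N i))))
          (λ sv → ⊥-elim (Boolₚ.not-¬ sv s-v))
          (λ j j≢u j≢v _ → trans (Y-other i j≢u j≢v) (sym (clear-other (N i) j≢u j≢v))) j (trans (sym e) si))
          (sym (X₂-true si j))
        cases false si = trans (column {R = λ j → s j ≡ false → Y i j ≡ N i j}
          (λ su → ⊥-elim (Boolₚ.not-¬ s-u su))
          (λ _ → trans (Y-v i) (trans (cong (_+ N i v) (across si s-u false≢true)) (ℤₚ.+-identityˡ (N i v))))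
          (λ j j≢u j≢v _ → Y-other i j≢u j≢v) j (trans (sym e) si))
          (sym (X₂-false si j))
      agree₂ : ∀ i j → j ≢ u → X₂ i j ≡ N i j
      agree₂ i j j≢u = cases (s i) refl
        where
        cases : ∀ b → s i ≡ b → X₂ i j ≡ N i j
        cases false si = X₂-false si j
        cases true  si = trans (X₂-true si j) (column {R = λ j → j ≢ u → clear (N i) j ≡ N i j}
          (λ u≢u → ⊥-elim (u≢u refl))
          (λ _ → trans (clear-v (N i)) (sym (across si s-v true≢false)))
          (λ j j≢u j≢v _ → clear-other (N i) j≢u j≢v) j j≢u)

    ⟨Nv,Ev⟩~ : ⟨ N~ v , δ v ⟩~ ≡ ⟨ δ u , N v ⟩
    ⟨Nv,Ev⟩~ = trans ⟨Nv,Ev⟩~-Y ⟨Eu,Nv⟩-Y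

    module Expand (M : Mat n) where
      open Bracket M u≢v renaming (⟨_,_⟩ to ⟦_,_⟧)

      expandʳ : ∀ p q a b (c d : Fin n → ℤ) → ⟦ p , (λ j → q j + (a * c j + b * d j)) ⟧ ≡ ⟦ p , q ⟧ + (a * ⟦ p , c ⟧ + b * ⟦ p , d ⟧)
      expandʳ p q a b c d = trans (addʳ p q _) (cong (λ t → ⟦ p , q ⟧ + t)
        (trans (addʳ p _ _) (cong₂ _+_ (scaleʳ a p c) (scaleʳ b p d))))

      expandˡ : ∀ p a b (c d : Fin n → ℤ) q → ⟦ (λ j → p j + (a * c j + b * d j)) , q ⟧ ≡ ⟦ p , q ⟧ + (a * ⟦ c , q ⟧ + b * ⟦ d , q ⟧)
      expandˡ p a b c d q = trans (addˡ p _ q) (cong (λ t → ⟦ p , q ⟧ + t)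
        (trans (addˡ _ _ q) (cong₂ _+_ (scaleˡ a c q) (scaleˡ b d q))))

    module _ (k l : ℤ) where

      -- The contribution of the 2×2 block: k when one row comes from the block, and its determinant
      -- k² - l² when both do.
      value : ℤ
      value = k * (⟨ N u , δ v ⟩ + ⟨ δ u , N v ⟩) + (k * k + - (l * l)) * ⟨ δ u , δ v ⟩

      det-joined : ∀ (P : Mat n) → (∀ i → i ≢ u → i ≢ v → ∀ j → P i j ≡ N i j) →
        (∀ j → P u j ≡ N u j + (k * δ u j + l * δ v j)) → (∀ j → P v j ≡ N v j + (l * δ u j + k * δ v j)) →
        detℤ n P ≡ value + detℤ n N
      det-joined P Po Pu Pv = begin
        detℤ n P
          ≡⟨ ⟪N⟫.det≡⟨⟩ P Po ⟩
        ⟨ P u , P v ⟩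
          ≡⟨ ⟪N⟫.⟨⟩-cong Pu Pv ⟩
        ⟨ (λ j → N u j + (k * δ u j + l * δ v j)) , q ⟩
          ≡⟨ expandˡ (N u) k l (δ u) (δ v) q ⟩
        ⟨ N u , q ⟩ + (k * ⟨ δ u , q ⟩ + l * ⟨ δ v , q ⟩)
          ≡⟨ cong₂ _+_ (expand (N u)) (cong₂ (λ a b → k * a + l * b) (expand (δ u)) (expand (δ v))) ⟩
        ⟨ N u , N v ⟩ + (l * ⟨ N u , δ u ⟩ + k * ⟨ N u , δ v ⟩)
          + (k * (⟨ δ u , N v ⟩ + (l * ⟨ δ u , δ u ⟩ + k * ⟨ δ u , δ v ⟩))
             + l * (⟨ δ v , N v ⟩ + (l * ⟨ δ v , δ u ⟩ + k * ⟨ δ v , δ v ⟩)))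
          ≡⟨ simplify ⟨ N u , δ v ⟩ ⟨ δ u , N v ⟩ ⟨ δ u , δ v ⟩ (sym (⟪N⟫.det≡⟨⟩ N (λ _ _ _ _ → refl)))
               ⟨Nu,Eu⟩ (AltN.self (δ u)) ⟨Ev,Nv⟩ (AltN.swap (δ v) (δ u)) (AltN.self (δ v)) ⟩
        value + detℤ n N ∎
        where
        open ≡-Reasoning
        open Expand N
        q : Fin n → ℤ
        q j = N v j + (l * δ u j + k * δ v j)
        expand : ∀ p → ⟨ p , q ⟩ ≡ ⟨ p , N v ⟩ + (l * ⟨ p , δ u ⟩ + k * ⟨ p , δ v ⟩)
        expand p = expandʳ p (N v) l k (δ u) (δ v)
        ring : ∀ k l d b c e → d + (l * 0ℤ + k * b) + (k * (c + (l * 0ℤ + k * e)) + l * (0ℤ + (l * (- e) + k * 0ℤ)))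
          ≡ k * (b + c) + (k * k + - (l * l)) * e + d
        ring = solve-∀
        -- The brackets become variables here, so that matching their known values on `refl` leaves
        -- a plain ring identity.
        simplify : ∀ b c e {d d′ a f g h o} → d ≡ d′ → a ≡ 0ℤ → f ≡ 0ℤ → g ≡ 0ℤ → h ≡ - e → o ≡ 0ℤ →
          d + (l * a + k * b) + (k * (c + (l * f + k * e)) + l * (g + (l * h + k * o)))
          ≡ k * (b + c) + (k * k + - (l * l)) * e + d′
        simplify b c e {d} refl refl refl refl refl refl = ring k l d b c e

      det-coalesced : ∀ (P : Mat n) → (∀ i → i ≢ u → i ≢ v → ∀ j → P i j ≡ N~ i j) →
        (∀ j → P u j ≡ (N u j + N~ v j) + (k * δ u j + l * δ v j)) → (∀ j → P v j ≡ l * δ u j + k * δ v j) →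
        detℤ n P ≡ value
      det-coalesced P Po Pu Pv = begin
        detℤ n P
          ≡⟨ ⟪~⟫.det≡⟨⟩ P Po ⟩
        ⟨ P u , P v ⟩~
          ≡⟨ ⟪~⟫.⟨⟩-cong Pu Pv ⟩
        ⟨ (λ j → p j + (k * δ u j + l * δ v j)) , q ⟩~
          ≡⟨ expandˡ p k l (δ u) (δ v) q ⟩
        ⟨ p , q ⟩~ + (k * ⟨ δ u , q ⟩~ + l * ⟨ δ v , q ⟩~)
          ≡⟨ cong₂ _+_ (expand p) (cong₂ (λ a b → k * a + l * b) (expand (δ u)) (expand (δ v))) ⟩
        (l * ⟨ p , δ u ⟩~ + k * ⟨ p , δ v ⟩~)
          + (k * (l * ⟨ δ u , δ u ⟩~ + k * ⟨ δ u , δ v ⟩~) + l * (l * ⟨ δ v , δ u ⟩~ + k * ⟨ δ v , δ v ⟩~))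
          ≡⟨ simplify (⟨ N u , δ v ⟩ + ⟨ δ u , N v ⟩) ⟨ δ u , δ v ⟩
               (⟨p,Eu⟩~ p (trans (cong₂ _+_ Nu-v (move-v (N v))) refl))
               (trans (⟪~⟫.addˡ (N u) (N~ v) (δ v)) (cong₂ _+_ ⟨Nu,Ev⟩~ ⟨Nv,Ev⟩~))
               (Alt~.self (δ u)) ⟨Eu,Ev⟩~ (trans (Alt~.swap (δ v) (δ u)) (cong -_ ⟨Eu,Ev⟩~)) (Alt~.self (δ v)) ⟩
        value ∎
        where
        open ≡-Reasoning
        open Expand N~
        p q : Fin n → ℤ
        p j = N u j + N~ v j
        q j = l * δ u j + k * δ v j
        expand : ∀ p → ⟨ p , q ⟩~ ≡ l * ⟨ p , δ u ⟩~ + k * ⟨ p , δ v ⟩~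
        expand p = trans (⟪~⟫.addʳ p _ _) (cong₂ _+_ (⟪~⟫.scaleʳ l p (δ u)) (⟪~⟫.scaleʳ k p (δ v)))
        ring : ∀ k l b e → (l * 0ℤ + k * b) + (k * (l * 0ℤ + k * e) + l * (l * (- e) + k * 0ℤ)) ≡ k * b + (k * k + - (l * l)) * e
        ring = solve-∀
        simplify : ∀ b e {a b′ f e′ h o} → a ≡ 0ℤ → b′ ≡ b → f ≡ 0ℤ → e′ ≡ e → h ≡ - e → o ≡ 0ℤ →
          (l * a + k * b′) + (k * (l * f + k * e′) + l * (l * h + k * o)) ≡ k * b + (k * k + - (l * l)) * e
        simplify b e refl refl refl refl refl refl = ring k l b e

-- Signs of the principal minors

∑-nonNegative : ∀ {n} {f : Fin n → ℤ} → (∀ i → 0ℤ ℤ.≤ f i) → 0ℤ ℤ.≤ ∑ f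
∑-nonNegative {zero}  h = ℤₚ.≤-reflexive (sym ∑-empty)
∑-nonNegative {suc n} h = subst (0ℤ ℤ.≤_) (sym ∑-suc) (ℤₚ.+-mono-≤ (h zero) (∑-nonNegative (h ∘ suc)))

∑-positive : ∀ {n} {f : Fin n → ℤ} → (∀ i → 0ℤ ℤ.≤ f i) → ∀ p → 0ℤ < f p → 0ℤ < ∑ f
∑-positive h zero    q = subst (0ℤ <_) (sym ∑-suc) (ℤₚ.+-mono-<-≤ q (∑-nonNegative (h ∘ suc)))
∑-positive h (suc p) q = subst (0ℤ <_) (sym ∑-suc) (ℤₚ.+-mono-≤-< (h zero) (∑-positive (h ∘ suc) p q))

∑-positive⁻¹ : ∀ {n} (f : Fin n → ℤ) → 0ℤ < ∑ f → ∃ λ i → 0ℤ < f i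
∑-positive⁻¹ {zero}  f q = ⊥-elim (ℤₚ.<-irrefl (sym ∑-empty) q)
∑-positive⁻¹ {suc n} f q with 0ℤ ℤ.<? f zero
... | yes p = zero , p
... | no ¬p = let (i , p) = ∑-positive⁻¹ (f ∘ suc) rest in suc i , p
  where
  rest : 0ℤ < ∑ (f ∘ suc)
  rest = ℤₚ.<-≤-trans (subst (0ℤ <_) ∑-suc q)
    (subst (λ t → f zero + ∑ (f ∘ suc) ℤ.≤ t) (ℤₚ.+-identityˡ (∑ (f ∘ suc))) (ℤₚ.+-monoˡ-≤ (∑ (f ∘ suc)) (ℤₚ.≮⇒≥ ¬p)))

square-positive : ∀ {x} → x ≢ 0ℤ → 0ℤ < x * x
square-positive {+ zero}       x≢0 = ⊥-elim (x≢0 refl)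
square-positive {ℤ.+[1+ m ]}   x≢0 = +<+ (s≤s z≤n)
square-positive {ℤ.-[1+ m ]}   x≢0 = +<+ (s≤s z≤n)

square-nonNegative : ∀ x → 0ℤ ℤ.≤ x * x
square-nonNegative x with x ℤ.≟ 0ℤ
... | yes refl = ℤₚ.≤-refl
... | no x≢0   = ℤₚ.<⇒≤ (square-positive x≢0)

∑-δ : ∀ {n} i (f : Fin n → ℤ) → ∑ (λ j → δ i j * f j) ≡ f i
∑-δ i f = trans (∑-single i λ j j≢i → trans (cong (_* f j) (δ-different (j≢i ∘ sym))) (ℤₚ.*-zeroˡ (f j)))
  (trans (cong (_* f i) (δ-same i)) (ℤₚ.*-identityˡ (f i)))

adjacency : ∀ {n} → Adj n → Mat n
adjacency H i j = if H i j then 1ℤ else 0ℤ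

degree : ∀ {n} → Adj n → Fin n → ℤ
degree H i = ∑ (adjacency H i)

deg≡degree : ∀ {n} (H : Adj n) i → + deg H i ≡ degree H i
deg≡degree H i = trans (total (λ j → if H i j then 1 else 0)) (∑-cong indicator)
  where
  total : ∀ {m} (f : Fin m → ℕ) → + sumℕ f ≡ ∑ (λ j → + f j)
  total {zero}  f = sym ∑-empty
  total {suc m} f = trans (ℤₚ.pos-+ (f zero) _) (trans (cong (λ t → + f zero + t) (total (f ∘ suc))) (sym ∑-suc))
  indicator : ∀ j → + (if H i j then 1 else 0) ≡ adjacency H i j
  indicator j with H i j
  ... | true  = refl
  ... | false = refl

Q-entry : ∀ {n} (H : Adj n) → (∀ x → H x x ≡ false) → ∀ i j → Q H i j ≡ δ i j * degree H i + adjacency H i j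
Q-entry H irr i j with i ≟ j
... | yes refl = trans (deg≡degree H i) (sym (trans (cong (λ t → 1ℤ * degree H i + (if t then 1ℤ else 0ℤ)) (irr i))
    (trans (ℤₚ.+-identityʳ _) (ℤₚ.*-identityˡ (degree H i)))))
... | no _ = sym (trans (cong (_+ adjacency H i j) (ℤₚ.*-zeroˡ (degree H i))) (ℤₚ.+-identityˡ (adjacency H i j)))

module Laplacian {n} (H : Adj n) (H-simple : IsSimple H) where

  private
    a : Mat n
    a = adjacency H

  a-sym : ∀ i j → a i j ≡ a j i
  a-sym i j = cong (λ b → if b then 1ℤ else 0ℤ) (proj₁ H-simple i j)

  Q-apply : ∀ x i → (Q H · x) i ≡ ∑ (λ j → a i j * (x i + x j))
  Q-apply x i = begin
    ∑ (λ j → Q H i j * x j)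
      ≡⟨ ∑-cong (λ j → trans (cong (_* x j) (Q-entry H (proj₂ H-simple) i j)) (split (δ i j) (degree H i) (a i j) (x j))) ⟩
    ∑ (λ j → δ i j * (degree H i * x j) + a i j * x j)
      ≡⟨ ∑-+ ⟩
    ∑ (λ j → δ i j * (degree H i * x j)) + ∑ (λ j → a i j * x j)
      ≡⟨ cong (_+ ∑ (λ j → a i j * x j)) (trans (∑-δ i (λ j → degree H i * x j)) (ℤₚ.*-comm (degree H i) (x i))) ⟩
    x i * degree H i + ∑ (λ j → a i j * x j)
      ≡⟨ cong (_+ ∑ (λ j → a i j * x j)) (sym (∑-*ˡ (x i) (a i))) ⟩
    ∑ (λ j → x i * a i j) + ∑ (λ j → a i j * x j)
      ≡⟨ sym ∑-+ ⟩
    ∑ (λ j → x i * a i j + a i j * x j)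
      ≡⟨ ∑-cong (λ j → merge (x i) (a i j) (x j)) ⟩
    ∑ (λ j → a i j * (x i + x j)) ∎
    where
    open ≡-Reasoning
    split : ∀ e d b y → (e * d + b) * y ≡ e * (d * y) + b * y
    split = solve-∀
    merge : ∀ y b z → y * b + b * z ≡ b * (y + z)
    merge = solve-∀

  energy : (Fin n → ℤ) → ℤ
  energy x = ∑ (λ i → x i * (Q H · x) i)

  -- The sum runs over ordered pairs, so each edge is counted twice. Exchanging i and j in one of
  -- the two copies of the energy completes the squares without a division.
  double-energy : ∀ x → energy x + energy x ≡ ∑ (λ i → ∑ (λ j → a i j * ((x i + x j) * (x i + x j))))
  double-energy x = begin
    energy x + energy x
      ≡⟨ cong₂ _+_ expand (trans expand ∑-comm) ⟩
    ∑ (λ i → ∑ (λ j → x i * (a i j * (x i + x j)))) + ∑ (λ i → ∑ (λ j → x j * (a j i * (x j + x i))))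
      ≡⟨ trans (sym ∑-+) (∑-cong λ i → sym ∑-+) ⟩
    ∑ (λ i → ∑ (λ j → x i * (a i j * (x i + x j)) + x j * (a j i * (x j + x i))))
      ≡⟨ ∑-cong (λ i → ∑-cong λ j → trans (cong (λ b → x i * (a i j * (x i + x j)) + x j * (b * (x j + x i))) (a-sym j i))
           (merge (x i) (a i j) (x j))) ⟩
    ∑ (λ i → ∑ (λ j → a i j * ((x i + x j) * (x i + x j)))) ∎
    where
    open ≡-Reasoning
    expand : energy x ≡ ∑ (λ i → ∑ (λ j → x i * (a i j * (x i + x j))))
    expand = ∑-cong λ i → trans (cong (x i *_) (Q-apply x i)) (sym (∑-*ˡ (x i) _))
    merge : ∀ y b z → y * (b * (y + z)) + z * (b * (z + y)) ≡ b * ((y + z) * (y + z))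
    merge = solve-∀

  -- Such an edge makes the energy positive, and a positive sum has a positive summand, which is all
  -- that sign preservation asks for.
  unbalanced-edge : ∀ x {p q} → H p q ≡ true → x p + x q ≢ 0ℤ → ∃ λ i → 0ℤ < x i * (Q H · x) i
  unbalanced-edge x {p} {q} pq ne = ∑-positive⁻¹ (λ i → x i * (Q H · x) i) (halve (subst (0ℤ <_) (sym (double-energy x)) positive))
    where
    term-nonNegative : ∀ i j → 0ℤ ℤ.≤ a i j * ((x i + x j) * (x i + x j))
    term-nonNegative i j with H i j
    ... | true  = subst (0ℤ ℤ.≤_) (sym (ℤₚ.*-identityˡ _)) (square-nonNegative (x i + x j))
    ... | false = ℤₚ.≤-reflexive (sym (ℤₚ.*-zeroˡ ((x i + x j) * (x i + x j))))
    term-positive : 0ℤ < a p q * ((x p + x q) * (x p + x q))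
    term-positive = subst (λ b → 0ℤ < (if b then 1ℤ else 0ℤ) * ((x p + x q) * (x p + x q))) (sym pq)
      (subst (0ℤ <_) (sym (ℤₚ.*-identityˡ _)) (square-positive ne))
    positive : 0ℤ < ∑ (λ i → ∑ (λ j → a i j * ((x i + x j) * (x i + x j))))
    positive = ∑-positive (λ i → ∑-nonNegative (term-nonNegative i)) p (∑-positive (term-nonNegative p) q term-positive)
    halve : ∀ {e} → 0ℤ < e + e → 0ℤ < e
    halve {e} 0<2e with 0ℤ ℤ.<? e
    ... | yes p = p
    ... | no ¬p = ⊥-elim (ℤₚ.<-irrefl refl (ℤₚ.<-≤-trans 0<2e (ℤₚ.+-mono-≤ (ℤₚ.≮⇒≥ ¬p) (ℤₚ.≮⇒≥ ¬p))))

module PrincipalMinors {n} (A : Adj n) (A-simple : IsSimple A) (A-connected : Connected A) (u v : Fin n)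
  (uv : A u v ≡ true) (nonCycle : ∀ (C : Cycle A) → ¬ CycleEdge C u v) where

  open Bridge A A-simple A-connected u v uv nonCycle
  open Laplacian B B-simple

  Contains : Bool → Vec Bool n → Set
  Contains t b = ∀ y → side y ≡ t → lookup b y ≡ true

  Degenerate : Vec Bool n → Bool → Set
  Degenerate b t = Contains t b × Bipartite (half t)

  degenerate? : ∀ b t → Dec (Degenerate b t)
  degenerate? b t = Finₚ.all? (λ y → (side y Bool.≟ t) →-dec (lookup b y Bool.≟ true)) ×-dec bipartite? (half t)

  module _ (x : Fin n → ℤ) (balanced : ∀ {p q} → B p q ≡ true → x p + x q ≡ 0ℤ) where

    opposite : ∀ {p q} → B p q ≡ true → x q ≡ - x p
    opposite {p} {q} e = trans (isolate (x p) (x q)) (trans (cong (λ t → t + - x p) (balanced e)) (ℤₚ.+-identityˡ (- x p)))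
      where
      isolate : ∀ a b → b ≡ a + b + - a
      isolate = solve-∀

    nonzero-reach : ∀ {p q} → Reach B p q → x p ≢ 0ℤ → x q ≢ 0ℤ
    nonzero-reach here               ne = ne
    nonzero-reach (step {p} {q} e r) ne = nonzero-reach r λ xq → ne
      (trans (sym (ℤₚ.neg-involutive (x p))) (cong -_ (trans (sym (opposite e)) xq)))

    -- A balanced x changes sign along every edge. Being nonzero at p, it vanishes nowhere on the
    -- side of p, so its sign is a proper colouring there.
    positive-colouring : ∀ p → x p ≢ 0ℤ → Bipartite (half (side p))
    positive-colouring p ne = (λ y → ⌊ 0ℤ ℤ.<? x y ⌋) , proper
      where
      signs : ∀ y z → y ≢ 0ℤ → z ≡ - y → ⌊ 0ℤ ℤ.<? y ⌋ ≢ ⌊ 0ℤ ℤ.<? z ⌋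
      signs (+ zero)     .(- (+ zero))     y≢0 refl = ⊥-elim (y≢0 refl)
      signs ℤ.+[1+ m ]   .(- ℤ.+[1+ m ])   y≢0 refl with 0ℤ ℤ.<? ℤ.+[1+ m ]
      ... | yes _ = λ ()
      ... | no ¬p = ⊥-elim (¬p (+<+ (s≤s z≤n)))
      signs ℤ.-[1+ m ]   .(- ℤ.-[1+ m ])   y≢0 refl with 0ℤ ℤ.<? ℤ.+[1+ m ]
      ... | yes _ = λ ()
      ... | no ¬p = ⊥-elim (¬p (+<+ (s≤s z≤n)))
      proper : ∀ y z → half (side p) y z ≡ true → ⌊ 0ℤ ℤ.<? x y ⌋ ≢ ⌊ 0ℤ ℤ.<? x z ⌋
      proper y z e = let (b , s) = half-elim {side p} {y} {z} e in
        signs (x y) (x z) (nonzero-reach (side-reach (sym s)) ne) (opposite b)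

  -- A vector that is nonzero outside b is caught by a unit row. One supported in b either has an
  -- unbalanced edge, or is nonzero on a whole side; that side then lies in b and is bipartite,
  -- contrary to assumption.
  nondegenerate-positive : ∀ b → (∀ t → ¬ Degenerate b t) → 0ℤ < detℤ n (principal (Q B) b)
  nondegenerate-positive b ok = det-signPreserving (principal (Q B) b) signPreserving
    where
    outside : ∀ x i → lookup b i ≡ false → (principal (Q B) b · x) i ≡ x i
    outside x i e = trans (∑-cong λ j → cong (λ t → (if t then Q B i j else δ i j) * x j) e) (∑-δ i x)
    inside : ∀ x i → lookup b i ≡ true → (principal (Q B) b · x) i ≡ (Q B · x) i
    inside x i e = ∑-cong λ j → cong (λ t → (if t then Q B i j else δ i j) * x j) e

    supported : ∀ x p → x p ≢ 0ℤ → (∀ i → lookup b i ≡ false → x i ≡ 0ℤ) → ∃ λ i → 0ℤ < x i * (Q B · x) i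
    supported x p ne supp with Finₚ.any? (λ i → Finₚ.any? λ j → (B i j Bool.≟ true) ×-dec ¬? (x i + x j ℤ.≟ 0ℤ))
    ... | yes (i , j , e , unb) = unbalanced-edge x e unb
    ... | no none = ⊥-elim (ok (side p) (contains , positive-colouring x balanced p ne))
      where
      balanced : ∀ {i j} → B i j ≡ true → x i + x j ≡ 0ℤ
      balanced {i} {j} e = decidable-stable (x i + x j ℤ.≟ 0ℤ) λ unb → none (i , j , e , unb)
      contains : Contains (side p) b
      contains y s with lookup b y in by
      ... | true  = refl
      ... | false = ⊥-elim (nonzero-reach x balanced (side-reach (sym s)) ne (supp y by))

    signPreserving : SignPreserving (principal (Q B) b)
    signPreserving x p ne with Finₚ.any? (λ i → (lookup b i Bool.≟ false) ×-dec ¬? (x i ℤ.≟ 0ℤ))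
    ... | yes (i , e , xi) = i , subst (λ t → 0ℤ < x i * t) (sym (outside x i e)) (square-positive xi)
    ... | no none = let (i , pos) = supported x p ne supp in i , subst (λ t → 0ℤ < x i * t) (sym (inside x i (in-b i pos))) pos
      where
      supp : ∀ i → lookup b i ≡ false → x i ≡ 0ℤ
      supp i e = decidable-stable (x i ℤ.≟ 0ℤ) λ xi → none (i , e , xi)
      in-b : ∀ i → 0ℤ < x i * (Q B · x) i → lookup b i ≡ true
      in-b i pos with lookup b i in bi
      ... | true  = refl
      ... | false = ⊥-elim (ℤₚ.<-irrefl (sym (trans (cong (_* (Q B · x) i) (supp i bi)) (ℤₚ.*-zeroˡ ((Q B · x) i)))) pos)

  Q-sym : ∀ i j → Q B i j ≡ Q B j i
  Q-sym i j with i ≟ j | j ≟ i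
  ... | yes refl | yes _    = refl
  ... | yes refl | no ne    = ⊥-elim (ne refl)
  ... | no ne    | yes refl = ⊥-elim (ne refl)
  ... | no _     | no _     = cong (λ b → if b then + 1 else + 0) (proj₁ B-simple i j)

  root : Bool → Fin n
  root true  = u
  root false = v

  side-root : ∀ t → side (root t) ≡ t
  side-root true  = side-u
  side-root false = side-v

  -- The colouring of side t, read as signs ±1 and extended by zero, is annihilated by `Q B`. It
  -- involves only rows of side t, and these lie in b, where the principal matrix has the rows of
  -- `Q B`.
  degenerate-zero : ∀ b t → Degenerate b t → detℤ n (principal (Q B) b) ≡ 0ℤ
  degenerate-zero b t (contains , c , proper) = det-leftKernel (principal (Q B) b) κ kernel (root t) κ-root
    where
    sign : Bool → ℤ
    sign true  = 1ℤ
    sign false = -1ℤ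

    κ : Fin n → ℤ
    κ y = if on t (side y) then sign (c y) else 0ℤ

    κ-root : κ (root t) ≢ 0ℤ
    κ-root rewrite side-root t | on-self t with c (root t)
    ... | true  = λ ()
    ... | false = λ ()

    sign-opposite : ∀ {a b} → a ≢ b → sign a + sign b ≡ 0ℤ
    sign-opposite {true}  {true}  ne = ⊥-elim (ne refl)
    sign-opposite {true}  {false} ne = refl
    sign-opposite {false} {true}  ne = refl
    sign-opposite {false} {false} ne = ⊥-elim (ne refl)

    cancels : ∀ i j → adjacency B j i * (κ j + κ i) ≡ 0ℤ
    cancels i j with B j i in e
    ... | false = ℤₚ.*-zeroˡ (κ j + κ i)
    ... | true rewrite side-edge e with on t (side i) in s
    ...   | false = refl
    ...   | true  = trans (ℤₚ.*-identityˡ _) (sign-opposite (proper j i (half-intro e (trans (side-edge e) (on-true t s)))))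

    entry : ∀ i j → κ i * principal (Q B) b i j ≡ Q B j i * κ i
    entry i j with on t (side i) in s
    ... | false = sym (ℤₚ.*-zeroʳ (Q B j i))
    ... | true rewrite contains i (on-true t s) = trans (ℤₚ.*-comm (sign (c i)) (Q B i j)) (cong (_* sign (c i)) (Q-sym i j))

    kernel : ∀ j → ∑ (λ i → κ i * principal (Q B) b i j) ≡ 0ℤ
    kernel j = trans (∑-cong λ i → entry i j) (trans (Q-apply κ j) (∑-zero λ i → cancels i j))

-- The comparison

≢0,1⇒≥2 : ∀ i → i ≢ 0 → i ≢ 1 → 2 ≤ i
≢0,1⇒≥2 zero          i≢0 i≢1 = ⊥-elim (i≢0 refl)
≢0,1⇒≥2 (suc zero)    i≢0 i≢1 = ⊥-elim (i≢1 refl)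
≢0,1⇒≥2 (suc (suc i)) i≢0 i≢1 = s≤s (s≤s z≤n)

count-none : ∀ n → count {n} (λ _ → false) ≡ 0
count-none zero    = refl
count-none (suc n) = count-none n

count-all : ∀ n → count {n} (λ _ → true) ≡ n
count-all zero    = refl
count-all (suc n) = cong suc (count-all n)

==-suc : ∀ {n} (i p : Fin n) → (suc i == suc p) ≡ (i == p)
==-suc i p with i ≟ p
... | yes _ = refl
... | no _  = refl

count-insert : ∀ {n} (f : Fin n → Bool) p → f p ≡ false → count (λ i → f i ∨ (i == p)) ≡ suc (count f)
count-insert f zero    fp rewrite fp = cong suc (count-cong λ i → Boolₚ.∨-identityʳ (f (suc i)))
count-insert f (suc p) fp = trans
  (cong₂ (λ b c → (if b then 1 else 0) ℕ.+ c) (Boolₚ.∨-identityʳ (f zero))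
    (trans (count-cong λ i → cong (f (suc i) ∨_) (==-suc i p)) (count-insert (f ∘ suc) p fp)))
  (ℕₚ.+-suc (if f zero then 1 else 0) (count (f ∘ suc)))

count-delete : ∀ {n} (f : Fin n → Bool) p → f p ≡ true → count f ≡ suc (count (λ i → f i ∧ not (i == p)))
count-delete f p fp = trans (count-cong restore)
    (count-insert (λ i → f i ∧ not (i == p)) p (trans (cong (λ b → f p ∧ not b) (==-refl p)) (Boolₚ.∧-zeroʳ (f p))))
  where
  restore : ∀ i → f i ≡ (f i ∧ not (i == p)) ∨ (i == p)
  restore i with i ≟ p
  ... | yes refl = trans fp (sym (Boolₚ.∨-zeroʳ (f i ∧ false)))
  ... | no _     = sym (trans (Boolₚ.∨-identityʳ (f i ∧ true)) (Boolₚ.∧-identityʳ (f i)))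

count-full : ∀ {n} (f : Fin n → Bool) → count f ≡ n → ∀ i → f i ≡ true
count-full {n} f e i with f i in fi
... | true  = refl
... | false = ⊥-elim (ℕₚ.<-irrefl e (subst (count f ℕ.<_) (count-all n) (count-strict (λ _ _ → refl) i fi refl)))

-- This supplies the vertex sets of prescribed size: `f` marks the vertices that must belong, and
-- the complement of `g` those that must not.
interpolate : ∀ {n} (f g : Fin n → Bool) → (∀ i → f i ≡ true → g i ≡ true) → ∀ k → count f ≤ k → k ≤ count g →
  ∃ λ (b : Vec Bool n) → size b ≡ k × (∀ i → f i ≡ true → lookup b i ≡ true) × (∀ i → g i ≡ false → lookup b i ≡ false)
interpolate {zero}  f g h zero lo hi = [] , refl , (λ ()) , λ ()
interpolate {suc n} f g h k    lo hi = cases (f zero) (g zero) refl refl k lo hi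
  where
  Result : ℕ → Set
  Result k = ∃ λ (b : Vec Bool (suc n)) → size b ≡ k × (∀ i → f i ≡ true → lookup b i ≡ true) × (∀ i → g i ≡ false → lookup b i ≡ false)
  extend : ∀ c {k} → (f zero ≡ true → c ≡ true) → (g zero ≡ false → c ≡ false) →
    count (f ∘ suc) ≤ k → k ≤ count (g ∘ suc) → Result ((if c then 1 else 0) ℕ.+ k)
  extend c {k} fc gc lo hi = let (b , s , fb , gb) = interpolate (f ∘ suc) (g ∘ suc) (h ∘ suc) k lo hi in
    c ∷ b , cong ((if c then 1 else 0) ℕ.+_) s , (λ { zero → fc ; (suc i) → fb i }) , (λ { zero → gc ; (suc i) → gb i })
  count-at : ∀ (f : Fin (suc n) → Bool) {b} → f zero ≡ b → count f ≡ (if b then 1 else 0) ℕ.+ count (f ∘ suc)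
  count-at f refl = refl
  cases : ∀ a c → f zero ≡ a → g zero ≡ c → ∀ k → count f ≤ k → k ≤ count g → Result k
  cases true  false f₀ g₀ k lo hi = ⊥-elim (Boolₚ.not-¬ (h zero f₀) g₀)
  cases true  true  f₀ g₀ zero lo hi with () ← subst (_≤ 0) (count-at f f₀) lo
  cases true  true  f₀ g₀ (suc k) lo hi = extend true (λ _ → refl) (λ g₀′ → ⊥-elim (Boolₚ.not-¬ g₀ g₀′))
    (ℕ.s≤s⁻¹ (subst (_≤ suc k) (count-at f f₀) lo)) (ℕ.s≤s⁻¹ (subst (suc k ≤_) (count-at g g₀) hi))
  cases false false f₀ g₀ k lo hi = extend false (λ f₀′ → ⊥-elim (Boolₚ.not-¬ f₀′ f₀)) (λ _ → refl)
    (subst (_≤ k) (count-at f f₀) lo) (subst (k ≤_) (count-at g g₀) hi)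
  -- The vertex is left out as long as the rest of `g` has room for k elements. Otherwise k is the
  -- size of `g`, and every free vertex is taken.
  cases false true  f₀ g₀ k lo hi with k ℕ.≤? count (g ∘ suc)
  ... | yes k≤ = extend false (λ f₀′ → ⊥-elim (Boolₚ.not-¬ f₀′ f₀)) (λ _ → refl) (subst (_≤ k) (count-at f f₀) lo) k≤
  ... | no k≰ = subst Result (sym (ℕₚ.≤-antisym (subst (k ≤_) (count-at g g₀) hi) (ℕₚ.≰⇒> k≰)))
    (extend true (λ _ → refl) (λ g₀′ → ⊥-elim (Boolₚ.not-¬ g₀ g₀′)) (count-mono (h ∘ suc)) ℕₚ.≤-refl)

eval-charPolyQ : ∀ {n} (H : Adj n) x → eval (charPolyQ H) x ≡ detℤ n (λ i j → x * δ i j + - Q H i j)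
eval-charPolyQ {n} H x = trans (eval-det n (λ i j → if i == j then (- Q H i j) ∷ + 1 ∷ [] else (- Q H i j) ∷ []) x) (det-cong entry)
  where
  diagonalEntry : ∀ q x → - q + x * (1ℤ + x * 0ℤ) ≡ x * 1ℤ + - q
  diagonalEntry = solve-∀
  offDiagonalEntry : ∀ q x → - q + x * 0ℤ ≡ x * 0ℤ + - q
  offDiagonalEntry = solve-∀
  evalIf : ∀ b q → eval (if b then (- q) ∷ + 1 ∷ [] else (- q) ∷ []) x ≡ x * (if b then 1ℤ else 0ℤ) + - q
  evalIf true  q = diagonalEntry q x
  evalIf false q = offDiagonalEntry q x
  entry : ∀ i j → eval (if i == j then (- Q H i j) ∷ + 1 ∷ [] else (- Q H i j) ∷ []) x ≡ x * δ i j + - Q H i j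
  entry i j = evalIf (i == j) (Q H i j)

indicator : Bool → ℤ
indicator b = if b then 1ℤ else 0ℤ

∑-indicator : ∀ {n} (i : Fin n) → ∑ (δ i) ≡ 1ℤ
∑-indicator i = trans (∑-cong λ j → sym (ℤₚ.*-identityʳ (δ i j))) (∑-δ i (λ _ → 1ℤ))

δ-sym : ∀ {n} (i j : Fin n) → δ i j ≡ δ j i
δ-sym i j with i ≟ j | j ≟ i
... | yes _    | yes _    = refl
... | no _     | no _     = refl
... | yes refl | no ne    = ⊥-elim (ne refl)
... | no ne    | yes refl = ⊥-elim (ne refl)

module Comparison {n} (A : Adj n) (A-simple : IsSimple A) (A-connected : Connected A) (u v : Fin n)
  (uv : A u v ≡ true) (nonCycle : ∀ (C : Cycle A) → ¬ CycleEdge C u v) where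

  open Bridge A A-simple A-connected u v uv nonCycle
  open PrincipalMinors A A-simple A-connected u v uv nonCycle

  G : Adj n
  G = contractPendent A u v

  a b g : Mat n
  a = adjacency A
  b = adjacency B
  g = adjacency G

  B≡A : ∀ {i j} → ¬ (i ≡ u × j ≡ v) → ¬ (i ≡ v × j ≡ u) → B i j ≡ A i j
  B≡A {i} {j} ¬uv ¬vu = cases (A i j) refl
    where
    cases : ∀ t → A i j ≡ t → B i j ≡ A i j
    cases false e = trans (cong (_∧ not (isPair u v i j)) e) (sym e)
    cases true  e with deleteEdge-cases A u v e
    ... | inj₁ h = trans h (sym e)
    ... | inj₂ (inj₁ p) = ⊥-elim (¬uv p)
    ... | inj₂ (inj₂ p) = ⊥-elim (¬vu p)

  b-zero : ∀ {i j} → B i j ≡ false → b i j ≡ 0ℤ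
  b-zero = cong indicator

  b-uv : b u v ≡ 0ℤ
  b-uv = b-zero B-uv

  b-vu : b v u ≡ 0ℤ
  b-vu = b-zero (trans (proj₁ B-simple v u) B-uv)

  b-irr : ∀ i → b i i ≡ 0ℤ
  b-irr i = b-zero (proj₂ B-simple i)

  a-other : ∀ {i} → i ≢ u → i ≢ v → ∀ j → a i j ≡ b i j
  a-other i≢u i≢v j = cong indicator (sym (B≡A (i≢u ∘ proj₁) (i≢v ∘ proj₁)))

  vertices : ∀ {R : Fin n → Set} → R u → R v → (∀ j → j ≢ u → j ≢ v → R j) → ∀ j → R j
  vertices {R} = column u v u≢v {R}

  a-u : ∀ j → a u j ≡ b u j + δ v j
  a-u = vertices (same u u≢v) (trans (cong indicator uv) (sym (cong₂ _+_ b-uv (δ-same v)))) (λ j _ j≢v → same j j≢v)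
    where
    same : ∀ j → j ≢ v → a u j ≡ b u j + δ v j
    same j j≢v = trans (cong indicator (sym (B≡A (j≢v ∘ proj₂) (u≢v ∘ proj₁))))
      (sym (trans (cong (λ t → b u j + t) (δ-different (j≢v ∘ sym))) (ℤₚ.+-identityʳ (b u j))))

  a-v : ∀ j → a v j ≡ b v j + δ u j
  a-v = vertices (trans (cong indicator (trans (A-sym v u) uv)) (sym (cong₂ _+_ b-vu (δ-same u)))) (same v (u≢v ∘ sym)) (λ j j≢u _ → same j j≢u)
    where
    same : ∀ j → j ≢ u → a v j ≡ b v j + δ u j
    same j j≢u = trans (cong indicator (sym (B≡A (u≢v ∘ sym ∘ proj₁) (j≢u ∘ proj₂))))
      (sym (trans (cong (λ t → b v j + t) (δ-different (j≢u ∘ sym))) (ℤₚ.+-identityʳ (b v j))))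

  indicator-∨ : ∀ {x y} → ¬ (x ≡ true × y ≡ true) → indicator (x ∨ y) ≡ indicator x + indicator y
  indicator-∨ {true}  {true}  ne = ⊥-elim (ne (refl , refl))
  indicator-∨ {true}  {false} ne = refl
  indicator-∨ {false} {true}  ne = refl
  indicator-∨ {false} {false} ne = refl

  -- The neighbours of u and of v in `B` lie on different sides. Hence merging u and v identifies no
  -- two edges, and the disjunction in `contractPendent` becomes a sum of matrix entries.
  no-common : ∀ {i} → ¬ (B u i ≡ true × B v i ≡ true)
  no-common (e , f) = Boolₚ.not-¬ side-u (trans (trans (side-edge e) (sym (side-edge f))) side-v)

  merged : ∀ {j} → j ≢ u → j ≢ v → indicator (A u j ∨ A v j) ≡ b u j + b v j
  merged {j} j≢u j≢v = trans (cong₂ (λ s t → indicator (s ∨ t)) (sym (B≡A (j≢v ∘ proj₂) (j≢u ∘ proj₂))) (sym (B≡A (j≢v ∘ proj₂) (j≢u ∘ proj₂))))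
    (indicator-∨ no-common)

  contract-v : ∀ y → G v y ≡ (y == u)
  contract-v y rewrite ==-refl v = refl

  contract-to-v : ∀ {x} → x ≢ v → G x v ≡ (x == u)
  contract-to-v x≢v rewrite ==-≢ x≢v | ==-refl v = refl

  contract-u : ∀ {y} → y ≢ v → G u y ≡ not (y == u) ∧ (A u y ∨ A v y)
  contract-u y≢v rewrite ==-≢ u≢v | ==-≢ y≢v | ==-refl u = refl

  contract-to-u : ∀ {x} → x ≢ u → x ≢ v → G x u ≡ A u x ∨ A v x
  contract-to-u x≢u x≢v rewrite ==-≢ x≢v | ==-≢ u≢v | ==-≢ x≢u | ==-refl u = refl

  contract-other : ∀ {x y} → x ≢ u → x ≢ v → y ≢ u → y ≢ v → G x y ≡ A x y
  contract-other x≢u x≢v y≢u y≢v rewrite ==-≢ x≢v | ==-≢ y≢v | ==-≢ x≢u | ==-≢ y≢u = refl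

  g-v : ∀ j → g v j ≡ δ u j
  g-v j = trans (cong indicator (contract-v j)) (δ-sym j u)

  g-u : ∀ j → g u j ≡ (b u j + b v j) + δ v j
  g-u = vertices
    (trans (cong indicator (trans (contract-u u≢v) (cong (λ t → not t ∧ (A u u ∨ A v u)) (==-refl u))))
      (sym (cong₂ _+_ (cong₂ _+_ (b-irr u) b-vu) (δ-different (u≢v ∘ sym)))))
    (trans (cong indicator (trans (contract-to-v u≢v) (==-refl u)))
      (sym (cong₂ _+_ (cong₂ _+_ b-uv (b-irr v)) (δ-same v))))
    (λ j j≢u j≢v → trans (cong indicator (trans (contract-u j≢v) (cong (λ t → not t ∧ (A u j ∨ A v j)) (==-≢ j≢u))))
      (trans (merged j≢u j≢v) (sym (trans (cong (λ t → b u j + b v j + t) (δ-different (j≢v ∘ sym))) (ℤₚ.+-identityʳ (b u j + b v j))))))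

  b-sym : ∀ i j → b i j ≡ b j i
  b-sym i j = cong indicator (proj₁ B-simple i j)

  g-other : ∀ {i} → i ≢ u → i ≢ v → ∀ j → g i j ≡ moveTo u v u≢v (b i) j
  g-other {i} i≢u i≢v = vertices
    (trans (cong indicator (contract-to-u i≢u i≢v)) (trans (merged i≢u i≢v)
      (trans (cong₂ _+_ (b-sym u i) (b-sym v i)) (sym (move-u u v u≢v (b i))))))
    (trans (cong indicator (trans (contract-to-v i≢v) (==-≢ i≢u))) (sym (move-v u v u≢v (b i))))
    (λ j j≢u j≢v → trans (cong indicator (contract-other i≢u i≢v j≢u j≢v))
      (trans (a-other i≢u i≢v j) (sym (move-other u v u≢v (b i) j≢u j≢v))))

  G-irr : ∀ i → G i i ≡ false
  G-irr = vertices
    (trans (contract-u u≢v) (cong (λ t → not t ∧ (A u u ∨ A v u)) (==-refl u)))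
    (trans (contract-v v) (==-≢ (u≢v ∘ sym)))
    (λ i i≢u i≢v → trans (contract-other i≢u i≢v i≢u i≢v) (proj₂ A-simple i))

  degree-sum : ∀ (H : Adj n) i {f h : Fin n → ℤ} {d e} → (∀ j → adjacency H i j ≡ f j + h j) →
    ∑ f ≡ d → ∑ h ≡ e → degree H i ≡ d + e
  degree-sum H i eq refl refl = trans (∑-cong eq) ∑-+

  degree-A-u : degree A u ≡ degree B u + 1ℤ
  degree-A-u = degree-sum A u a-u refl (∑-indicator v)

  degree-A-v : degree A v ≡ degree B v + 1ℤ
  degree-A-v = degree-sum A v a-v refl (∑-indicator u)

  degree-G-u : degree G u ≡ (degree B u + degree B v) + 1ℤ
  degree-G-u = degree-sum G u g-u ∑-+ (∑-indicator v)

  -- Moving an entry from column v to column u preserves the row sum.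
  degree-G-other : ∀ {i} → i ≢ u → i ≢ v → degree G i ≡ degree B i
  degree-G-other {i} i≢u i≢v = trans (degree-sum G i (g-other i≢u i≢v) refl
      (trans (∑-*ˡ (b i v) (λ j → δ u j + - δ v j)) (trans (cong (b i v *_) balanced) (ℤₚ.*-zeroʳ (b i v)))))
    (ℤₚ.+-identityʳ (degree B i))
    where
    balanced : ∑ (λ j → δ u j + - δ v j) ≡ 0ℤ
    balanced = trans ∑-+ (cong₂ _+_ (∑-indicator u) (trans (∑-cong λ j → sym (ℤₚ.-1*i≡-i (δ v j)))
      (trans (∑-*ˡ -1ℤ (δ v)) (cong (-1ℤ *_) (∑-indicator v)))))

  keep : Fin n → Bool
  keep i = (i == u) ∨ (i == v)

  keep-u : keep u ≡ true
  keep-u = cong (_∨ (u == v)) (==-refl u)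

  keep-v : keep v ≡ true
  keep-v = ∨-trueʳ (v == u) (==-refl v)

  keep-other : ∀ {i} → i ≢ u → i ≢ v → keep i ≡ false
  keep-other i≢u i≢v = cong₂ _∨_ (==-≢ i≢u) (==-≢ i≢v)

  module _ (x : ℤ) where

    N : Mat n
    N i j = diagonal keep x i * δ i j + - Q B i j

    N-entry : ∀ i {z} → diagonal keep x i ≡ z → ∀ j → N i j ≡ z * δ i j + - (δ i j * degree B i + b i j)
    N-entry i refl j = cong (λ t → diagonal keep x i * δ i j + - t) (Q-entry B (proj₂ B-simple) i j)

    z-u : diagonal keep x u ≡ 0ℤ
    z-u = cong (λ t → if t then 0ℤ else x) keep-u

    z-v : diagonal keep x v ≡ 0ℤ
    z-v = cong (λ t → if t then 0ℤ else x) keep-v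

    z-other : ∀ {i} → i ≢ u → i ≢ v → diagonal keep x i ≡ x
    z-other i≢u i≢v = cong (λ t → if t then 0ℤ else x) (keep-other i≢u i≢v)

    N-block : ∀ i j → side i ≢ side j → N i j ≡ 0ℤ
    N-block i j ne = trans (N-entry i refl j) (trans (cong₂ (λ s t → diagonal keep x i * s + - (s * degree B i + t))
      (δ-different (λ { refl → ne refl })) (b-zero (side-different ne))) (vanish (diagonal keep x i) (degree B i)))
      where
      vanish : ∀ z d → z * 0ℤ + - (0ℤ * d + 0ℤ) ≡ 0ℤ
      vanish = solve-∀

    open Coalescence u v u≢v side side-u side-v N N-block

    joined coalesced : Mat n
    joined    i j = x * δ i j + - Q A i j
    coalesced i j = x * δ i j + - Q G i j

    -- The edge uv of G, like the pendent edge of G_uv, raises the degree of both its ends by one,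
    -- which turns x into x - 1; its adjacency entry is the -1 passed along with `k`.
    k : ℤ
    k = x + -1ℤ

    det-A : detℤ n joined ≡ value k -1ℤ + detℤ n N
    det-A = det-joined k -1ℤ joined other at-u at-v
      where
      other : ∀ i → i ≢ u → i ≢ v → ∀ j → joined i j ≡ N i j
      other i i≢u i≢v j = trans (cong (λ t → x * δ i j + - t) (trans (Q-entry A (proj₂ A-simple) i j)
          (cong₂ (λ d c → δ i j * d + c) (∑-cong (a-other i≢u i≢v)) (a-other i≢u i≢v j))))
        (sym (N-entry i (z-other i≢u i≢v) j))
      ring : ∀ x e d b f → x * e + - (e * (d + 1ℤ) + (b + f)) ≡ 0ℤ * e + - (e * d + b) + ((x + -1ℤ) * e + -1ℤ * f)
      ring = solve-∀
      ring′ : ∀ x e d b f → x * e + - (e * (d + 1ℤ) + (b + f)) ≡ 0ℤ * e + - (e * d + b) + (-1ℤ * f + (x + -1ℤ) * e)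
      ring′ = solve-∀
      at-u : ∀ j → joined u j ≡ N u j + (k * δ u j + -1ℤ * δ v j)
      at-u j = trans (cong (λ t → x * δ u j + - t) (trans (Q-entry A (proj₂ A-simple) u j)
          (cong₂ (λ d c → δ u j * d + c) degree-A-u (a-u j))))
        (trans (ring x (δ u j) (degree B u) (b u j) (δ v j))
          (cong (_+ (k * δ u j + -1ℤ * δ v j)) (sym (N-entry u z-u j))))
      at-v : ∀ j → joined v j ≡ N v j + (-1ℤ * δ u j + k * δ v j)
      at-v j = trans (cong (λ t → x * δ v j + - t) (trans (Q-entry A (proj₂ A-simple) v j)
          (cong₂ (λ d c → δ v j * d + c) degree-A-v (a-v j))))
        (trans (ring′ x (δ v j) (degree B v) (b v j) (δ u j))
          (cong (_+ (-1ℤ * δ u j + k * δ v j)) (sym (N-entry v z-v j))))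

    det-G : detℤ n coalesced ≡ value k -1ℤ
    det-G = det-coalesced k -1ℤ coalesced other at-u at-v
      where
      ring : ∀ x e d b c t → x * e + - (e * d + (b + c * t)) ≡ x * e + - (e * d + b) + (x * 0ℤ + - (0ℤ * d + c)) * t
      ring = solve-∀
      other : ∀ i → i ≢ u → i ≢ v → ∀ j → coalesced i j ≡ N~ i j
      other i i≢u i≢v j = trans (cong (λ t → x * δ i j + - t) (trans (Q-entry G G-irr i j)
          (cong₂ (λ d c → δ i j * d + c) (degree-G-other i≢u i≢v) (g-other i≢u i≢v j))))
        (trans (ring x (δ i j) (degree B i) (b i j) (b i v) (δ u j + - δ v j))
          (sym (cong₂ (λ s t → s + t * (δ u j + - δ v j)) (N-entry i (z-other i≢u i≢v) j)
            (trans (N-entry i (z-other i≢u i≢v) v) (cong (λ e → x * e + - (e * degree B i + b i v)) (δ-different i≢v))))))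
      ring-u : ∀ x e f d d′ b b′ → x * e + - (e * (d + d′ + 1ℤ) + (b + b′ + f)) ≡
        (0ℤ * e + - (e * d + b)) + ((0ℤ * f + - (f * d′ + b′)) + (0ℤ * 1ℤ + - (1ℤ * d′ + 0ℤ)) * (e + - f)) + ((x + -1ℤ) * e + -1ℤ * f)
      ring-u = solve-∀
      at-u : ∀ j → coalesced u j ≡ (N u j + N~ v j) + (k * δ u j + -1ℤ * δ v j)
      at-u j = trans (cong (λ t → x * δ u j + - t) (trans (Q-entry G G-irr u j)
          (cong₂ (λ d c → δ u j * d + c) degree-G-u (g-u j))))
        (trans (ring-u x (δ u j) (δ v j) (degree B u) (degree B v) (b u j) (b v j))
          (cong (_+ (k * δ u j + -1ℤ * δ v j)) (sym (cong₂ _+_ (N-entry u z-u j)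
            (cong₂ (λ s t → s + t * (δ u j + - δ v j)) (N-entry v z-v j)
              (trans (N-entry v z-v v) (cong₂ (λ e c → 0ℤ * e + - (e * degree B v + c)) (δ-same v) (b-irr v))))))))
      ring-v : ∀ x e f → x * f + - (f * 1ℤ + e) ≡ -1ℤ * e + (x + -1ℤ) * f
      ring-v = solve-∀
      at-v : ∀ j → coalesced v j ≡ -1ℤ * δ u j + k * δ v j
      at-v j = trans (cong (λ t → x * δ v j + - t) (trans (Q-entry G G-irr v j)
          (cong₂ (λ d c → δ v j * d + c) (trans (∑-cong g-v) (∑-indicator u)) (g-v j))))
        (ring-v x (δ u j) (δ v j))

    eval-difference : eval (charPolyQ A) x ≡ eval (charPolyQ G ⊕ minorPoly keep (Q B)) x
    eval-difference = begin
      eval (charPolyQ A) x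
        ≡⟨ trans (eval-charPolyQ A x) det-A ⟩
      value k -1ℤ + detℤ n N
        ≡⟨ cong₂ _+_ (sym (trans (eval-charPolyQ G x) det-G)) (det-diagonal-minus keep (Q B) x) ⟩
      eval (charPolyQ G) x + eval (minorPoly keep (Q B)) x
        ≡⟨ sym (eval-⊕ (charPolyQ G) (minorPoly keep (Q B)) x) ⟩
      eval (charPolyQ G ⊕ minorPoly keep (Q B)) x ∎
      where open ≡-Reasoning

  module Coefficient (i : ℕ) (i≤n : i ≤ n) where
    open MinorCoefficients keep (Q B) i i≤n public

    gap : ℤ
    gap = ∑ₛ term

    φ-difference : φ A i ≡ φ G i + gap
    φ-difference = trans (cong (-1ℤ ^ i *_) (trans (coeff-unique (charPolyQ A) (charPolyQ G ⊕ minorPoly keep (Q B)) eval-difference (n ∸ i))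
        (coeff-⊕ (charPolyQ G) (minorPoly keep (Q B)) (n ∸ i))))
      (trans (ℤₚ.*-distribˡ-+ (-1ℤ ^ i) (coeff (charPolyQ G) (n ∸ i)) (coeff (minorPoly keep (Q B)) (n ∸ i)))
        (cong (λ t → φ G i + t) coefficient))

    minor-nonNegative : ∀ c → 0ℤ ≤ℤ detℤ n (principal (Q B) c)
    minor-nonNegative c with degenerate? c true | degenerate? c false
    ... | yes d | _     = ℤₚ.≤-reflexive (sym (degenerate-zero c true d))
    ... | no _  | yes d = ℤₚ.≤-reflexive (sym (degenerate-zero c false d))
    ... | no ¬t | no ¬f = ℤₚ.<⇒≤ (nondegenerate-positive c λ { true → ¬t ; false → ¬f })

    term-nonNegative : ∀ c → 0ℤ ≤ℤ term c
    term-nonNegative c with admissible? c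
    ... | yes adm = subst (0ℤ ≤ℤ_) (sym (term-admissible c adm)) (minor-nonNegative c)
    ... | no ¬adm = ℤₚ.≤-reflexive (sym (term-other c ¬adm))

    gap-nonNegative : 0ℤ ≤ℤ gap
    gap-nonNegative = ∑ₛ-nonNegative term-nonNegative

    gap-positive : ∀ c → Admissible c → (∀ t → ¬ Degenerate c t) → 0ℤ < gap
    gap-positive c adm ok = ∑ₛ-positive term-nonNegative c
      (subst (0ℤ <_) (sym (term-admissible c adm)) (nondegenerate-positive c ok))

    gap-zero : (∀ c → Admissible c → ∃ λ t → Degenerate c t) → gap ≡ 0ℤ
    gap-zero h = ∑ₛ-zero vanish
      where
      vanish : ∀ c → term c ≡ 0ℤ
      vanish c with admissible? c
      ... | no ¬adm = term-other c ¬adm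
      ... | yes adm = let (t , d) = h c adm in trans (term-admissible c adm) (degenerate-zero c t d)

    ≤-φ : φ G i ≤ℤ φ A i
    ≤-φ = subst₂ _≤ℤ_ (ℤₚ.+-identityʳ (φ G i)) (sym φ-difference) (ℤₚ.+-monoʳ-≤ (φ G i) gap-nonNegative)

    gap-zero⇒ : gap ≡ 0ℤ → φ A i ≡ φ G i
    gap-zero⇒ e = trans φ-difference (trans (cong (λ t → φ G i + t) e) (ℤₚ.+-identityʳ (φ G i)))

    gap-positive⇒ : 0ℤ < gap → φ A i ≢ φ G i
    gap-positive⇒ pos e = ℤₚ.<-irrefl (sym zero-gap) pos
      where
      isolate : ∀ a b → b ≡ (a + b) + - a
      isolate = solve-∀
      zero-gap : gap ≡ 0ℤ
      zero-gap = trans (isolate (φ G i) gap) (trans (cong (λ t → t + - φ G i) (trans (sym φ-difference) e)) (ℤₚ.+-inverseʳ (φ G i)))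

  -- Which coefficients coincide

  count-keep : count keep ≡ 2
  count-keep = trans (count-insert (_== u) v (==-≢ (u≢v ∘ sym)))
    (cong suc (trans (count-insert (λ _ → false) u refl) (cong suc (count-none n))))

  -- Deleting the bridge costs w one neighbour; with degree at least two another one is left.
  neighbour : ∀ w → degree A w ≡ degree B w + 1ℤ → 2 ≤ deg A w → ∃ λ p → B w p ≡ true
  neighbour w eq 2≤ with Finₚ.any? (λ p → B w p Bool.≟ true)
  ... | yes found = found
  ... | no none = ⊥-elim (ℕₚ.<-irrefl refl (subst (2 ≤_) deg≡1 2≤))
    where
    isolated : degree B w ≡ 0ℤ
    isolated = ∑-zero λ p → b-zero (Boolₚ.¬-not λ e → none (p , e))
    deg≡1 : deg A w ≡ 1
    deg≡1 = ℤₚ.+-injective (trans (deg≡degree A w) (trans eq (cong (_+ 1ℤ) isolated)))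

  remove : Fin n → (Fin n → Bool) → Fin n → Bool
  remove p f i = f i ∧ not (i == p)

  everything : Fin n → Bool
  everything _ = true

  keep-avoids : ∀ {p} → p ≢ u → p ≢ v → ∀ f → (∀ i → keep i ≡ true → f i ≡ true) →
    ∀ i → keep i ≡ true → remove p f i ≡ true
  keep-avoids {p} p≢u p≢v f h i ki = cong₂ (λ s t → s ∧ not t) (h i ki)
    (==-≢ λ { refl → Boolₚ.not-¬ ki (keep-other p≢u p≢v) })

  remove-at : ∀ p f → remove p f p ≡ false
  remove-at p f = trans (cong (λ t → f p ∧ not t) (==-refl p)) (Boolₚ.∧-zeroʳ (f p))

  remove-false : ∀ p f {i} → f i ≡ false → remove p f i ≡ false
  remove-false p f {i} e = cong (_∧ not (i == p)) e

  -- A vertex of side t that a set required to contain u and v may still omit.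
  record Spare (t : Bool) : Set where
    field
      p      : Fin n
      side-p : side p ≡ t
      p≢u    : p ≢ u
      p≢v    : p ≢ v

  distinct : ∀ {w p z} → B w p ≡ true → B w z ≡ false → p ≢ z
  distinct e f refl = Boolₚ.not-¬ e f

  spare : 2 ≤ deg A u → 2 ≤ deg A v → ∀ t → Spare t
  spare du dv true = let (p , e) = neighbour u degree-A-u du in record
    { p = p ; side-p = trans (sym (side-edge e)) side-u
    ; p≢u = distinct e (proj₂ B-simple u) ; p≢v = distinct e B-uv }
  spare du dv false = let (p , e) = neighbour v degree-A-v dv in record
    { p = p ; side-p = trans (sym (side-edge e)) side-v
    ; p≢u = distinct e (trans (proj₁ B-simple v u) B-uv) ; p≢v = distinct e (proj₂ B-simple v) }

  misses : ∀ {t} c (s : Spare t) → lookup c (Spare.p s) ≡ false → ¬ Contains t c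
  misses c s e contains = Boolₚ.not-¬ (contains (Spare.p s) (Spare.side-p s)) e

  count-remove-one : ∀ p → suc (count (remove p everything)) ≡ n
  count-remove-one p = trans (sym (count-delete everything p refl)) (count-all n)

  module Conclusion (du : 2 ≤ deg A u) (dv : 2 ≤ deg A v) (i : ℕ) (i≤n : i ≤ n) where
    open Coefficient i i≤n

    -- Omitting one vertex deals with side t, and the other side is harmless because it is not
    -- bipartite.
    positive-missing-one : ∀ t → ¬ Bipartite (half (not t)) → 2 ≤ i → i ℕ.< n → 0ℤ < gap
    positive-missing-one t nonbip 2≤i i<n =
      let (c , sz , lo , hi) = interpolate keep (remove p everything) (keep-avoids p≢u p≢v everything (λ _ _ → refl)) i
                                 (subst (_≤ i) (sym count-keep) 2≤i) (ℕ.s≤s⁻¹ (subst (i ℕ.<_) (sym (count-remove-one p)) i<n))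
          missing = misses c (spare du dv t) (hi p (remove-at p everything))
      in gap-positive c (sz , lo) λ t′ (contains , bip) → nondegenerate t t′ c nonbip missing contains bip
      where
      open Spare (spare du dv t)
      nondegenerate : ∀ t t′ c → ¬ Bipartite (half (not t)) → ¬ Contains t c → Contains t′ c → Bipartite (half t′) → ⊥
      nondegenerate true  true  _ _ ¬c c _ = ¬c c
      nondegenerate true  false _ ¬b _ _ b = ¬b b
      nondegenerate false true  _ ¬b _ _ b = ¬b b
      nondegenerate false false _ _ ¬c c _ = ¬c c

    -- Omitting a vertex on each side settles both at once, whether or not they are bipartite, at
    -- the price of i ≤ n - 2.
    positive-missing-two : 2 ≤ i → suc i ℕ.< n → 0ℤ < gap
    positive-missing-two 2≤i i+1<n =
      let (c , sz , lo , hi) = interpolate keep upper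
                                 (keep-avoids Q.p≢u Q.p≢v _ (keep-avoids P.p≢u P.p≢v everything (λ _ _ → refl))) i
                                 (subst (_≤ i) (sym count-keep) 2≤i) (ℕ.s≤s⁻¹ (ℕ.s≤s⁻¹ (subst (suc i ℕ.<_) (sym count-upper) i+1<n)))
          missing-p = misses c (spare du dv true) (hi P.p (remove-false Q.p (remove P.p everything) {P.p} (remove-at P.p everything)))
          missing-q = misses c (spare du dv false) (hi Q.p (remove-at Q.p (remove P.p everything)))
      in gap-positive c (sz , lo) λ { true (contains , _) → missing-p contains ; false (contains , _) → missing-q contains }
      where
      module P = Spare (spare du dv true)
      module Q = Spare (spare du dv false)
      p≢q : P.p ≢ Q.p
      p≢q e = Boolₚ.not-¬ P.side-p (trans (cong side e) Q.side-p)
      upper : Fin n → Bool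
      upper = remove Q.p (remove P.p everything)
      count-upper : suc (suc (count upper)) ≡ n
      count-upper = trans (cong suc (sym (count-delete (remove P.p everything) Q.p (cong not (==-≢ (p≢q ∘ sym)))))) (count-remove-one P.p)

    -- No set with fewer than two elements contains both u and v.
    zero-small : i ℕ.< 2 → gap ≡ 0ℤ
    zero-small i<2 = gap-zero λ c (sz , k) → ⊥-elim (ℕₚ.<⇒≱ i<2
      (subst₂ _≤_ count-keep sz (count-mono k)))

    zero-full : i ≡ n → Bipartite (half true) ⊎ Bipartite (half false) → gap ≡ 0ℤ
    zero-full refl one = gap-zero λ c (sz , _) → pick c one (count-full (lookup c) sz)
      where
      pick : ∀ c → Bipartite (half true) ⊎ Bipartite (half false) → (∀ y → lookup c y ≡ true) → ∃ λ t → Degenerate c t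
      pick c (inj₁ bip) full = true , (λ y _ → full y) , bip
      pick c (inj₂ bip) full = false , (λ y _ → full y) , bip

    contains? : ∀ t c → Contains t c ⊎ ∃ λ y → side y ≡ t × lookup c y ≡ false
    contains? t c with Finₚ.any? (λ y → (side y Bool.≟ t) ×-dec (lookup c y Bool.≟ false))
    ... | yes (y , e) = inj₂ (y , e)
    ... | no none = inj₁ λ y s → Boolₚ.¬-not λ e → none (y , s , e)

    -- A set that omits at most one vertex contains one of the two sides, and both are bipartite.
    zero-almost-full : n ≤ suc i → Bipartite A → gap ≡ 0ℤ
    zero-almost-full n≤1+i bip = gap-zero λ c (sz , _) → pick c sz (contains? true c) (contains? false c)
      where
      pick : ∀ c → size c ≡ i → Contains true c ⊎ (∃ λ y → side y ≡ true × lookup c y ≡ false) →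
        Contains false c ⊎ (∃ λ y → side y ≡ false × lookup c y ≡ false) → ∃ λ t → Degenerate c t
      pick c sz (inj₁ h) _        = true , h , bipartite-half bip true
      pick c sz (inj₂ _) (inj₁ h) = false , h , bipartite-half bip false
      pick c sz (inj₂ (y , sy , cy)) (inj₂ (z , sz′ , cz)) = ⊥-elim (ℕₚ.<⇒≱ too-small (subst (n ≤_) (cong suc (sym sz)) n≤1+i))
        where
        z≢y : z ≢ y
        z≢y refl = Boolₚ.not-¬ sy sz′
        too-small : suc (size c) ℕ.< n
        too-small = subst₂ ℕ._<_ (count-insert (lookup c) y cy) (count-all n)
          (count-strict (λ _ _ → refl) z (cong₂ _∨_ cz (==-≢ z≢y)) refl)

    small : i ≡ 0 ⊎ i ≡ 1 → i ℕ.< 2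
    small (inj₁ e) = subst (ℕ._< 2) (sym e) (s≤s z≤n)
    small (inj₂ e) = subst (ℕ._< 2) (sym e) (s≤s (s≤s z≤n))

    nonbipartite-case : Bipartite (half true) ⊎ Bipartite (half false) → ¬ Bipartite A →
      φ A i ≡ φ G i ⇔ (i ≡ 0 ⊎ i ≡ 1 ⊎ i ≡ n)
    nonbipartite-case one nonbip = mk⇔ to from
      where
      positive : Bipartite (half true) ⊎ Bipartite (half false) → 2 ≤ i → i ℕ.< n → 0ℤ < gap
      positive (inj₁ bip) 2≤i i<n = positive-missing-one true (λ bip′ → nonbip (bipartite-halves bip bip′)) 2≤i i<n
      positive (inj₂ bip) 2≤i i<n = positive-missing-one false (λ bip′ → nonbip (bipartite-halves bip′ bip)) 2≤i i<n
      to : φ A i ≡ φ G i → i ≡ 0 ⊎ i ≡ 1 ⊎ i ≡ n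
      to e with i ℕ.≟ 0 | i ℕ.≟ 1 | i ℕ.≟ n
      ... | yes p | _     | _     = inj₁ p
      ... | no _  | yes p | _     = inj₂ (inj₁ p)
      ... | no _  | no _  | yes p = inj₂ (inj₂ p)
      ... | no p  | no q  | no r  = ⊥-elim (gap-positive⇒ (positive one (≢0,1⇒≥2 i p q) (ℕₚ.≤∧≢⇒< i≤n r)) e)
      from : i ≡ 0 ⊎ i ≡ 1 ⊎ i ≡ n → φ A i ≡ φ G i
      from (inj₁ p)        = gap-zero⇒ (zero-small (small (inj₁ p)))
      from (inj₂ (inj₁ p)) = gap-zero⇒ (zero-small (small (inj₂ p)))
      from (inj₂ (inj₂ p)) = gap-zero⇒ (zero-full p one)

    bipartite-case : Bipartite A → φ A i ≡ φ G i ⇔ (i ≡ 0 ⊎ i ≡ 1 ⊎ i ≡ n ∸ 1 ⊎ i ≡ n)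
    bipartite-case bip = mk⇔ to from
      where
      to : φ A i ≡ φ G i → i ≡ 0 ⊎ i ≡ 1 ⊎ i ≡ n ∸ 1 ⊎ i ≡ n
      to e with i ℕ.≟ 0 | i ℕ.≟ 1 | i ℕ.≟ n ∸ 1 | i ℕ.≟ n
      ... | yes p | _     | _     | _     = inj₁ p
      ... | no _  | yes p | _     | _     = inj₂ (inj₁ p)
      ... | no _  | no _  | yes p | _     = inj₂ (inj₂ (inj₁ p))
      ... | no _  | no _  | no _  | yes p = inj₂ (inj₂ (inj₂ p))
      ... | no p  | no q  | no r  | no s  = ⊥-elim (gap-positive⇒ (positive-missing-two (≢0,1⇒≥2 i p q)
        (ℕₚ.≤∧≢⇒< (ℕₚ.≤∧≢⇒< i≤n s) λ e → r (cong ℕ.pred e))) e)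
      from : i ≡ 0 ⊎ i ≡ 1 ⊎ i ≡ n ∸ 1 ⊎ i ≡ n → φ A i ≡ φ G i
      from (inj₁ p)               = gap-zero⇒ (zero-small (small (inj₁ p)))
      from (inj₂ (inj₁ p))        = gap-zero⇒ (zero-small (small (inj₂ p)))
      from (inj₂ (inj₂ (inj₁ p))) = gap-zero⇒ (zero-almost-full (subst (λ t → n ≤ suc t) (sym p) (ℕₚ.m≤n+m∸n n 1)) bip)
      from (inj₂ (inj₂ (inj₂ p))) = gap-zero⇒ (zero-almost-full (subst (λ t → n ≤ suc t) (sym p) (ℕₚ.n≤1+n n)) bip)

theorem2p2 : ∀ (n : ℕ) (A : Adj n) → Unicyclic A → (u v : Fin n) →
    A u v ≡ true → 2 ≤ deg A u → 2 ≤ deg A v →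
    (∀ (C : Cycle A) → ¬ CycleEdge C u v) →
    ∀ (i : ℕ) → i ≤ n →
    (φ (contractPendent A u v) i ≤ℤ φ A i)
    × (¬ Bipartite A → (φ A i ≡ φ (contractPendent A u v) i ⇔ (i ≡ 0 ⊎ i ≡ 1 ⊎ i ≡ n)))
    × (Bipartite A → (φ A i ≡ φ (contractPendent A u v) i ⇔ (i ≡ 0 ⊎ i ≡ 1 ⊎ i ≡ n ∸ 1 ⊎ i ≡ n)))
theorem2p2 n A (A-simple , A-connected , unique) u v uv du dv nonCycle i i≤n =
  ≤-φ , nonbipartite-case (one-half-bipartite unique) , bipartite-case
  where
  open Bridge A A-simple A-connected u v uv nonCycle using (one-half-bipartite)
  open Comparison A A-simple A-connected u v uv nonCycle
  open Coefficient i i≤n using (≤-φ)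
  open Conclusion du dv i i≤n using (nonbipartite-case; bipartite-case)
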